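{- For every odd prime $p>2$, \[ \sum_{k=0}^{\frac{p-1}{2}}\frac{(-1)^k(172k^2+75k+9)}{2^{12k}}\binom{2k}{k}^3\binom{3k}{k}\binom{4k}{2k} \equiv 9p^2+6p^3q_p(2)-9p^4q_p(2)^2 \pmod{p^5}. \]
   Context: For an odd prime $p$, the Fermat quotient is $q_p(2)=\frac{2^{p-1}-1}{p}$. Congruences between rational numbers whose denominators are coprime to $p$ are understood in the ring of $p$-integral rationals. -}

module Defs where

open import Data.Integer.Base as ℤ using (ℤ; +_; -1ℤ)
open import Data.Nat.Base as ℕ using (ℕ; NonZero)
open import Data.Nat.Combinatorics using (_C_)
open import Data.Nat.Coprimality using (Coprime)
open import Data.Nat.Properties using (m^n≢0)
open import Data.Rational.Base using (ℚ; _/_; _-_; _*_; ↧ₙ_; +-*-rawSemiring)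
open import Relation.Binary.PropositionalEquality using (_≡_)

open import Algebra.Definitions.RawSemiring +-*-rawSemiring public using (_^_)

fromℕ : ℕ → ℚ
fromℕ n = + n / 1

-- Elements of ℚ are in lowest terms, so for prime p this says that x
-- belongs to the localisation ℤ₍ₚ₎.
Integral : ℕ → ℚ → Set
Integral p x = Coprime p (↧ₙ x)

-- Congruence modulo m in the ring ℤ₍ₚ₎ of p-integral rationals: both sides
-- are p-integral and their difference lies in the ideal m ℤ₍ₚ₎.
infix 4 _≅_[mod_]inℤ₍_₎

record _≅_[mod_]inℤ₍_₎ (x y : ℚ) (m p : ℕ) : Set where
  constructor congruence
  field
    integralˡ        : Integral p x
    integralʳ        : Integral p y
    quotient         : ℚ
    integralQuotient : Integral p quotient
    equality         : x - y ≡ fromℕ m * quotient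

fermatQuotient : (p a : ℕ) .{{_ : NonZero p}} → ℚ
fermatQuotient p a = (+ (a ℕ.^ (p ℕ.∸ 1)) ℤ.- + 1) / p

summand : ℕ → ℚ
summand k =
  ((-1ℤ ℤ.^ k ℤ.* + (172 ℕ.* k ℕ.^ 2 ℕ.+ 75 ℕ.* k ℕ.+ 9)) / (2 ℕ.^ (12 ℕ.* k)))
    * fromℕ ((2 ℕ.* k) C k) ^ 3
    * fromℕ ((3 ℕ.* k) C k)
    * fromℕ ((4 ℕ.* k) C (2 ℕ.* k))
  where
  instance
    2^12k≢0 : NonZero (2 ℕ.^ (12 ℕ.* k))
    2^12k≢0 = m^n≢0 2 (12 ℕ.* k)

{-# OPTIONS --safe #-}

-- Write p = 2P + 1, m = 2^(p−1), and let F and G be the WZ pair below.  It comes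
-- from Dougall's ₅H₅ sum run backwards; − G 0 n is the n-th summand, so telescoping
-- turns the sum over n ≤ P into the sum of F k (P − k) over k ≤ P.  The two extreme
-- terms of the new sum are products of factorials, hence of the form p² times a
-- unit, and each of the others is the first one times a rational number ρ k that
-- is divisible by p.  Modulo p³, (1 + p)(1 + 2p) ρ k differs from the binomial
-- coefficient C(2p+2, 2k+2) by p² times reciprocal squares, whose sum over k is known
-- modulo p.  Binomial coefficients of even index add up to powers of 4, and the
-- theorems of Wolstenholme, C(2p−1, p) ≡ 1, and of Morley, (−1)^P C(p−1, P) ≡ m²,
-- both modulo p³, give p² (12 − 3 / m²) modulo p⁵; this is the right-hand side,
-- because m = 1 + p q.
module Submission where

open import Defs
open import Data.Fin.Base as Fin using (toℕ)
import Data.Fin.Properties as Fin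
open import Data.Integer.Base as ℤ using (ℤ)
import Data.Integer.Divisibility.Signed as ℤᵈ
import Data.Integer.Properties as ℤ
open import Data.Nat.Base as ℕ using (ℕ; zero; suc; _<_; _≤_; _∸_; NonZero; _!; z≤n; s≤s)
open import Data.Nat.Combinatorics using (_C_; k![n∸k]!∣n!; nCk+nC[k+1]≡[n+1]C[k+1]; nCk≡nC[n∸k]; nC1≡n)
open import Data.Nat.Combinatorics.Specification using (nCk≡n!/k![n-k]!; k>n⇒nCk≡0)
open import Data.Nat.Coprimality as Coprime using (Coprime; coprime-divisor)
open import Data.Nat.Divisibility as ℕ using (_∣_; _∣?_; divides)
import Data.Nat.DivMod as ℕ
open import Data.Nat.Primality using (Prime; prime⇒nonZero; prime⇒nonTrivial; prime⇒irreducible; euclidsLemma)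
import Data.Nat.Properties as ℕ
import Data.Nat.Tactic.RingSolver as ℕ-Solver
open import Data.Product.Base using (_,_)
open import Data.Rational.Base using (ℚ; mkℚ; _/_; _+_; _-_; _*_; -_; 0ℚ; 1ℚ; ½)
import Data.Rational.Properties as ℚ
open import Data.Rational.Properties using (+-0-commutativeMonoid)
open import Data.Rational.Unnormalised.Base as ℚᵘ using (mkℚᵘ)
import Data.Rational.Unnormalised.Properties as ℚᵘ
open import Data.Sum.Base using (inj₁; inj₂)
open import Algebra.Properties.CommutativeMonoid.Sum +-0-commutativeMonoid using (sum⁺-syntax; sum-cong-≗; sum-init-last)
open import Function.Base using (_∘_)
open import Relation.Binary.PropositionalEquality using (_≡_; refl; sym; trans; cong; cong₂; subst; module ≡-Reasoning)
open import Relation.Nullary.Decidable.Core using (yes; no; dec⇒maybe)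
open import Relation.Nullary.Negation.Core using (¬_; contradiction)
open import Tactic.RingSolver using (solve-∀)
open import Tactic.RingSolver.Core.AlmostCommutativeRing using (AlmostCommutativeRing; fromCommutativeRing)

open ≡-Reasoning

ℚ-ring : AlmostCommutativeRing _ _
ℚ-ring = fromCommutativeRing ℚ.+-*-commutativeRing (λ x → dec⇒maybe (0ℚ ℚ.≟ x))

ι : ℕ → ℚ
ι = fromℕ

open import Tactic.RingSolver.NonReflective ℚ-ring using (Expr; Κ; solve)
  renaming (_⊕_ to infixl 6 _:+_; _⊗_ to infixl 7 _:*_; ⊝_ to infix 8 :-_; _⊜_ to infix 4 _:=_)

infixl 6 _:-_
_:-_ : ∀ {n} → Expr ℚ n → Expr ℚ n → Expr ℚ n
x :- y = x :+ :- y

con : ∀ {n} → ℕ → Expr ℚ n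
con k = Κ (ι k)

/1-homo-+ : ∀ i j → (i ℤ.+ j) / 1 ≡ i / 1 + j / 1
/1-homo-+ i j = ℚ.toℚᵘ-injective (ℚᵘ.≃-trans (ℚ.toℚᵘ-fromℚᵘ (mkℚᵘ (i ℤ.+ j) 0)) (ℚᵘ.≃-sym
  (ℚᵘ.≃-trans (ℚ.toℚᵘ-homo-+ (i / 1) (j / 1))
  (ℚᵘ.≃-trans (ℚᵘ.+-cong (ℚ.toℚᵘ-fromℚᵘ (mkℚᵘ i 0)) (ℚ.toℚᵘ-fromℚᵘ (mkℚᵘ j 0)))
    (ℚᵘ.*≡* (cong (ℤ._* ℤ.+ 1) (cong₂ ℤ._+_ (ℤ.*-identityʳ i) (ℤ.*-identityʳ j))))))))

/1-homo-* : ∀ i j → (i ℤ.* j) / 1 ≡ i / 1 * (j / 1)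
/1-homo-* i j = ℚ.toℚᵘ-injective (ℚᵘ.≃-trans (ℚ.toℚᵘ-fromℚᵘ (mkℚᵘ (i ℤ.* j) 0)) (ℚᵘ.≃-sym
  (ℚᵘ.≃-trans (ℚ.toℚᵘ-homo-* (i / 1) (j / 1))
    (ℚᵘ.*-cong (ℚ.toℚᵘ-fromℚᵘ (mkℚᵘ i 0)) (ℚ.toℚᵘ-fromℚᵘ (mkℚᵘ j 0))))))

/1-homo-neg : ∀ i → (ℤ.- i) / 1 ≡ - (i / 1)
/1-homo-neg i = ℚ.toℚᵘ-injective (ℚᵘ.≃-trans (ℚ.toℚᵘ-fromℚᵘ (mkℚᵘ (ℤ.- i) 0)) (ℚᵘ.≃-sym
  (ℚᵘ.≃-trans (ℚ.toℚᵘ-homo‿- (i / 1)) (ℚᵘ.-‿cong (ℚ.toℚᵘ-fromℚᵘ (mkℚᵘ i 0))))))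

/-*-cancel : ∀ i d .{{_ : NonZero d}} → i / d * ι d ≡ i / 1
/-*-cancel i d@(suc d-1) = ℚ.toℚᵘ-injective
  (ℚᵘ.≃-trans (ℚ.toℚᵘ-homo-* (i / d) (ι d))
  (ℚᵘ.≃-trans (ℚᵘ.*-cong (ℚ.toℚᵘ-fromℚᵘ (mkℚᵘ i d-1)) (ℚ.toℚᵘ-fromℚᵘ (mkℚᵘ (ℤ.+ d) 0)))
  (ℚᵘ.≃-trans (ℚᵘ.*≡* (trans (ℤ.*-identityʳ _) (cong (λ e → i ℤ.* ℤ.+ e) (sym (ℕ.*-identityʳ d)))))
    (ℚᵘ.≃-sym (ℚ.toℚᵘ-fromℚᵘ (mkℚᵘ i 0))))))

ι-+ : ∀ m n → ι (m ℕ.+ n) ≡ ι m + ι n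
ι-+ m n = /1-homo-+ (ℤ.+ m) (ℤ.+ n)

ι-* : ∀ m n → ι (m ℕ.* n) ≡ ι m * ι n
ι-* m n = trans (cong (_/ 1) (ℤ.pos-* m n)) (/1-homo-* (ℤ.+ m) (ℤ.+ n))

ι-suc : ∀ n → ι (suc n) ≡ 1ℚ + ι n
ι-suc = ι-+ 1

recip : ℕ → ℚ
recip n = ℤ.+ 1 / suc n

recip-inverse : ∀ n → (1ℚ + ι n) * recip n ≡ 1ℚ
recip-inverse n = trans (ℚ.*-comm (1ℚ + ι n) (recip n))
  (trans (cong (recip n *_) (sym (ι-suc n))) (/-*-cancel (ℤ.+ 1) (suc n)))

!⁻¹ : ℕ → ℚ
!⁻¹ zero = 1ℚ
!⁻¹ (suc n) = !⁻¹ n * recip n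

!⁻¹-suc : ∀ n → !⁻¹ n ≡ (1ℚ + ι n) * !⁻¹ (suc n)
!⁻¹-suc n = begin
  !⁻¹ n                             ≡⟨ ℚ.*-identityʳ (!⁻¹ n) ⟨
  !⁻¹ n * 1ℚ                        ≡⟨ cong (!⁻¹ n *_) (recip-inverse n) ⟨
  !⁻¹ n * ((1ℚ + ι n) * recip n)    ≡⟨ rearrange (!⁻¹ n) (1ℚ + ι n) (recip n) ⟩
  (1ℚ + ι n) * (!⁻¹ n * recip n)    ∎
  where
  rearrange = solve 3 (λ x y z → x :* (y :* z) := y :* (x :* z)) refl

fac : ℕ → ℚ
fac n = ι (n !)

fac-suc : ∀ n → fac (suc n) ≡ (1ℚ + ι n) * fac n
fac-suc n = trans (ι-* (suc n) (n !)) (cong (_* fac n) (ι-suc n))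

fac-inverse : ∀ n → fac n * !⁻¹ n ≡ 1ℚ
fac-inverse zero = refl
fac-inverse (suc n) = begin
  fac (suc n) * !⁻¹ (suc n)           ≡⟨ cong (_* !⁻¹ (suc n)) (fac-suc n) ⟩
  (1ℚ + ι n) * fac n * !⁻¹ (suc n)    ≡⟨ rearrange (1ℚ + ι n) (fac n) (!⁻¹ (suc n)) ⟩
  fac n * ((1ℚ + ι n) * !⁻¹ (suc n))  ≡⟨ cong (fac n *_) (!⁻¹-suc n) ⟨
  fac n * !⁻¹ n                       ≡⟨ fac-inverse n ⟩
  1ℚ                                  ∎
  where
  rearrange = solve 3 (λ x y z → x :* y :* z := y :* (x :* z)) refl

-- (2n − 1)!!
oddFac : ℕ → ℚ
oddFac zero = 1ℚ
oddFac (suc n) = oddFac n * (ι 2 * ι n + 1ℚ)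

sgn : ℕ → ℚ
sgn zero = 1ℚ
sgn (suc n) = - sgn n

64⁻^ : ℕ → ℚ
64⁻^ zero = 1ℚ
64⁻^ (suc n) = 64⁻^ n * (ℤ.+ 1 / 64)

-- The certificate of the WZ pair, found by Gosper's algorithm.
X : ℚ → ℚ → ℚ
X n k = (ι 128 * n * n + ι 76 * n + ι 16) * k * k - ι 16 * k * k * k * k
  - (ι 172 * n * n + ι 75 * n + ι 9) * (ι 2 * n + 1ℚ) * (ι 2 * n + 1ℚ)

weight : ℕ → ℚ
weight n = 64⁻^ n * (oddFac n * oddFac n) * oddFac (n ℕ.+ n) * fac (n ℕ.+ n ℕ.+ n) * !⁻¹ n * !⁻¹ (n ℕ.+ n)

core : ℕ → ℕ → ℕ → ℚ
core n k r = sgn r * oddFac (n ℕ.+ k) * oddFac r * !⁻¹ (n ℕ.+ k) * !⁻¹ r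

-- These are used at n = 1 + k + r and n = k + r respectively; a separate argument n
-- lets the indices be shifted without rewriting inside n.
F̂ Ĝ : ℕ → ℕ → ℕ → ℚ
F̂ n k r = ι 128 * ι n * weight n * (core n k r * (!⁻¹ (n ℕ.+ r) * !⁻¹ (n ℕ.+ n ℕ.+ k)))
Ĝ n k r = weight n * (core n k r * (!⁻¹ (suc (n ℕ.+ r)) * !⁻¹ (suc (n ℕ.+ n ℕ.+ k)))) * X (ι n) (ι k)

64⁻^-suc : ∀ n → 64⁻^ n ≡ ι 64 * 64⁻^ (suc n)
64⁻^-suc n = lem (64⁻^ n)
  where
  lem = solve 1 (λ x → x := con 64 :* (x :* Κ (ℤ.+ 1 / 64))) refl

module Double (n : ℕ) where
  suc+suc : suc n ℕ.+ suc n ≡ suc (suc (n ℕ.+ n))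
  suc+suc = cong suc (ℕ.+-suc n n)

  suc+suc+suc : suc n ℕ.+ suc n ℕ.+ suc n ≡ suc (suc (suc (n ℕ.+ n ℕ.+ n)))
  suc+suc+suc = trans (cong (ℕ._+ suc n) suc+suc) (cong (λ x → suc (suc x)) (ℕ.+-suc (n ℕ.+ n) n))

  ι2n : ι (n ℕ.+ n) ≡ ι 2 * ι n
  ι2n = trans (ι-+ n n) (lem (ι n))
    where
    lem = solve 1 (λ x → x :+ x := con 2 :* x) refl

  ι3n : ι (n ℕ.+ n ℕ.+ n) ≡ ι 3 * ι n
  ι3n = trans (ι-+ (n ℕ.+ n) n) (trans (cong (_+ ι n) ι2n) (lem (ι n)))
    where
    lem = solve 1 (λ x → con 2 :* x :+ x := con 3 :* x) refl

  oddFac-2suc : oddFac (suc n ℕ.+ suc n) ≡ oddFac (n ℕ.+ n) * ((ι 4 * ι n + 1ℚ) * (ι 4 * ι n + ι 3))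
  oddFac-2suc = begin
    oddFac (suc n ℕ.+ suc n) ≡⟨ cong oddFac suc+suc ⟩
    oddFac (n ℕ.+ n) * (ι 2 * ι (n ℕ.+ n) + 1ℚ) * (ι 2 * ι (suc (n ℕ.+ n)) + 1ℚ)
      ≡⟨ cong₂ (λ x y → oddFac (n ℕ.+ n) * (ι 2 * x + 1ℚ) * (ι 2 * y + 1ℚ)) ι2n (trans (ι-suc (n ℕ.+ n)) (cong (1ℚ +_) ι2n)) ⟩
    oddFac (n ℕ.+ n) * (ι 2 * (ι 2 * ι n) + 1ℚ) * (ι 2 * (1ℚ + ι 2 * ι n) + 1ℚ) ≡⟨ lem (oddFac (n ℕ.+ n)) (ι n) ⟩
    oddFac (n ℕ.+ n) * ((ι 4 * ι n + 1ℚ) * (ι 4 * ι n + ι 3)) ∎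
    where
    lem = solve 2 (λ o x →
      o :* (con 2 :* (con 2 :* x) :+ con 1) :* (con 2 :* (con 1 :+ con 2 :* x) :+ con 1)
      := o :* ((con 4 :* x :+ con 1) :* (con 4 :* x :+ con 3))) refl

  !⁻¹-2suc : !⁻¹ (n ℕ.+ n) ≡ (ι 2 * ι n + 1ℚ) * (ι 2 * ι n + ι 2) * !⁻¹ (suc n ℕ.+ suc n)
  !⁻¹-2suc = begin
    !⁻¹ (n ℕ.+ n) ≡⟨ trans (!⁻¹-suc (n ℕ.+ n)) (cong ((1ℚ + ι (n ℕ.+ n)) *_) (!⁻¹-suc (suc (n ℕ.+ n)))) ⟩
    (1ℚ + ι (n ℕ.+ n)) * ((1ℚ + ι (suc (n ℕ.+ n))) * !⁻¹ (suc (suc (n ℕ.+ n))))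
      ≡⟨ cong₂ (λ x y → (1ℚ + x) * ((1ℚ + y) * !⁻¹ (suc (suc (n ℕ.+ n))))) ι2n (trans (ι-suc (n ℕ.+ n)) (cong (1ℚ +_) ι2n)) ⟩
    (1ℚ + ι 2 * ι n) * ((1ℚ + (1ℚ + ι 2 * ι n)) * !⁻¹ (suc (suc (n ℕ.+ n)))) ≡⟨ lem (!⁻¹ (suc (suc (n ℕ.+ n)))) (ι n) ⟩
    (ι 2 * ι n + 1ℚ) * (ι 2 * ι n + ι 2) * !⁻¹ (suc (suc (n ℕ.+ n))) ≡⟨ cong (λ m → (ι 2 * ι n + 1ℚ) * (ι 2 * ι n + ι 2) * !⁻¹ m) suc+suc ⟨
    (ι 2 * ι n + 1ℚ) * (ι 2 * ι n + ι 2) * !⁻¹ (suc n ℕ.+ suc n) ∎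
    where
    lem = solve 2 (λ o x →
      (con 1 :+ con 2 :* x) :* ((con 1 :+ (con 1 :+ con 2 :* x)) :* o)
      := (con 2 :* x :+ con 1) :* (con 2 :* x :+ con 2) :* o) refl

  fac-3suc : fac (suc n ℕ.+ suc n ℕ.+ suc n) ≡ (ι 3 * ι n + 1ℚ) * (ι 3 * ι n + ι 2) * (ι 3 * ι n + ι 3) * fac (n ℕ.+ n ℕ.+ n)
  fac-3suc = begin
    fac (suc n ℕ.+ suc n ℕ.+ suc n) ≡⟨ cong fac suc+suc+suc ⟩
    fac (suc (suc (suc N))) ≡⟨ trans (fac-suc (suc (suc N))) (cong ((1ℚ + ι (suc (suc N))) *_) (trans (fac-suc (suc N)) (cong ((1ℚ + ι (suc N)) *_) (fac-suc N)))) ⟩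
    (1ℚ + ι (2 ℕ.+ N)) * ((1ℚ + ι (1 ℕ.+ N)) * ((1ℚ + ι N) * fac N))
      ≡⟨ cong₂ (λ x y → (1ℚ + x) * ((1ℚ + y) * ((1ℚ + ι N) * fac N))) (ι-+ 2 N) (ι-+ 1 N) ⟩
    (1ℚ + (ι 2 + ι N)) * ((1ℚ + (1ℚ + ι N)) * ((1ℚ + ι N) * fac N)) ≡⟨ cong (λ x → (1ℚ + (ι 2 + x)) * ((1ℚ + (1ℚ + x)) * ((1ℚ + x) * fac N))) ι3n ⟩
    (1ℚ + (ι 2 + ι 3 * ι n)) * ((1ℚ + (1ℚ + ι 3 * ι n)) * ((1ℚ + ι 3 * ι n) * fac N)) ≡⟨ lem (fac N) (ι n) ⟩
    (ι 3 * ι n + 1ℚ) * (ι 3 * ι n + ι 2) * (ι 3 * ι n + ι 3) * fac N ∎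
    where
    N = n ℕ.+ n ℕ.+ n
    lem = solve 2 (λ o x →
      (con 1 :+ (con 2 :+ con 3 :* x)) :* ((con 1 :+ (con 1 :+ con 3 :* x)) :* ((con 1 :+ con 3 :* x) :* o))
      := (con 3 :* x :+ con 1) :* (con 3 :* x :+ con 2) :* (con 3 :* x :+ con 3) :* o) refl

wz-polynomial = solve 3 (λ Y k r →
  let n = k :+ r :+ con 1
      a = con 2 :* n :+ con 1
      X′ : Expr ℚ 3 → Expr ℚ 3
      X′ k = (con 128 :* n :* n :+ con 76 :* n :+ con 16) :* k :* k :- con 16 :* k :* k :* k :* k
        :- (con 172 :* n :* n :+ con 75 :* n :+ con 9) :* a :* a
  in :- con 128 :* (Y :* a :* a :* (con 4 :* n :+ con 1) :* (con 4 :* n :+ con 3) :* (con 3 :* n :+ con 1) :* (con 3 :* n :+ con 2)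
      :* (con 3 :* n :+ con 3) :* (con 2 :* (n :+ k) :+ con 1) :* (con 2 :* r :+ con 1))
    :- con 8192 :* (Y :* n :* a :* (con 2 :* n :+ con 2) :* (n :+ k :+ con 1) :* (r :+ con 1) :* (n :+ r :+ con 1) :* (n :+ r :+ con 2)
      :* (con 2 :* n :+ k :+ con 1) :* (con 2 :* n :+ k :+ con 2))
    := con 64 :* (Y :* a :* (con 2 :* n :+ con 2) :* (con 2 :* (n :+ k) :+ con 1) :* (r :+ con 1) :* (n :+ r :+ con 2) :* X′ (con 1 :+ k))
    :- (:- con 64) :* (Y :* a :* (con 2 :* n :+ con 2) :* (con 2 :* r :+ con 1) :* (n :+ k :+ con 1) :* (con 2 :* n :+ k :+ con 2) :* X′ k)) refl

module WZ (n k r : ℕ) where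
  open Double n

  v : ℚ
  v = 64⁻^ (suc n) * (oddFac n * oddFac n) * oddFac (n ℕ.+ n) * fac (n ℕ.+ n ℕ.+ n) * !⁻¹ (suc n) * !⁻¹ (suc n ℕ.+ suc n)

  t : ℚ
  t = sgn r * oddFac (n ℕ.+ k) * oddFac r * !⁻¹ (suc (n ℕ.+ k)) * !⁻¹ (suc r)

  !⁻¹₁ !⁻¹₂ : ℚ
  !⁻¹₁ = !⁻¹ (suc (suc (n ℕ.+ r)))
  !⁻¹₂ = !⁻¹ (suc (suc (n ℕ.+ n ℕ.+ k)))

  weight-n : weight n ≡ v * (ι 64 * (1ℚ + ι n) * (ι 2 * ι n + 1ℚ) * (ι 2 * ι n + ι 2))
  weight-n = trans (cong (λ x → x * (oddFac n * oddFac n) * oddFac (n ℕ.+ n) * fac (n ℕ.+ n ℕ.+ n) * !⁻¹ n * !⁻¹ (n ℕ.+ n)) (64⁻^-suc n))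
    (trans (cong₂ (λ y z → ι 64 * 64⁻^ (suc n) * (oddFac n * oddFac n) * oddFac (n ℕ.+ n) * fac (n ℕ.+ n ℕ.+ n) * y * z) (!⁻¹-suc n) !⁻¹-2suc)
      (lem (64⁻^ (suc n)) (oddFac n) (oddFac (n ℕ.+ n)) (fac (n ℕ.+ n ℕ.+ n)) (!⁻¹ (suc n)) (!⁻¹ (suc n ℕ.+ suc n)) (1ℚ + ι n) (ι 2 * ι n + 1ℚ) (ι 2 * ι n + ι 2)))
    where
    lem = solve 9 (λ e d D f p q x y z →
      con 64 :* e :* (d :* d) :* D :* f :* (x :* p) :* (y :* z :* q)
      := e :* (d :* d) :* D :* f :* p :* q :* (con 64 :* x :* y :* z)) refl

  weight-suc : weight (suc n) ≡ v * ((ι 2 * ι n + 1ℚ) * (ι 2 * ι n + 1ℚ) * (ι 4 * ι n + 1ℚ) * (ι 4 * ι n + ι 3)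
    * (ι 3 * ι n + 1ℚ) * (ι 3 * ι n + ι 2) * (ι 3 * ι n + ι 3))
  weight-suc = trans (cong₂ (λ D f → 64⁻^ (suc n) * (oddFac (suc n) * oddFac (suc n)) * D * f * !⁻¹ (suc n) * !⁻¹ (suc n ℕ.+ suc n)) oddFac-2suc fac-3suc)
    (lem (64⁻^ (suc n)) (oddFac n) (oddFac (n ℕ.+ n)) (fac (n ℕ.+ n ℕ.+ n)) (!⁻¹ (suc n)) (!⁻¹ (suc n ℕ.+ suc n)) (ι 2 * ι n + 1ℚ) (ι 4 * ι n + 1ℚ) (ι 4 * ι n + ι 3)
      (ι 3 * ι n + 1ℚ) (ι 3 * ι n + ι 2) (ι 3 * ι n + ι 3))
    where
    lem = solve 12 (λ e d D f p q x y z a b c →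
      e :* (d :* x :* (d :* x)) :* (D :* (y :* z)) :* (a :* b :* c :* f) :* p :* q
      := e :* (d :* d) :* D :* f :* p :* q :* (x :* x :* y :* z :* a :* b :* c)) refl

  !⁻¹[n+k] : !⁻¹ (n ℕ.+ k) ≡ (ι n + ι k + 1ℚ) * !⁻¹ (suc (n ℕ.+ k))
  !⁻¹[n+k] = trans (!⁻¹-suc (n ℕ.+ k)) (cong (_* !⁻¹ (suc (n ℕ.+ k))) (trans (ℚ.+-comm 1ℚ (ι (n ℕ.+ k))) (cong (_+ 1ℚ) (ι-+ n k))))

  !⁻¹[r] : !⁻¹ r ≡ (ι r + 1ℚ) * !⁻¹ (suc r)
  !⁻¹[r] = trans (!⁻¹-suc r) (cong (_* !⁻¹ (suc r)) (ℚ.+-comm 1ℚ (ι r)))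

  ι[2+] : ∀ m → 1ℚ + ι (suc m) ≡ ι m + ι 2
  ι[2+] m = trans (sym (ι-suc (suc m))) (trans (ι-+ 2 m) (ℚ.+-comm (ι 2) (ι m)))

  !⁻¹[1+n+r] : !⁻¹ (suc (n ℕ.+ r)) ≡ (ι n + ι r + ι 2) * !⁻¹₁
  !⁻¹[1+n+r] = trans (!⁻¹-suc (suc (n ℕ.+ r))) (cong (_* !⁻¹₁) (trans (ι[2+] (n ℕ.+ r)) (cong (_+ ι 2) (ι-+ n r))))

  !⁻¹[n+r] : !⁻¹ (n ℕ.+ r) ≡ (ι n + ι r + 1ℚ) * ((ι n + ι r + ι 2) * !⁻¹₁)
  !⁻¹[n+r] = trans (!⁻¹-suc (n ℕ.+ r)) (cong₂ _*_ (trans (ℚ.+-comm 1ℚ (ι (n ℕ.+ r))) (cong (_+ 1ℚ) (ι-+ n r))) !⁻¹[1+n+r])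

  ι[2n+k] : ι (n ℕ.+ n ℕ.+ k) ≡ ι 2 * ι n + ι k
  ι[2n+k] = trans (ι-+ (n ℕ.+ n) k) (cong (_+ ι k) ι2n)

  !⁻¹[1+2n+k] : !⁻¹ (suc (n ℕ.+ n ℕ.+ k)) ≡ (ι 2 * ι n + ι k + ι 2) * !⁻¹₂
  !⁻¹[1+2n+k] = trans (!⁻¹-suc (suc (n ℕ.+ n ℕ.+ k))) (cong (_* !⁻¹₂) (trans (ι[2+] (n ℕ.+ n ℕ.+ k)) (cong (_+ ι 2) ι[2n+k])))

  !⁻¹[2n+k] : !⁻¹ (n ℕ.+ n ℕ.+ k) ≡ (ι 2 * ι n + ι k + 1ℚ) * ((ι 2 * ι n + ι k + ι 2) * !⁻¹₂)
  !⁻¹[2n+k] = trans (!⁻¹-suc (n ℕ.+ n ℕ.+ k)) (cong₂ _*_ (trans (ℚ.+-comm 1ℚ (ι (n ℕ.+ n ℕ.+ k))) (cong (_+ 1ℚ) ι[2n+k])) !⁻¹[1+2n+k])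

  oddFac[1+n+k] : oddFac (suc (n ℕ.+ k)) ≡ oddFac (n ℕ.+ k) * (ι 2 * (ι n + ι k) + 1ℚ)
  oddFac[1+n+k] = cong (λ x → oddFac (n ℕ.+ k) * (ι 2 * x + 1ℚ)) (ι-+ n k)

  core-n-k-r : core n k r ≡ t * ((ι n + ι k + 1ℚ) * (ι r + 1ℚ))
  core-n-k-r = trans (cong₂ (λ a b → sgn r * oddFac (n ℕ.+ k) * oddFac r * a * b) !⁻¹[n+k] !⁻¹[r])
    (lem (sgn r * oddFac (n ℕ.+ k) * oddFac r) (!⁻¹ (suc (n ℕ.+ k))) (!⁻¹ (suc r)) (ι n + ι k + 1ℚ) (ι r + 1ℚ))
    where
    lem = solve 5 (λ s a b x y → s :* (x :* a) :* (y :* b) := s :* a :* b :* (x :* y)) refl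

  core-n-k-1+r : core n k (suc r) ≡ t * (- ((ι 2 * ι r + 1ℚ) * (ι n + ι k + 1ℚ)))
  core-n-k-1+r = trans (cong (λ a → - sgn r * oddFac (n ℕ.+ k) * oddFac (suc r) * a * !⁻¹ (suc r)) !⁻¹[n+k])
    (lem (sgn r) (oddFac (n ℕ.+ k)) (oddFac r) (!⁻¹ (suc (n ℕ.+ k))) (!⁻¹ (suc r)) (ι n + ι k + 1ℚ) (ι 2 * ι r + 1ℚ))
    where
    lem = solve 7 (λ s d e a b x y → :- s :* d :* (e :* y) :* (x :* a) :* b := s :* d :* e :* a :* b :* (:- (y :* x))) refl

  core-n-1+k-r : core n (suc k) r ≡ t * ((ι 2 * (ι n + ι k) + 1ℚ) * (ι r + 1ℚ))
  core-n-1+k-r = trans (cong (λ m → sgn r * oddFac m * oddFac r * !⁻¹ m * !⁻¹ r) (ℕ.+-suc n k))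
    (trans (cong₂ (λ d b → sgn r * d * oddFac r * !⁻¹ (suc (n ℕ.+ k)) * b) oddFac[1+n+k] !⁻¹[r])
    (lem (sgn r) (oddFac (n ℕ.+ k)) (oddFac r) (!⁻¹ (suc (n ℕ.+ k))) (!⁻¹ (suc r)) (ι 2 * (ι n + ι k) + 1ℚ) (ι r + 1ℚ)))
    where
    lem = solve 7 (λ s d e a b x y → s :* (d :* x) :* e :* a :* (y :* b) := s :* d :* e :* a :* b :* (x :* y)) refl

  core-1+n-k-1+r : core (suc n) k (suc r) ≡ t * (- ((ι 2 * (ι n + ι k) + 1ℚ) * (ι 2 * ι r + 1ℚ)))
  core-1+n-k-1+r = trans (cong (λ d → - sgn r * d * oddFac (suc r) * !⁻¹ (suc (n ℕ.+ k)) * !⁻¹ (suc r)) oddFac[1+n+k])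
    (lem (sgn r) (oddFac (n ℕ.+ k)) (oddFac r) (!⁻¹ (suc (n ℕ.+ k))) (!⁻¹ (suc r)) (ι 2 * (ι n + ι k) + 1ℚ) (ι 2 * ι r + 1ℚ))
    where
    lem = solve 7 (λ s d e a b x y → :- s :* (d :* x) :* (e :* y) :* a :* b := s :* d :* e :* a :* b :* (:- (x :* y))) refl

  Y : ℚ
  Y = v * (1ℚ + ι n) * t * !⁻¹₁ * !⁻¹₂

  N K R : ℚ
  N = ι n
  K = ι k
  R = ι r

  F̂-1+n-k-1+r : F̂ (suc n) k (suc r) ≡ - ι 128 * (Y * (ι 2 * N + 1ℚ) * (ι 2 * N + 1ℚ) * (ι 4 * N + 1ℚ) * (ι 4 * N + ι 3)
    * (ι 3 * N + 1ℚ) * (ι 3 * N + ι 2) * (ι 3 * N + ι 3) * (ι 2 * (N + K) + 1ℚ) * (ι 2 * R + 1ℚ))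
  F̂-1+n-k-1+r = trans
    (cong₂ (λ i j → ι 128 * ι (suc n) * weight (suc n) * (core (suc n) k (suc r) * (!⁻¹ i * !⁻¹ j))) (cong suc (ℕ.+-suc n r)) (cong (ℕ._+ k) suc+suc))
    (trans (cong₂ (λ c w → ι 128 * ι (suc n) * w * (c * (!⁻¹₁ * !⁻¹₂))) core-1+n-k-1+r weight-suc)
    (trans (cong (λ m → ι 128 * m * (v * w) * (t * (- (x * y)) * (!⁻¹₁ * !⁻¹₂))) (ι-suc n))
    (lem v t x y !⁻¹₁ !⁻¹₂ (1ℚ + N) (ι 2 * N + 1ℚ) (ι 4 * N + 1ℚ) (ι 4 * N + ι 3) (ι 3 * N + 1ℚ) (ι 3 * N + ι 2) (ι 3 * N + ι 3))))
    where
    x y w : ℚ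
    x = ι 2 * (N + K) + 1ℚ
    y = ι 2 * R + 1ℚ
    w = (ι 2 * N + 1ℚ) * (ι 2 * N + 1ℚ) * (ι 4 * N + 1ℚ) * (ι 4 * N + ι 3) * (ι 3 * N + 1ℚ) * (ι 3 * N + ι 2) * (ι 3 * N + ι 3)
    lem = solve 13 (λ v t x y p q m a b c d e f →
      con 128 :* m :* (v :* (a :* a :* b :* c :* d :* e :* f)) :* (t :* (:- (x :* y)) :* (p :* q))
      := :- con 128 :* (v :* m :* t :* p :* q :* a :* a :* b :* c :* d :* e :* f :* x :* y)) refl

  F̂-n-k-r : F̂ n k r ≡ ι 8192 * (Y * N * (ι 2 * N + 1ℚ) * (ι 2 * N + ι 2) * (N + K + 1ℚ) * (R + 1ℚ) * (N + R + 1ℚ) * (N + R + ι 2)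
    * (ι 2 * N + K + 1ℚ) * (ι 2 * N + K + ι 2))
  F̂-n-k-r = trans (cong₂ (λ w c → ι 128 * N * w * (c * (!⁻¹ (n ℕ.+ r) * !⁻¹ (n ℕ.+ n ℕ.+ k)))) weight-n core-n-k-r)
    (trans (cong₂ (λ i j → ι 128 * N * (v * (ι 64 * (1ℚ + N) * (ι 2 * N + 1ℚ) * (ι 2 * N + ι 2))) * (t * ((N + K + 1ℚ) * (R + 1ℚ)) * (i * j))) !⁻¹[n+r] !⁻¹[2n+k])
    (lem v t !⁻¹₁ !⁻¹₂ N (1ℚ + N) (ι 2 * N + 1ℚ) (ι 2 * N + ι 2) (N + K + 1ℚ) (R + 1ℚ) (N + R + 1ℚ) (N + R + ι 2) (ι 2 * N + K + 1ℚ) (ι 2 * N + K + ι 2)))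
    where
    lem = solve 14 (λ v t p q n m a b x y c d e f →
      con 128 :* n :* (v :* (con 64 :* m :* a :* b)) :* (t :* (x :* y) :* (c :* (d :* p) :* (e :* (f :* q))))
      := con 8192 :* (v :* m :* t :* p :* q :* n :* a :* b :* x :* y :* c :* d :* e :* f)) refl

  Ĝ-n-1+k-r : Ĝ n (suc k) r ≡ ι 64 * (Y * (ι 2 * N + 1ℚ) * (ι 2 * N + ι 2) * (ι 2 * (N + K) + 1ℚ) * (R + 1ℚ) * (N + R + ι 2) * X N (1ℚ + K))
  Ĝ-n-1+k-r = trans (cong₂ (λ w c → w * (c * (!⁻¹ (suc (n ℕ.+ r)) * !⁻¹ (suc (n ℕ.+ n ℕ.+ suc k)))) * X N (ι (suc k))) weight-n core-n-1+k-r)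
    (trans (cong₂ (λ i j → v * w * (t * (x * y) * (i * !⁻¹ (suc j))) * X N (ι (suc k))) !⁻¹[1+n+r] (ℕ.+-suc (n ℕ.+ n) k))
    (trans (cong (λ m → v * w * (t * (x * y) * (z * !⁻¹₁ * !⁻¹₂)) * X N m) (ι-suc k))
    (lem v t !⁻¹₁ !⁻¹₂ (1ℚ + N) (ι 2 * N + 1ℚ) (ι 2 * N + ι 2) x y z (X N (1ℚ + K)))))
    where
    x y z w : ℚ
    x = ι 2 * (N + K) + 1ℚ
    y = R + 1ℚ
    z = N + R + ι 2
    w = ι 64 * (1ℚ + N) * (ι 2 * N + 1ℚ) * (ι 2 * N + ι 2)
    lem = solve 11 (λ v t p q m a b x y c X →
      v :* (con 64 :* m :* a :* b) :* (t :* (x :* y) :* (c :* p :* q)) :* X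
      := con 64 :* (v :* m :* t :* p :* q :* a :* b :* x :* y :* c :* X)) refl

  Ĝ-n-k-1+r : Ĝ n k (suc r) ≡ - ι 64 * (Y * (ι 2 * N + 1ℚ) * (ι 2 * N + ι 2) * (ι 2 * R + 1ℚ) * (N + K + 1ℚ) * (ι 2 * N + K + ι 2) * X N K)
  Ĝ-n-k-1+r = trans (cong₂ (λ w c → w * (c * (!⁻¹ (suc (n ℕ.+ suc r)) * !⁻¹ (suc (n ℕ.+ n ℕ.+ k)))) * X N K) weight-n core-n-k-1+r)
    (trans (cong₂ (λ i j → v * w * (t * (- (x * y)) * (!⁻¹ (suc i) * j)) * X N K) (ℕ.+-suc n r) !⁻¹[1+2n+k])
    (lem v t !⁻¹₁ !⁻¹₂ (1ℚ + N) (ι 2 * N + 1ℚ) (ι 2 * N + ι 2) x y (ι 2 * N + K + ι 2) (X N K)))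
    where
    x y w : ℚ
    x = ι 2 * R + 1ℚ
    y = N + K + 1ℚ
    w = ι 64 * (1ℚ + N) * (ι 2 * N + 1ℚ) * (ι 2 * N + ι 2)
    lem = solve 11 (λ v t p q m a b x y c X →
      v :* (con 64 :* m :* a :* b) :* (t :* (:- (x :* y)) :* (p :* (c :* q))) :* X
      := :- con 64 :* (v :* m :* t :* p :* q :* a :* b :* x :* y :* c :* X)) refl

wz : ∀ k r → let n = suc (k ℕ.+ r) in F̂ (suc n) k (suc r) - F̂ n k r ≡ Ĝ n (suc k) r - Ĝ n k (suc r)
wz k r = begin
  F̂ (suc n) k (suc r) - F̂ n k r ≡⟨ cong₂ _-_ F̂-1+n-k-1+r F̂-n-k-r ⟩
  lhs (ι n) ≡⟨ cong lhs ιn ⟩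
  lhs (K + R + 1ℚ) ≡⟨ wz-polynomial Y K R ⟩
  rhs (K + R + 1ℚ) ≡⟨ cong rhs ιn ⟨
  rhs (ι n) ≡⟨ cong₂ _-_ Ĝ-n-1+k-r Ĝ-n-k-1+r ⟨
  Ĝ n (suc k) r - Ĝ n k (suc r) ∎
  where
  n = suc (k ℕ.+ r)
  open WZ n k r
  ιn : ι n ≡ K + R + 1ℚ
  ιn = trans (ι-suc (k ℕ.+ r)) (trans (ℚ.+-comm 1ℚ (ι (k ℕ.+ r))) (cong (_+ 1ℚ) (ι-+ k r)))
  lhs rhs : ℚ → ℚ
  lhs n = - ι 128 * (Y * (ι 2 * n + 1ℚ) * (ι 2 * n + 1ℚ) * (ι 4 * n + 1ℚ) * (ι 4 * n + ι 3) * (ι 3 * n + 1ℚ) * (ι 3 * n + ι 2) * (ι 3 * n + ι 3) * (ι 2 * (n + K) + 1ℚ) * (ι 2 * R + 1ℚ))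
    - ι 8192 * (Y * n * (ι 2 * n + 1ℚ) * (ι 2 * n + ι 2) * (n + K + 1ℚ) * (R + 1ℚ) * (n + R + 1ℚ) * (n + R + ι 2) * (ι 2 * n + K + 1ℚ) * (ι 2 * n + K + ι 2))
  rhs n = ι 64 * (Y * (ι 2 * n + 1ℚ) * (ι 2 * n + ι 2) * (ι 2 * (n + K) + 1ℚ) * (R + 1ℚ) * (n + R + ι 2) * X n (1ℚ + K))
    - (- ι 64) * (Y * (ι 2 * n + 1ℚ) * (ι 2 * n + ι 2) * (ι 2 * R + 1ℚ) * (n + K + 1ℚ) * (ι 2 * n + K + ι 2) * X n K)

F G : ℕ → ℕ → ℚ
F k r = F̂ (suc (k ℕ.+ r)) k r
G k r = Ĝ (k ℕ.+ r) k r

wz-pair : ∀ k r → F k (suc r) - F k r ≡ G (suc k) r - G k (suc r)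
wz-pair k r = begin
  F k (suc r) - F k r ≡⟨ cong (λ n → F̂ (suc n) k (suc r) - F k r) (ℕ.+-suc k r) ⟩
  F̂ (suc (suc (k ℕ.+ r))) k (suc r) - F k r ≡⟨ wz k r ⟩
  G (suc k) r - Ĝ (suc (k ℕ.+ r)) k (suc r) ≡⟨ cong (λ n → G (suc k) r - Ĝ n k (suc r)) (ℕ.+-suc k r) ⟨
  G (suc k) r - G k (suc r) ∎

F[-,0] : ∀ k → F k 0 ≡ - G k 0
F[-,0] n = begin
  F̂ (suc (n ℕ.+ 0)) n 0 ≡⟨ cong (λ m → F̂ (suc m) n 0) (ℕ.+-identityʳ n) ⟩
  F̂ (suc n) n 0 ≡⟨ cong₂ (λ w o → ι 128 * ι (suc n) * w * (1ℚ * o * 1ℚ * !⁻¹ (suc (n ℕ.+ n)) * 1ℚ * (!⁻¹ (suc (n ℕ.+ 0)) * !⁻¹ (suc n ℕ.+ suc n ℕ.+ n)))) weight-suc oddFac[1+n+k] ⟩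
  ι 128 * ι (suc n) * (v * w) * (1ℚ * (oddFac (n ℕ.+ n) * (ι 2 * (N + N) + 1ℚ)) * 1ℚ * !⁻¹ (suc (n ℕ.+ n)) * 1ℚ * (!⁻¹ (suc (n ℕ.+ 0)) * !⁻¹ (suc n ℕ.+ suc n ℕ.+ n)))
    ≡⟨ cong₂ (λ x m → ι 128 * x * (v * w) * (1ℚ * (oddFac (n ℕ.+ n) * (ι 2 * (N + N) + 1ℚ)) * 1ℚ * !⁻¹ (suc (n ℕ.+ n)) * 1ℚ * (!⁻¹ (suc (n ℕ.+ 0)) * !⁻¹ (m ℕ.+ n)))) (ι-suc n) suc+suc ⟩
  ι 128 * (1ℚ + N) * (v * w) * (1ℚ * (oddFac (n ℕ.+ n) * (ι 2 * (N + N) + 1ℚ)) * 1ℚ * !⁻¹ (suc (n ℕ.+ n)) * 1ℚ * (!⁻¹ (suc (n ℕ.+ 0)) * !⁻¹₂))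
    ≡⟨ lem v (oddFac (n ℕ.+ n)) (!⁻¹ (suc (n ℕ.+ n))) (!⁻¹ (suc (n ℕ.+ 0))) !⁻¹₂ N ⟩
  - (v * w′ * (1ℚ * oddFac (n ℕ.+ n) * 1ℚ * ((N + N + 1ℚ) * !⁻¹ (suc (n ℕ.+ n))) * 1ℚ * (!⁻¹ (suc (n ℕ.+ 0)) * ((ι 2 * N + N + ι 2) * !⁻¹₂))) * X N N)
    ≡⟨ cong₂ (λ i j → - (v * w′ * (1ℚ * oddFac (n ℕ.+ n) * 1ℚ * i * 1ℚ * (!⁻¹ (suc (n ℕ.+ 0)) * j)) * X N N)) !⁻¹[n+k] !⁻¹[1+2n+k] ⟨
  - (v * w′ * (core n n 0 * (!⁻¹ (suc (n ℕ.+ 0)) * !⁻¹ (suc (n ℕ.+ n ℕ.+ n)))) * X N N)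
    ≡⟨ cong (λ w → - (w * (core n n 0 * (!⁻¹ (suc (n ℕ.+ 0)) * !⁻¹ (suc (n ℕ.+ n ℕ.+ n)))) * X N N)) weight-n ⟨
  - Ĝ n n 0 ≡⟨ cong (λ m → - Ĝ m n 0) (ℕ.+-identityʳ n) ⟨
  - G n 0 ∎
  where
  open Double n
  open WZ n n 0
  w w′ : ℚ
  w = (ι 2 * N + 1ℚ) * (ι 2 * N + 1ℚ) * (ι 4 * N + 1ℚ) * (ι 4 * N + ι 3) * (ι 3 * N + 1ℚ) * (ι 3 * N + ι 2) * (ι 3 * N + ι 3)
  w′ = ι 64 * (1ℚ + N) * (ι 2 * N + 1ℚ) * (ι 2 * N + ι 2)
  lem = solve 6 (λ v o a b c n →
    con 128 :* (con 1 :+ n) :* (v :* ((con 2 :* n :+ con 1) :* (con 2 :* n :+ con 1) :* (con 4 :* n :+ con 1) :* (con 4 :* n :+ con 3) :* (con 3 :* n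
      :+ con 1) :* (con 3 :* n :+ con 2) :* (con 3 :* n :+ con 3))) :* (con 1 :* (o :* (con 2 :* (n :+ n) :+ con 1)) :* con 1 :* a :* con 1 :* (b
      :* c))
    := :- (v :* (con 64 :* (con 1 :+ n) :* (con 2 :* n :+ con 1) :* (con 2 :* n :+ con 2)) :* (con 1 :* o :* con 1 :* ((n :+ n :+ con 1) :* a)
      :* con 1 :* (b :* ((con 2 :* n :+ n :+ con 2) :* c))) :* ((con 128 :* n :* n :+ con 76 :* n :+ con 16) :* n :* n :- con 16 :* n :* n :* n :* n
      :- (con 172 :* n :* n :+ con 75 :* n :+ con 9) :* (con 2 :* n :+ con 1) :* (con 2 :* n :+ con 1)))) refl

2⁻^ : ℕ → ℚ
2⁻^ zero = 1ℚ
2⁻^ (suc n) = 2⁻^ n * ½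

2⁻^-double : ∀ n → 2⁻^ (n ℕ.+ n) ≡ 2⁻^ n * 2⁻^ n
2⁻^-double zero = refl
2⁻^-double (suc n) = begin
  2⁻^ (suc n ℕ.+ suc n) ≡⟨ cong 2⁻^ (Double.suc+suc n) ⟩
  2⁻^ (n ℕ.+ n) * ½ * ½ ≡⟨ cong (λ x → x * ½ * ½) (2⁻^-double n) ⟩
  2⁻^ n * 2⁻^ n * ½ * ½ ≡⟨ lem (2⁻^ n) ⟩
  2⁻^ n * ½ * (2⁻^ n * ½) ∎
  where
  lem = solve 1 (λ x → x :* x :* Κ ½ :* Κ ½ := x :* Κ ½ :* (x :* Κ ½)) refl

oddFac≡ : ∀ n → oddFac n ≡ fac (n ℕ.+ n) * 2⁻^ n * !⁻¹ n
oddFac≡ zero = refl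
oddFac≡ (suc n) = begin
  oddFac n * (ι 2 * ι n + 1ℚ) ≡⟨ cong (_* (ι 2 * ι n + 1ℚ)) (oddFac≡ n) ⟩
  fac (n ℕ.+ n) * 2⁻^ n * !⁻¹ n * (ι 2 * ι n + 1ℚ) ≡⟨ cong (λ x → fac (n ℕ.+ n) * 2⁻^ n * x * (ι 2 * ι n + 1ℚ)) (!⁻¹-suc n) ⟩
  fac (n ℕ.+ n) * 2⁻^ n * ((1ℚ + ι n) * !⁻¹ (suc n)) * (ι 2 * ι n + 1ℚ) ≡⟨ lem (fac (n ℕ.+ n)) (2⁻^ n) (!⁻¹ (suc n)) (ι n) ⟩
  (1ℚ + (1ℚ + ι 2 * ι n)) * ((1ℚ + ι 2 * ι n) * fac (n ℕ.+ n)) * (2⁻^ n * ½) * !⁻¹ (suc n)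
    ≡⟨ cong (λ x → (1ℚ + (1ℚ + x)) * ((1ℚ + x) * fac (n ℕ.+ n)) * (2⁻^ n * ½) * !⁻¹ (suc n)) ι2n ⟨
  (1ℚ + (1ℚ + ι (n ℕ.+ n))) * ((1ℚ + ι (n ℕ.+ n)) * fac (n ℕ.+ n)) * (2⁻^ n * ½) * !⁻¹ (suc n)
    ≡⟨ cong₂ (λ x y → (1ℚ + x) * y * (2⁻^ n * ½) * !⁻¹ (suc n)) (ι-suc (n ℕ.+ n)) (fac-suc (n ℕ.+ n)) ⟨
  (1ℚ + ι (suc (n ℕ.+ n))) * fac (suc (n ℕ.+ n)) * (2⁻^ n * ½) * !⁻¹ (suc n)
    ≡⟨ cong (λ x → x * (2⁻^ n * ½) * !⁻¹ (suc n)) (fac-suc (suc (n ℕ.+ n))) ⟨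
  fac (suc (suc (n ℕ.+ n))) * 2⁻^ (suc n) * !⁻¹ (suc n) ≡⟨ cong (λ m → fac m * 2⁻^ (suc n) * !⁻¹ (suc n)) suc+suc ⟨
  fac (suc n ℕ.+ suc n) * 2⁻^ (suc n) * !⁻¹ (suc n) ∎
  where
  open Double n
  lem = solve 4 (λ f t i n →
    f :* t :* ((con 1 :+ n) :* i) :* (con 2 :* n :+ con 1)
    := (con 1 :+ (con 1 :+ con 2 :* n)) :* ((con 1 :+ con 2 :* n) :* f) :* (t :* Κ ½) :* i) refl

C≡ : ∀ m n → ι ((m ℕ.+ n) C m) ≡ fac (m ℕ.+ n) * (!⁻¹ m * !⁻¹ n)
C≡ m n = begin
  c ≡⟨ lem c (fac m) (!⁻¹ m) (fac n) (!⁻¹ n) ⟨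
  c * (fac m * fac n) * (!⁻¹ m * !⁻¹ n) - c * ((fac m * !⁻¹ m - 1ℚ) * fac n * !⁻¹ n + (fac n * !⁻¹ n - 1ℚ))
    ≡⟨ cong₂ (λ x y → c * (fac m * fac n) * (!⁻¹ m * !⁻¹ n) - c * ((x - 1ℚ) * fac n * !⁻¹ n + (y - 1ℚ))) (fac-inverse m) (fac-inverse n) ⟩
  c * (fac m * fac n) * (!⁻¹ m * !⁻¹ n) - c * ((1ℚ - 1ℚ) * fac n * !⁻¹ n + (1ℚ - 1ℚ)) ≡⟨ lem′ c (fac n) (!⁻¹ n) (c * (fac m * fac n) * (!⁻¹ m * !⁻¹ n)) ⟩
  c * (fac m * fac n) * (!⁻¹ m * !⁻¹ n) ≡⟨ cong (_* (!⁻¹ m * !⁻¹ n)) eq ⟩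
  fac (m ℕ.+ n) * (!⁻¹ m * !⁻¹ n) ∎
  where
  c = ι ((m ℕ.+ n) C m)
  lem = solve 5 (λ c a a′ b b′ → c :* (a :* b) :* (a′ :* b′) :- c :* ((a :* a′ :- con 1) :* b :* b′ :+ (b :* b′ :- con 1)) := c) refl
  lem′ = solve 4 (λ c b b′ z → z :- c :* ((con 1 :- con 1) :* b :* b′ :+ (con 1 :- con 1)) := z) refl
  ℕeq : ((m ℕ.+ n) C m) ℕ.* (m ! ℕ.* n !) ≡ (m ℕ.+ n) !
  ℕeq = subst (λ d → ((m ℕ.+ n) C m) ℕ.* (m ! ℕ.* d !) ≡ (m ℕ.+ n) !) (ℕ.m+n∸m≡n m n)
    (trans (cong (ℕ._* (m ! ℕ.* (m ℕ.+ n ∸ m) !)) (nCk≡n!/k![n-k]! (ℕ.m≤m+n m n)))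
      (ℕ.m/n*n≡m {{m ℕ.!* (m ℕ.+ n ∸ m) !≢0}} (k![n∸k]!∣n! (ℕ.m≤m+n m n))))
  eq : c * (fac m * fac n) ≡ fac (m ℕ.+ n)
  eq = trans (cong (c *_) (sym (ι-* (m !) (n !)))) (trans (sym (ι-* ((m ℕ.+ n) C m) (m ! ℕ.* n !))) (cong ι ℕeq))

4096^n : ∀ n → ι (4096 ℕ.^ n) * (64⁻^ n * (2⁻^ n * 2⁻^ n * 2⁻^ n * 2⁻^ n * 2⁻^ n * 2⁻^ n)) ≡ 1ℚ
4096^n zero = refl
4096^n (suc n) = begin
  ι (4096 ℕ.^ suc n) * (64⁻^ (suc n) * (h * h * h * h * h * h)) ≡⟨ cong (_* (64⁻^ (suc n) * (h * h * h * h * h * h))) (ι-* 4096 (4096 ℕ.^ n)) ⟩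
  ι 4096 * ι (4096 ℕ.^ n) * (64⁻^ (suc n) * (h * h * h * h * h * h)) ≡⟨ lem (ι (4096 ℕ.^ n)) (64⁻^ n) (2⁻^ n) ⟩
  ι (4096 ℕ.^ n) * (64⁻^ n * (2⁻^ n * 2⁻^ n * 2⁻^ n * 2⁻^ n * 2⁻^ n * 2⁻^ n)) ≡⟨ 4096^n n ⟩
  1ℚ ∎
  where
  h = 2⁻^ (suc n)
  lem = solve 3 (λ x y z →
    con 4096 :* x :* (y :* Κ (ℤ.+ 1 / 64) :* (z :* Κ ½ :* (z :* Κ ½) :* (z :* Κ ½) :* (z :* Κ ½) :* (z :* Κ ½) :* (z :* Κ ½)))
    := x :* (y :* (z :* z :* z :* z :* z :* z))) refl

-1^n : ∀ n → (ℤ.-1ℤ ℤ.^ n) / 1 ≡ sgn n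
-1^n zero = refl
-1^n (suc n) = trans (/1-homo-* ℤ.-1ℤ (ℤ.-1ℤ ℤ.^ n)) (trans (cong (_*_ (ℤ.-1ℤ / 1)) (-1^n n)) (lem (sgn n)))
  where
  lem = solve 1 (λ x → Κ (ℤ.-1ℤ / 1) :* x := :- x) refl

/≡* : ∀ i d .{{_ : NonZero d}} d⁻¹ → ι d * d⁻¹ ≡ 1ℚ → i / d ≡ i / 1 * d⁻¹
/≡* i d d⁻¹ eq = begin
  i / d ≡⟨ ℚ.*-identityʳ (i / d) ⟨
  i / d * 1ℚ ≡⟨ cong (i / d *_) eq ⟨
  i / d * (ι d * d⁻¹) ≡⟨ ℚ.*-assoc (i / d) (ι d) d⁻¹ ⟨
  i / d * ι d * d⁻¹ ≡⟨ cong (_* d⁻¹) (/-*-cancel i d) ⟩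
  i / 1 * d⁻¹ ∎

summand≡ : ∀ n → summand n ≡ - G 0 n
summand≡ n = begin
  summand n ≡⟨⟩
  num / (2 ℕ.^ (12 ℕ.* n)) * (c₂ * (c₂ * (c₂ * 1ℚ))) * fromℕ ((3 ℕ.* n) C n) * fromℕ ((4 ℕ.* n) C (2 ℕ.* n))
    ≡⟨ cong₂ (λ x y → x * (c₂ * (c₂ * (c₂ * 1ℚ))) * y * fromℕ ((4 ℕ.* n) C (2 ℕ.* n))) first (trans (cong (λ m → ι (m C n)) 3n) (C≡ n (n ℕ.+ n))) ⟩
  first′ * (c₂ * (c₂ * (c₂ * 1ℚ))) * (fac (n ℕ.+ (n ℕ.+ n)) * (i * i₂)) * fromℕ ((4 ℕ.* n) C (2 ℕ.* n))
    ≡⟨ cong₂ (λ x y → first′ * (x * (x * (x * 1ℚ))) * (fac (n ℕ.+ (n ℕ.+ n)) * (i * i₂)) * y) (trans (cong (λ m → ι (m C n)) 2n) (C≡ n n))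
         (trans (cong₂ (λ m m′ → ι (m C m′)) 4n 2n) (C≡ (n ℕ.+ n) (n ℕ.+ n))) ⟩
  first′ * (b₂ * (b₂ * (b₂ * 1ℚ))) * (fac (n ℕ.+ (n ℕ.+ n)) * (i * i₂)) * (f₄ * (i₂ * i₂))
    ≡⟨ cong (λ m → first′ * (b₂ * (b₂ * (b₂ * 1ℚ))) * (fac m * (i * i₂)) * (f₄ * (i₂ * i₂))) (sym (ℕ.+-assoc n n n)) ⟩
  first′ * (b₂ * (b₂ * (b₂ * 1ℚ))) * (f₃ * (i * i₂)) * (f₄ * (i₂ * i₂)) ≡⟨ lem (sgn n) (64⁻^ n) h (ι n) f₂ f₃ f₄ i i₂ ⟩
  rhs (f₂ * h * i) (f₄ * (h * h) * i₂) i₂ + f₂ * f₂ * f₂ * lemfac * (1ℚ - f₂ * i₂)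
    ≡⟨ cong (λ x → rhs (f₂ * h * i) (f₄ * (h * h) * i₂) i₂ + f₂ * f₂ * f₂ * lemfac * (1ℚ - x)) (fac-inverse (n ℕ.+ n)) ⟩
  rhs (f₂ * h * i) (f₄ * (h * h) * i₂) i₂ + f₂ * f₂ * f₂ * lemfac * (1ℚ - 1ℚ) ≡⟨ lem₀ (rhs (f₂ * h * i) (f₄ * (h * h) * i₂) i₂) (f₂ * f₂ * f₂ * lemfac) ⟩
  rhs (f₂ * h * i) (f₄ * (h * h) * i₂) i₂
    ≡⟨ cong₂ (λ x y → rhs x y i₂) (oddFac≡ n) (trans (oddFac≡ (n ℕ.+ n)) (cong (λ x → f₄ * x * i₂) (2⁻^-double n))) ⟨
  rhs (oddFac n) (oddFac (n ℕ.+ n)) i₂ ≡⟨ cong (rhs (oddFac n) (oddFac (n ℕ.+ n))) (trans (!⁻¹-suc (n ℕ.+ n)) (cong (λ x → (1ℚ + x) * i₃) (Double.ι2n n))) ⟩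
  rhs (oddFac n) (oddFac (n ℕ.+ n)) ((1ℚ + ι 2 * ι n) * i₃) ≡⟨ lem₁ (64⁻^ n) (oddFac n) (oddFac (n ℕ.+ n)) f₃ i i₂ i₃ (sgn n) (ι n) ⟩
  - (weight n * (sgn n * oddFac n * oddFac n * i * i * (i₃ * i₃)) * X (ι n) 0ℚ)
    ≡⟨ cong₂ (λ a b → - (weight n * (sgn n * oddFac a * oddFac n * !⁻¹ a * i * (i₃ * !⁻¹ (suc b))) * X (ι n) 0ℚ)) (ℕ.+-identityʳ n) (ℕ.+-identityʳ (n ℕ.+ n)) ⟨
  - G 0 n ∎
  where
  num = ℤ.-1ℤ ℤ.^ n ℤ.* ℤ.+ (172 ℕ.* n ℕ.^ 2 ℕ.+ 75 ℕ.* n ℕ.+ 9)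
  instance _ = ℕ.m^n≢0 2 (12 ℕ.* n)
  c₂ = fromℕ ((2 ℕ.* n) C n)
  h = 2⁻^ n
  i = !⁻¹ n
  i₂ = !⁻¹ (n ℕ.+ n)
  i₃ = !⁻¹ (suc (n ℕ.+ n))
  f₂ = fac (n ℕ.+ n)
  f₃ = fac (n ℕ.+ n ℕ.+ n)
  f₄ = fac (n ℕ.+ n ℕ.+ (n ℕ.+ n))
  b₂ = f₂ * (i * i)
  first′ = sgn n * (ι 172 * ι n * ι n + ι 75 * ι n + ι 9) * (64⁻^ n * (h * h * h * h * h * h))
  2n : 2 ℕ.* n ≡ n ℕ.+ n
  2n = cong (n ℕ.+_) (ℕ.+-identityʳ n)
  3n : 3 ℕ.* n ≡ n ℕ.+ (n ℕ.+ n)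
  3n = cong (n ℕ.+_) 2n
  4n : 4 ℕ.* n ≡ n ℕ.+ n ℕ.+ (n ℕ.+ n)
  4n = trans (cong (n ℕ.+_) 3n) (sym (ℕ.+-assoc n n (n ℕ.+ n)))
  n² : ι (n ℕ.^ 2) ≡ ι n * ι n
  n² = trans (cong (λ m → ι (n ℕ.* m)) (ℕ.*-identityʳ n)) (ι-* n n)
  poly : ι (172 ℕ.* n ℕ.^ 2 ℕ.+ 75 ℕ.* n ℕ.+ 9) ≡ ι 172 * ι n * ι n + ι 75 * ι n + ι 9
  poly = trans (ι-+ (172 ℕ.* n ℕ.^ 2 ℕ.+ 75 ℕ.* n) 9) (cong (_+ ι 9) (trans (ι-+ (172 ℕ.* n ℕ.^ 2) (75 ℕ.* n))
    (cong₂ _+_ (trans (ι-* 172 (n ℕ.^ 2)) (trans (cong (ι 172 *_) n²) (sym (ℚ.*-assoc (ι 172) (ι n) (ι n))))) (ι-* 75 n))))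
  first : num / (2 ℕ.^ (12 ℕ.* n)) ≡ first′
  first = trans (/≡* num (2 ℕ.^ (12 ℕ.* n)) (64⁻^ n * (h * h * h * h * h * h)) (trans (cong (λ m → ι m * (64⁻^ n * (h * h * h * h * h * h))) (sym (ℕ.^-*-assoc 2 12 n))) (4096^n n)))
    (cong (_* (64⁻^ n * (h * h * h * h * h * h))) (trans (/1-homo-* (ℤ.-1ℤ ℤ.^ n) (ℤ.+ (172 ℕ.* n ℕ.^ 2 ℕ.+ 75 ℕ.* n ℕ.+ 9))) (cong₂ _*_ (-1^n n) poly)))
  lemfac : ℚ
  lemfac = sgn n * (ι 172 * ι n * ι n + ι 75 * ι n + ι 9) * 64⁻^ n * (h * h * h * h * h * h) * i * i * i * i * i * i * i * i₂ * i₂ * i₂ * f₃ * f₄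
  rhs : ℚ → ℚ → ℚ → ℚ
  rhs o o₂ i′ = 64⁻^ n * (o * o) * o₂ * f₃ * i * i₂ * (sgn n * o * o * i * i * (i′ * i′)) * (ι 172 * ι n * ι n + ι 75 * ι n + ι 9)
  lem = solve 9 (λ s e h n f₂ f₃ f₄ i i₂ →
    s :* (con 172 :* n :* n :+ con 75 :* n :+ con 9) :* (e :* (h :* h :* h :* h :* h :* h)) :* (f₂ :* (i :* i) :* (f₂ :* (i :* i) :* (f₂ :* (i :* i)
      :* con 1))) :* (f₃ :* (i :* i₂)) :* (f₄ :* (i₂ :* i₂))
    := e :* (f₂ :* h :* i :* (f₂ :* h :* i)) :* (f₄ :* (h :* h) :* i₂) :* f₃ :* i :* i₂ :* (s :* (f₂ :* h :* i) :* (f₂ :* h :* i) :* i :* i :* (i₂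
      :* i₂)) :* (con 172 :* n :* n :+ con 75 :* n :+ con 9) :+ f₂ :* f₂ :* f₂ :* (s :* (con 172 :* n :* n :+ con 75 :* n :+ con 9) :* e :* (h :* h
      :* h :* h :* h :* h) :* i :* i :* i :* i :* i :* i :* i :* i₂ :* i₂ :* i₂ :* f₃ :* f₄) :* (con 1 :- f₂ :* i₂)) refl
  lem₀ = solve 2 (λ x y → x :+ y :* (con 1 :- con 1) := x) refl
  lem₁ = solve 9 (λ e o o₂ f₃ i i₂ i₃ s n →
    e :* (o :* o) :* o₂ :* f₃ :* i :* i₂ :* (s :* o :* o :* i :* i :* ((con 1 :+ con 2 :* n) :* i₃ :* ((con 1 :+ con 2 :* n) :* i₃))) :* (con 172 :* n
      :* n :+ con 75 :* n :+ con 9)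
    := :- (e :* (o :* o) :* o₂ :* f₃ :* i :* i₂ :* (s :* o :* o :* i :* i :* (i₃ :* i₃)) :* ((con 128 :* n :* n :+ con 76 :* n :+ con 16) :* con 0
      :* con 0 :- con 16 :* con 0 :* con 0 :* con 0 :* con 0 :- (con 172 :* n :* n :+ con 75 :* n :+ con 9) :* (con 2 :* n :+ con 1) :* (con 2 :* n
      :+ con 1)))) refl

diagonal : ℕ → ℕ → ℚ
diagonal k zero = F k zero
diagonal k (suc r) = F k (suc r) + diagonal (suc k) r

diagonal-step : ∀ k r → diagonal k (suc r) - diagonal k r ≡ - G k (suc r)
diagonal-step k zero = begin
  F k 1 + F (suc k) 0 - F k 0 ≡⟨ cong (λ x → F k 1 + x - F k 0) (F[-,0] (suc k)) ⟩
  F k 1 - G (suc k) 0 - F k 0 ≡⟨ lem (F k 1) (G (suc k) 0) (F k 0) ⟩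
  F k 1 - F k 0 - G (suc k) 0 ≡⟨ cong (_- G (suc k) 0) (wz-pair k 0) ⟩
  G (suc k) 0 - G k 1 - G (suc k) 0 ≡⟨ lem′ (G (suc k) 0) (G k 1) ⟩
  - G k 1 ∎
  where
  lem = solve 3 (λ x y z → x :- y :- z := x :- z :- y) refl
  lem′ = solve 2 (λ x y → x :- y :- x := :- y) refl
diagonal-step k (suc r) = begin
  F k (2 ℕ.+ r) + diagonal (suc k) (suc r) - (F k (suc r) + diagonal (suc k) r) ≡⟨ lem (F k (2 ℕ.+ r)) (F k (suc r)) (diagonal (suc k) (suc r)) (diagonal (suc k) r) ⟩
  F k (2 ℕ.+ r) - F k (suc r) + (diagonal (suc k) (suc r) - diagonal (suc k) r) ≡⟨ cong₂ _+_ (wz-pair k (suc r)) (diagonal-step (suc k) r) ⟩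
  G (suc k) (suc r) - G k (2 ℕ.+ r) - G (suc k) (suc r) ≡⟨ lem′ (G (suc k) (suc r)) (G k (2 ℕ.+ r)) ⟩
  - G k (2 ℕ.+ r) ∎
  where
  lem = solve 4 (λ x y z w → x :+ z :- (y :+ w) := x :- y :+ (z :- w)) refl
  lem′ = solve 2 (λ x y → x :- y :- x := :- y) refl

∑summand≡diagonal : ∀ n → (∑[ k ≤ n ] summand (toℕ k)) ≡ diagonal 0 n
∑summand≡diagonal zero = refl
∑summand≡diagonal (suc n) = begin
  (∑[ k ≤ suc n ] summand (toℕ k)) ≡⟨ sum-init-last (λ k → summand (toℕ {suc (suc n)} k)) ⟩
  (∑[ k ≤ n ] summand (toℕ (Fin.inject₁ k))) + summand (toℕ (Fin.fromℕ (suc n)))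
    ≡⟨ cong₂ _+_ (sum-cong-≗ {suc n} (λ k → cong summand (Fin.toℕ-inject₁ k))) (cong summand (Fin.toℕ-fromℕ (suc n))) ⟩
  (∑[ k ≤ n ] summand (toℕ k)) + summand (suc n) ≡⟨ cong₂ _+_ (∑summand≡diagonal n) (trans (summand≡ (suc n)) (sym (diagonal-step 0 n))) ⟩
  diagonal 0 n + (diagonal 0 (suc n) - diagonal 0 n) ≡⟨ lem (diagonal 0 n) (diagonal 0 (suc n)) ⟩
  diagonal 0 (suc n) ∎
  where
  lem = solve 2 (λ x y → x :+ (y :- x) := y) refl

F-ratio : ∀ k r → let n = ι (suc (k ℕ.+ suc r)) in
  F (suc k) r * ((ι 2 * ι r + 1ℚ) * (n + ι k + 1ℚ) * (ι 2 * n + ι k + 1ℚ))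
  ≡ - (F k (suc r) * ((ι 2 * (n + ι k) + 1ℚ) * (1ℚ + ι r) * (n + ι r + 1ℚ)))
F-ratio k r = begin
  F (suc k) r * (x * y * z) ≡⟨ cong (λ m → F̂ (suc m) (suc k) r * (x * y * z)) (ℕ.+-suc k r) ⟨
  F̂ n (suc k) r * (x * y * z)
    ≡⟨ cong₂ (λ c j → w * (c * (!⁻¹ (n ℕ.+ r) * !⁻¹ j)) * (x * y * z)) core₁ (ℕ.+-suc (n ℕ.+ n) k) ⟩
  w * (s * (o * u) * o′ * i₁ * ((1ℚ + ι r) * i₂) * (!⁻¹ (n ℕ.+ r) * i₄)) * (x * y * z)
    ≡⟨ cong (λ j → w * (s * (o * u) * o′ * i₁ * ((1ℚ + ι r) * i₂) * (j * i₄)) * (x * y * z)) i₃≡ ⟩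
  w * (s * (o * u) * o′ * i₁ * ((1ℚ + ι r) * i₂) * (t * i₃ * i₄)) * (x * y * z)
    ≡⟨ lem w s o o′ i₁ i₂ i₃ i₄ x y z u (1ℚ + ι r) t ⟩
  - (w * (- s * o * (o′ * x) * (y * i₁) * i₂ * (i₃ * (z * i₄))) * (u * (1ℚ + ι r) * t))
    ≡⟨ cong₂ (λ a b → - (w * (- s * o * (o′ * x) * a * i₂ * (i₃ * b)) * (u * (1ℚ + ι r) * t))) i₁≡ i₄≡ ⟨
  - (w * (- s * o * (o′ * x) * !⁻¹ (n ℕ.+ k) * i₂ * (i₃ * !⁻¹ (n ℕ.+ n ℕ.+ k))) * (u * (1ℚ + ι r) * t))
    ≡⟨ cong (λ j → - (w * (- s * o * (o′ * x) * !⁻¹ (n ℕ.+ k) * i₂ * (!⁻¹ j * !⁻¹ (n ℕ.+ n ℕ.+ k))) * (u * (1ℚ + ι r) * t))) (ℕ.+-suc n r) ⟨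
  - (F k (suc r) * (u * (1ℚ + ι r) * t)) ∎
  where
  n = suc (k ℕ.+ suc r)
  N = ι n
  w = ι 128 * N * weight n
  s = sgn r
  o = oddFac (n ℕ.+ k)
  o′ = oddFac r
  i₁ = !⁻¹ (suc (n ℕ.+ k))
  i₂ = !⁻¹ (suc r)
  i₃ = !⁻¹ (suc (n ℕ.+ r))
  i₄ = !⁻¹ (suc (n ℕ.+ n ℕ.+ k))
  x = ι 2 * ι r + 1ℚ
  y = N + ι k + 1ℚ
  z = ι 2 * N + ι k + 1ℚ
  u = ι 2 * (N + ι k) + 1ℚ
  t = N + ι r + 1ℚ
  open WZ n k r using (oddFac[1+n+k]; !⁻¹[n+k]; ι[2n+k])
  open Double n using ()
  core₁ : core n (suc k) r ≡ s * (o * u) * o′ * i₁ * ((1ℚ + ι r) * i₂)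
  core₁ = trans (cong (λ m → s * oddFac m * o′ * !⁻¹ m * !⁻¹ r) (ℕ.+-suc n k))
    (cong₂ (λ a b → s * a * o′ * i₁ * b) oddFac[1+n+k] (!⁻¹-suc r))
  i₁≡ : !⁻¹ (n ℕ.+ k) ≡ y * i₁
  i₁≡ = !⁻¹[n+k]
  i₃≡ : !⁻¹ (n ℕ.+ r) ≡ t * i₃
  i₃≡ = trans (!⁻¹-suc (n ℕ.+ r)) (cong (_* i₃) (trans (ℚ.+-comm 1ℚ (ι (n ℕ.+ r))) (cong (_+ 1ℚ) (ι-+ n r))))
  i₄≡ : !⁻¹ (n ℕ.+ n ℕ.+ k) ≡ z * i₄
  i₄≡ = trans (!⁻¹-suc (n ℕ.+ n ℕ.+ k)) (cong (_* i₄) (trans (ℚ.+-comm 1ℚ (ι (n ℕ.+ n ℕ.+ k))) (cong (_+ 1ℚ) ι[2n+k])))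
  lem = solve 14 (λ w s o o′ i₁ i₂ i₃ i₄ x y z u v t →
    w :* (s :* (o :* u) :* o′ :* i₁ :* (v :* i₂) :* (t :* i₃ :* i₄)) :* (x :* y :* z)
    := :- (w :* (:- s :* o :* (o′ :* x) :* (y :* i₁) :* i₂ :* (i₃ :* (z :* i₄))) :* (u :* v :* t))) refl

64⁻^≡ : ∀ n → 64⁻^ n ≡ 2⁻^ n * 2⁻^ n * 2⁻^ n * 2⁻^ n * 2⁻^ n * 2⁻^ n
64⁻^≡ zero = refl
64⁻^≡ (suc n) = trans (cong (_* (ℤ.+ 1 / 64)) (64⁻^≡ n)) (lem (2⁻^ n))
  where
  lem = solve 1 (λ z →
    z :* z :* z :* z :* z :* z :* Κ (ℤ.+ 1 / 64)
    := z :* Κ ½ :* (z :* Κ ½) :* (z :* Κ ½) :* (z :* Κ ½) :* (z :* Κ ½) :* (z :* Κ ½)) refl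

module Corners (P : ℕ) (β γ W : ℚ)
  (fac-2P : fac (P ℕ.+ P) ≡ fac P * fac P * β)
  (fac-p+P : fac (suc (P ℕ.+ P) ℕ.+ P) ≡ fac (suc (P ℕ.+ P)) * fac P * γ)
  (fac-p+2P : fac (suc (P ℕ.+ P) ℕ.+ (P ℕ.+ P)) ≡ fac (suc (P ℕ.+ P)) * fac (P ℕ.+ P) * W)
  where
  p = suc (P ℕ.+ P)
  n = suc P
  x π f φ h fp ψ a b o : ℚ
  x = ι P
  π = ι p
  f = fac P
  φ = !⁻¹ P
  h = 2⁻^ P
  fp = fac p
  ψ = !⁻¹ p
  a = !⁻¹ n
  b = !⁻¹ (suc p)
  o = f * f * β * h * φ

  π≡ : π ≡ 1ℚ + ι 2 * x
  π≡ = trans (ι-suc (P ℕ.+ P)) (cong (1ℚ +_) (Double.ι2n P))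

  fp≡ : fp ≡ π * (f * f * β)
  fp≡ = trans (ι-* p ((P ℕ.+ P) !)) (cong (π *_) fac-2P)

  o≡ : oddFac P ≡ o
  o≡ = trans (oddFac≡ P) (cong (λ y → y * h * φ) fac-2P)

  oddFac-n : oddFac n ≡ o * π
  oddFac-n = cong₂ _*_ o≡ (trans (ℚ.+-comm (ι 2 * x) 1ℚ) (sym π≡))

  oddFac-p : oddFac p ≡ π * (h * h) * (f * f * β) * W * (fp * ψ)
  oddFac-p = begin
    oddFac p ≡⟨ oddFac≡ p ⟩
    fac (p ℕ.+ p) * 2⁻^ p * ψ ≡⟨ cong₂ (λ y z → y * z * ψ) fac-2p (cong (_* ½) (2⁻^-double P)) ⟩
    ι 2 * π * (fp * (f * f * β) * W) * (h * h * ½) * ψ ≡⟨ lem π h (f * f * β) W fp ψ ⟩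
    π * (h * h) * (f * f * β) * W * (fp * ψ) ∎
    where
    fac-2p : fac (p ℕ.+ p) ≡ ι 2 * π * (fp * (f * f * β) * W)
    fac-2p = begin
      fac (p ℕ.+ p) ≡⟨ cong fac (ℕ.+-suc p (P ℕ.+ P)) ⟩
      fac (suc (p ℕ.+ (P ℕ.+ P))) ≡⟨ ι-* (suc (p ℕ.+ (P ℕ.+ P))) ((p ℕ.+ (P ℕ.+ P)) !) ⟩
      ι (suc (p ℕ.+ (P ℕ.+ P))) * fac (p ℕ.+ (P ℕ.+ P))
        ≡⟨ cong₂ _*_ (trans (cong ι (sym (ℕ.+-suc p (P ℕ.+ P)))) (Double.ι2n p)) (trans fac-p+2P (cong (λ y → fp * y * W) fac-2P)) ⟩
      ι 2 * π * (fp * (f * f * β) * W) ∎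
    lem = solve 6 (λ π h c W fp ψ → con 2 :* π :* (fp :* c :* W) :* (h :* h :* Κ ½) :* ψ := π :* (h :* h) :* c :* W :* (fp :* ψ)) refl

  n+n : n ℕ.+ n ≡ suc p
  n+n = Double.suc+suc P

  oddFac-2n : oddFac (n ℕ.+ n) ≡ π * (h * h) * (f * f * β) * W * (fp * ψ) * (ι 2 * π + 1ℚ)
  oddFac-2n = trans (cong oddFac n+n) (cong (_* (ι 2 * π + 1ℚ)) oddFac-p)

  fac-3n : fac (n ℕ.+ n ℕ.+ n) ≡ (1ℚ + (1ℚ + (π + x))) * ((1ℚ + (π + x)) * (fp * f * γ))
  fac-3n = begin
    fac (n ℕ.+ n ℕ.+ n) ≡⟨ cong fac (trans (cong (ℕ._+ n) n+n) (ℕ.+-suc (suc p) P)) ⟩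
    fac (suc (suc (p ℕ.+ P))) ≡⟨ trans (fac-suc (suc (p ℕ.+ P))) (cong₂ (λ y z → (1ℚ + y) * z) (ι-suc (p ℕ.+ P)) (fac-suc (p ℕ.+ P))) ⟩
    (1ℚ + (1ℚ + ι (p ℕ.+ P))) * ((1ℚ + ι (p ℕ.+ P)) * fac (p ℕ.+ P)) ≡⟨ cong₂ (λ y z → (1ℚ + (1ℚ + y)) * ((1ℚ + y) * z)) (ι-+ p P) fac-p+P ⟩
    (1ℚ + (1ℚ + (π + x))) * ((1ℚ + (π + x)) * (fp * f * γ)) ∎

  φ≡ : φ ≡ (1ℚ + x) * a
  φ≡ = !⁻¹-suc P

  ψ≡ : ψ ≡ (1ℚ + π) * b
  ψ≡ = !⁻¹-suc p

  fφ : f * φ ≡ 1ℚ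
  fφ = fac-inverse P

  fpψ : fp * ψ ≡ 1ℚ
  fpψ = fac-inverse p

  fpψ′ : π * (f * f * β) * ψ ≡ 1ℚ
  fpψ′ = trans (cong (_* ψ) (sym fp≡)) fpψ

  weight-corner : weight n ≡ h * ½ * (h * ½) * (h * ½) * (h * ½) * (h * ½) * (h * ½) * (o * π * (o * π)) * (π * (h * h) * (f * f * β) * W * (fp * ψ) * (ι 2 * π + 1ℚ))
    * ((1ℚ + (1ℚ + (π + x))) * ((1ℚ + (π + x)) * (fp * f * γ))) * a * b
  weight-corner = begin
    64⁻^ n * (oddFac n * oddFac n) * oddFac (n ℕ.+ n) * fac (n ℕ.+ n ℕ.+ n) * a * !⁻¹ (n ℕ.+ n)
      ≡⟨ cong₂ (λ y z → y * (oddFac n * oddFac n) * oddFac (n ℕ.+ n) * fac (n ℕ.+ n ℕ.+ n) * a * !⁻¹ z) (64⁻^≡ n) n+n ⟩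
    e * (oddFac n * oddFac n) * oddFac (n ℕ.+ n) * fac (n ℕ.+ n ℕ.+ n) * a * b
      ≡⟨ cong₂ (λ y z → e * (oddFac n * oddFac n) * y * z * a * b) oddFac-2n fac-3n ⟩
    e * (oddFac n * oddFac n) * c * d * a * b ≡⟨ cong (λ y → e * (y * y) * c * d * a * b) oddFac-n ⟩
    e * (o * π * (o * π)) * c * d * a * b ∎
    where
    e = h * ½ * (h * ½) * (h * ½) * (h * ½) * (h * ½) * (h * ½)
    c = π * (h * h) * (f * f * β) * W * (fp * ψ) * (ι 2 * π + 1ℚ)
    d = (1ℚ + (1ℚ + (π + x))) * ((1ℚ + (π + x)) * (fp * f * γ))

  h¹² : ℚ
  h¹² = h * h * (h * h) * (h * h) * (h * h) * (h * h) * (h * h)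

  F-first : F 0 P * ((1ℚ + π) * (1ℚ + π)) ≡ ι 3 * (π * π) * ((ι 2 * π + 1ℚ) * (ι 3 * π + 1ℚ)) * h¹² * W * (β * β) * (sgn P * (β * γ))
  F-first = begin
    F 0 P * ((1ℚ + π) * (1ℚ + π)) ≡⟨ cong (_* ((1ℚ + π) * (1ℚ + π))) (begin
      ι 128 * ι n * weight n * (sgn P * oddFac (n ℕ.+ 0) * oddFac P * !⁻¹ (n ℕ.+ 0) * φ * (ψ * !⁻¹ (n ℕ.+ n ℕ.+ 0)))
        ≡⟨ cong₂ (λ y z → ι 128 * ι n * weight n * (sgn P * oddFac y * oddFac P * !⁻¹ y * φ * (ψ * !⁻¹ z))) (ℕ.+-identityʳ n) (trans (ℕ.+-identityʳ (n ℕ.+ n)) n+n) ⟩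
      ι 128 * ι n * weight n * (sgn P * oddFac n * oddFac P * a * φ * (ψ * b))
        ≡⟨ cong₂ (λ y z → ι 128 * ι n * y * (sgn P * z * oddFac P * a * φ * (ψ * b))) weight-corner oddFac-n ⟩
      ι 128 * ι n * w π x * (sgn P * (o * π) * oddFac P * a * φ * (ψ * b))
        ≡⟨ cong₂ (λ y z → ι 128 * y * w π x * (sgn P * (o * π) * z * a * φ * (ψ * b))) (ι-suc P) o≡ ⟩
      ι 128 * (1ℚ + x) * w π x * (sgn P * (o * π) * o * a * φ * (ψ * b)) ∎) ⟩
    ι 128 * (1ℚ + x) * w π x * (sgn P * (o * π) * o * a * φ * (ψ * b)) * ((1ℚ + π) * (1ℚ + π))
      ≡⟨ cong (λ π → ι 128 * (1ℚ + x) * w π x * (sgn P * (o * π) * o * a * φ * (ψ * b)) * ((1ℚ + π) * (1ℚ + π))) π≡ ⟩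
    ι 128 * (1ℚ + x) * w (1ℚ + ι 2 * x) x * (sgn P * (o * (1ℚ + ι 2 * x)) * o * a * φ * (ψ * b)) * ((1ℚ + (1ℚ + ι 2 * x)) * (1ℚ + (1ℚ + ι 2 * x)))
      ≡⟨ lem x f φ h fp ψ a b β γ W (sgn P) ⟩
    R (1ℚ + ι 2 * x) * (f * φ * (f * φ) * (f * φ) * (f * φ) * (f * φ)) * (f * ((1ℚ + x) * a)) * (f * ((1ℚ + x) * a)) * (fp * ψ) * (fp * ((1ℚ + (1ℚ + ι 2 * x)) * b)) * ((1ℚ + ι 2 * x) * (f * f * β) * ψ * ((1ℚ + ι 2 * x) * (f * f * β) * ((1ℚ + (1ℚ + ι 2 * x)) * b)))
      ≡⟨ cong (λ π → R π * (f * φ * (f * φ) * (f * φ) * (f * φ) * (f * φ)) * (f * ((1ℚ + x) * a)) * (f * ((1ℚ + x) * a)) * (fp * ψ) * (fp * ((1ℚ + π) * b)) * (π * (f * f * β) * ψ * (π * (f * f * β) * ((1ℚ + π) * b)))) π≡ ⟨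
    R π * (f * φ * (f * φ) * (f * φ) * (f * φ) * (f * φ)) * (f * ((1ℚ + x) * a)) * (f * ((1ℚ + x) * a)) * (fp * ψ) * (fp * ((1ℚ + π) * b)) * (π * (f * f * β) * ψ * (π * (f * f * β) * ((1ℚ + π) * b)))
      ≡⟨ cong₂ (λ y z → R π * (f * φ * (f * φ) * (f * φ) * (f * φ) * (f * φ)) * (f * y) * (f * y) * (fp * ψ) * (fp * z) * (π * (f * f * β) * ψ * (π * (f * f * β) * z))) φ≡ ψ≡ ⟨
    R π * (f * φ * (f * φ) * (f * φ) * (f * φ) * (f * φ)) * (f * φ) * (f * φ) * (fp * ψ) * (fp * ψ) * (π * (f * f * β) * ψ * (π * (f * f * β) * ψ))
      ≡⟨ cong₂ (λ y z → R π * (y * y * y * y * y) * y * y * (fp * ψ) * (fp * ψ) * (z * z)) fφ fpψ′ ⟩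
    R π * (1ℚ * 1ℚ * 1ℚ * 1ℚ * 1ℚ) * 1ℚ * 1ℚ * (fp * ψ) * (fp * ψ) * (1ℚ * 1ℚ) ≡⟨ cong (λ y → R π * (1ℚ * 1ℚ * 1ℚ * 1ℚ * 1ℚ) * 1ℚ * 1ℚ * y * y * (1ℚ * 1ℚ)) fpψ ⟩
    R π * (1ℚ * 1ℚ * 1ℚ * 1ℚ * 1ℚ) * 1ℚ * 1ℚ * 1ℚ * 1ℚ * (1ℚ * 1ℚ) ≡⟨ lem₁ (R π) ⟩
    R π ∎
    where
    w : ℚ → ℚ → ℚ
    w π x = h * ½ * (h * ½) * (h * ½) * (h * ½) * (h * ½) * (h * ½) * (o * π * (o * π)) * (π * (h * h) * (f * f * β) * W * (fp * ψ) * (ι 2 * π + 1ℚ))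
      * ((1ℚ + (1ℚ + (π + x))) * ((1ℚ + (π + x)) * (fp * f * γ))) * a * b
    R : ℚ → ℚ
    R π = ι 3 * (π * π) * ((ι 2 * π + 1ℚ) * (ι 3 * π + 1ℚ)) * h¹² * W * (β * β) * (sgn P * (β * γ))
    lem₁ = solve 1 (λ x → x :* (con 1 :* con 1 :* con 1 :* con 1 :* con 1) :* con 1 :* con 1 :* con 1 :* con 1 :* (con 1 :* con 1) := x) refl
    lem = solve 12 (λ x f φ h fp ψ a b β γ W s →
      con 128 :* (con 1 :+ x) :* (h :* Κ ½ :* (h :* Κ ½) :* (h :* Κ ½) :* (h :* Κ ½) :* (h :* Κ ½) :* (h :* Κ ½) :* (f :* f :* β :* h :* φ :* (con 1
        :+ con 2 :* x) :* (f :* f :* β :* h :* φ :* (con 1 :+ con 2 :* x))) :* ((con 1 :+ con 2 :* x) :* (h :* h) :* (f :* f :* β) :* W :* (fp :* ψ)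
        :* (con 2 :* (con 1 :+ con 2 :* x) :+ con 1)) :* ((con 1 :+ (con 1 :+ ((con 1 :+ con 2 :* x) :+ x))) :* ((con 1 :+ ((con 1 :+ con 2 :* x)
        :+ x)) :* (fp :* f :* γ))) :* a :* b) :* (s :* (f :* f :* β :* h :* φ :* (con 1 :+ con 2 :* x)) :* (f :* f :* β :* h :* φ) :* a :* φ :* (ψ
        :* b)) :* ((con 1 :+ (con 1 :+ con 2 :* x)) :* (con 1 :+ (con 1 :+ con 2 :* x)))
      := con 3 :* ((con 1 :+ con 2 :* x) :* (con 1 :+ con 2 :* x)) :* ((con 2 :* (con 1 :+ con 2 :* x) :+ con 1) :* (con 3 :* (con 1 :+ con 2 :* x)
        :+ con 1)) :* (h :* h :* (h :* h) :* (h :* h) :* (h :* h) :* (h :* h) :* (h :* h)) :* W :* (β :* β) :* (s :* (β :* γ)) :* (f :* φ :* (f :* φ)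
        :* (f :* φ) :* (f :* φ) :* (f :* φ)) :* (f :* ((con 1 :+ x) :* a)) :* (f :* ((con 1 :+ x) :* a)) :* (fp :* ψ) :* (fp :* ((con 1 :+ (con 1
        :+ con 2 :* x)) :* b)) :* ((con 1 :+ con 2 :* x) :* (f :* f :* β) :* ψ :* ((con 1 :+ con 2 :* x) :* (f :* f :* β) :* ((con 1 :+ (con 1
        :+ con 2 :* x)) :* b)))) refl

  fac-3n-!⁻¹ : fac (n ℕ.+ n ℕ.+ n) * !⁻¹ (n ℕ.+ n ℕ.+ P) ≡ ι 3 * (1ℚ + x)
  fac-3n-!⁻¹ = begin
    fac (n ℕ.+ n ℕ.+ n) * !⁻¹ N ≡⟨ cong (λ m → fac m * !⁻¹ N) (ℕ.+-suc (n ℕ.+ n) P) ⟩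
    fac (suc N) * !⁻¹ N ≡⟨ cong (_* !⁻¹ N) (ι-* (suc N) (N !)) ⟩
    ι (suc N) * fac N * !⁻¹ N ≡⟨ ℚ.*-assoc (ι (suc N)) (fac N) (!⁻¹ N) ⟩
    ι (suc N) * (fac N * !⁻¹ N) ≡⟨ cong₂ _*_ (trans (cong ι (sym (ℕ.+-suc (n ℕ.+ n) P))) (trans (Double.ι3n n) (cong (ι 3 *_) (ι-suc P)))) (fac-inverse N) ⟩
    ι 3 * (1ℚ + x) * 1ℚ ≡⟨ ℚ.*-identityʳ (ι 3 * (1ℚ + x)) ⟩
    ι 3 * (1ℚ + x) ∎
    where
    N = n ℕ.+ n ℕ.+ P

  F-last : F P 0 * (1ℚ + π) ≡ ι 6 * (π * π) * (ι 2 * π + 1ℚ) * h¹² * (β * β) * (W * W)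
  F-last = begin
    F P 0 * (1ℚ + π) ≡⟨ cong (_* (1ℚ + π)) (begin
      F̂ (suc (P ℕ.+ 0)) P 0 ≡⟨ cong (λ m → F̂ (suc m) P 0) (ℕ.+-identityʳ P) ⟩
      ι 128 * ι n * weight n * (1ℚ * oddFac p * 1ℚ * ψ * 1ℚ * (!⁻¹ (n ℕ.+ 0) * j))
        ≡⟨ cong₂ (λ y z → ι 128 * y * weight n * (1ℚ * oddFac p * 1ℚ * ψ * 1ℚ * (!⁻¹ z * j))) (ι-suc P) (ℕ.+-identityʳ n) ⟩
      ι 128 * (1ℚ + x) * (64⁻^ n * (oddFac n * oddFac n) * oddFac (n ℕ.+ n) * fac (n ℕ.+ n ℕ.+ n) * a * !⁻¹ (n ℕ.+ n)) * (1ℚ * oddFac p * 1ℚ * ψ * 1ℚ * (a * j))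
        ≡⟨ cong₂ (λ y z → ι 128 * (1ℚ + x) * (y * (oddFac n * oddFac n) * oddFac z * fac (n ℕ.+ n ℕ.+ n) * a * !⁻¹ z) * (1ℚ * oddFac p * 1ℚ * ψ * 1ℚ * (a * j))) (64⁻^≡ n) n+n ⟩
      ι 128 * (1ℚ + x) * (e * (oddFac n * oddFac n) * (oddFac p * (ι 2 * π + 1ℚ)) * fac (n ℕ.+ n ℕ.+ n) * a * b) * (1ℚ * oddFac p * 1ℚ * ψ * 1ℚ * (a * j))
        ≡⟨ cong₂ (λ y z → ι 128 * (1ℚ + x) * (e * (y * y) * (z * (ι 2 * π + 1ℚ)) * fac (n ℕ.+ n ℕ.+ n) * a * b) * (1ℚ * z * 1ℚ * ψ * 1ℚ * (a * j))) oddFac-n oddFac-p ⟩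
      ι 128 * (1ℚ + x) * (e * (o * π * (o * π)) * (c * (ι 2 * π + 1ℚ)) * fac (n ℕ.+ n ℕ.+ n) * a * b) * (1ℚ * c * 1ℚ * ψ * 1ℚ * (a * j)) ∎) ⟩
    ι 128 * (1ℚ + x) * (e * (o * π * (o * π)) * (c * (ι 2 * π + 1ℚ)) * fac (n ℕ.+ n ℕ.+ n) * a * b) * (1ℚ * c * 1ℚ * ψ * 1ℚ * (a * j)) * (1ℚ + π)
      ≡⟨ lem x π f φ h fp ψ a b β W (fac (n ℕ.+ n ℕ.+ n)) j ⟩
    ι 2 * R′ * (fac (n ℕ.+ n ℕ.+ n) * j) * (1ℚ + x) * (f * a) * (f * a) * (f * φ * (f * φ)) * (π * (f * f * β) * ψ * (π * (f * f * β) * ((1ℚ + π) * b))) * (fp * ψ * (fp * ψ))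
      ≡⟨ cong₂ (λ y z → ι 2 * R′ * y * (1ℚ + x) * (f * a) * (f * a) * (f * φ * (f * φ)) * (π * (f * f * β) * ψ * (π * (f * f * β) * z)) * (fp * ψ * (fp * ψ))) fac-3n-!⁻¹ (sym ψ≡) ⟩
    ι 2 * R′ * (ι 3 * (1ℚ + x)) * (1ℚ + x) * (f * a) * (f * a) * (f * φ * (f * φ)) * (π * (f * f * β) * ψ * (π * (f * f * β) * ψ)) * (fp * ψ * (fp * ψ))
      ≡⟨ lem₁ R′ x f a (f * φ) (π * (f * f * β) * ψ) (fp * ψ) ⟩
    ι 6 * R′ * (f * ((1ℚ + x) * a)) * (f * ((1ℚ + x) * a)) * (f * φ * (f * φ)) * (π * (f * f * β) * ψ * (π * (f * f * β) * ψ)) * (fp * ψ * (fp * ψ))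
      ≡⟨ cong₂ (λ y z → ι 6 * R′ * (f * y) * (f * y) * (f * φ * (f * φ)) * (z * z) * (fp * ψ * (fp * ψ))) (sym φ≡) fpψ′ ⟩
    ι 6 * R′ * (f * φ) * (f * φ) * (f * φ * (f * φ)) * (1ℚ * 1ℚ) * (fp * ψ * (fp * ψ))
      ≡⟨ cong₂ (λ y z → ι 6 * R′ * y * y * (y * y) * (1ℚ * 1ℚ) * (z * z)) fφ fpψ ⟩
    ι 6 * R′ * 1ℚ * 1ℚ * (1ℚ * 1ℚ) * (1ℚ * 1ℚ) * (1ℚ * 1ℚ) ≡⟨ lem₂ π h¹² β W ⟩
    ι 6 * (π * π) * (ι 2 * π + 1ℚ) * h¹² * (β * β) * (W * W) ∎
    where
    e c j R′ : ℚ
    e = h * ½ * (h * ½) * (h * ½) * (h * ½) * (h * ½) * (h * ½)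
    c = π * (h * h) * (f * f * β) * W * (fp * ψ)
    j = !⁻¹ (n ℕ.+ n ℕ.+ P)
    R′ = π * π * (ι 2 * π + 1ℚ) * h¹² * (β * β) * (W * W)
    lem = solve 13 (λ x π f φ h fp ψ a b β W F j →
      con 128 :* (con 1 :+ x) :* (h :* Κ ½ :* (h :* Κ ½) :* (h :* Κ ½) :* (h :* Κ ½) :* (h :* Κ ½) :* (h :* Κ ½) :* (f :* f :* β :* h :* φ :* π :* (f
        :* f :* β :* h :* φ :* π)) :* (π :* (h :* h) :* (f :* f :* β) :* W :* (fp :* ψ) :* (con 2 :* π :+ con 1)) :* F :* a :* b) :* (con 1 :* (π
        :* (h :* h) :* (f :* f :* β) :* W :* (fp :* ψ)) :* con 1 :* ψ :* con 1 :* (a :* j)) :* (con 1 :+ π)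
      := con 2 :* (π :* π :* (con 2 :* π :+ con 1) :* (h :* h :* (h :* h) :* (h :* h) :* (h :* h) :* (h :* h) :* (h :* h)) :* (β :* β) :* (W :* W))
        :* (F :* j) :* (con 1 :+ x) :* (f :* a) :* (f :* a) :* (f :* φ :* (f :* φ)) :* (π :* (f :* f :* β) :* ψ :* (π :* (f :* f :* β) :* ((con 1
        :+ π) :* b))) :* (fp :* ψ :* (fp :* ψ))) refl
    lem₁ = solve 7 (λ R x f a y z w →
      con 2 :* R :* (con 3 :* (con 1 :+ x)) :* (con 1 :+ x) :* (f :* a) :* (f :* a) :* (y :* y) :* (z :* z) :* (w :* w)
      := con 6 :* R :* (f :* ((con 1 :+ x) :* a)) :* (f :* ((con 1 :+ x) :* a)) :* (y :* y) :* (z :* z) :* (w :* w)) refl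
    lem₂ = solve 4 (λ π h β W →
      con 6 :* (π :* π :* (con 2 :* π :+ con 1) :* h :* (β :* β) :* (W :* W)) :* con 1 :* con 1 :* (con 1 :* con 1) :* (con 1 :* con 1) :* (con 1
        :* con 1)
      := con 6 :* (π :* π) :* (con 2 :* π :+ con 1) :* h :* (β :* β) :* (W :* W)) refl

2^*2⁻^ : ∀ n → ι (2 ℕ.^ n) * 2⁻^ n ≡ 1ℚ
2^*2⁻^ zero = refl
2^*2⁻^ (suc n) = trans (cong (_* 2⁻^ (suc n)) (ι-* 2 (2 ℕ.^ n))) (trans (lem (ι (2 ℕ.^ n)) (2⁻^ n)) (2^*2⁻^ n))
  where
  lem = solve 2 (λ a b → con 2 :* a :* (b :* Κ ½) := a :* b) refl

/1-injective : ∀ {i j} → i / 1 ≡ j / 1 → i ≡ j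
/1-injective {i} {j} eq with ℚ./-injective-≃ (mkℚᵘ i 0) (mkℚᵘ j 0) eq
... | ℚᵘ.*≡* eq′ = trans (sym (ℤ.*-identityʳ i)) (trans eq′ (ℤ.*-identityʳ j))

module Localisation (p : ℕ) (p-prime : Prime p) where

  record IsIntegral (x : ℚ) : Set where
    field
      denominator : ℕ
      numerator   : ℤ
      p∤          : ¬ p ∣ denominator
      equality    : x * ι denominator ≡ numerator / 1

  record ℤ₍ₚ₎ : Set where
    constructor _,_
    field
      val      : ℚ
      integral : IsIntegral val

  open ℤ₍ₚ₎ public

  π : ℚ
  π = ι p

  p∤1 : ¬ p ∣ 1
  p∤1 p∣1 = ℕ.<⇒≱ (ℕ.nonTrivial⇒n>1 p {{prime⇒nonTrivial p-prime}}) (ℕ.∣⇒≤ p∣1)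

  p∤* : ∀ {m n} → ¬ p ∣ m → ¬ p ∣ n → ¬ p ∣ m ℕ.* n
  p∤* {m} {n} p∤m p∤n p∣mn with euclidsLemma m n p-prime p∣mn
  ... | inj₁ p∣m = p∤m p∣m
  ... | inj₂ p∣n = p∤n p∣n

  p∤^ : ∀ {m} n → ¬ p ∣ m → ¬ p ∣ m ℕ.^ n
  p∤^ zero    p∤m = p∤1
  p∤^ (suc n) p∤m = p∤* p∤m (p∤^ n p∤m)

  infixl 6 _⊕_
  infixl 7 _⊛_
  infix 8 ⊖_

  opaque
    isIntegral-+ : ∀ {x y} → IsIntegral x → IsIntegral y → IsIntegral (x + y)
    isIntegral-+ {x} {y} i j = record
      { denominator = I.denominator ℕ.* J.denominator
      ; numerator   = I.numerator ℤ.* ℤ.+ J.denominator ℤ.+ J.numerator ℤ.* ℤ.+ I.denominator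
      ; p∤          = p∤* I.p∤ J.p∤
      ; equality    = begin
          (x + y) * ι (I.denominator ℕ.* J.denominator) ≡⟨ cong ((x + y) *_) (ι-* I.denominator J.denominator) ⟩
          (x + y) * (ι I.denominator * ι J.denominator) ≡⟨ lem x y (ι I.denominator) (ι J.denominator) ⟩
          x * ι I.denominator * ι J.denominator + y * ι J.denominator * ι I.denominator
            ≡⟨ cong₂ (λ u v → u * ι J.denominator + v * ι I.denominator) I.equality J.equality ⟩
          I.numerator / 1 * ι J.denominator + J.numerator / 1 * ι I.denominator
            ≡⟨ cong₂ _+_ (/1-homo-* I.numerator (ℤ.+ J.denominator)) (/1-homo-* J.numerator (ℤ.+ I.denominator)) ⟨
          (I.numerator ℤ.* ℤ.+ J.denominator) / 1 + (J.numerator ℤ.* ℤ.+ I.denominator) / 1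
            ≡⟨ /1-homo-+ (I.numerator ℤ.* ℤ.+ J.denominator) (J.numerator ℤ.* ℤ.+ I.denominator) ⟨
          (I.numerator ℤ.* ℤ.+ J.denominator ℤ.+ J.numerator ℤ.* ℤ.+ I.denominator) / 1 ∎
      }
      where
      module I = IsIntegral i
      module J = IsIntegral j
      lem : ∀ x y d e → (x + y) * (d * e) ≡ x * d * e + y * e * d
      lem = solve-∀ ℚ-ring

    isIntegral-* : ∀ {x y} → IsIntegral x → IsIntegral y → IsIntegral (x * y)
    isIntegral-* {x} {y} i j = record
      { denominator = I.denominator ℕ.* J.denominator
      ; numerator   = I.numerator ℤ.* J.numerator
      ; p∤          = p∤* I.p∤ J.p∤
      ; equality    = begin
          x * y * ι (I.denominator ℕ.* J.denominator) ≡⟨ cong (x * y *_) (ι-* I.denominator J.denominator) ⟩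
          x * y * (ι I.denominator * ι J.denominator) ≡⟨ lem x y (ι I.denominator) (ι J.denominator) ⟩
          x * ι I.denominator * (y * ι J.denominator) ≡⟨ cong₂ _*_ I.equality J.equality ⟩
          I.numerator / 1 * (J.numerator / 1) ≡⟨ /1-homo-* I.numerator J.numerator ⟨
          (I.numerator ℤ.* J.numerator) / 1 ∎
      }
      where
      module I = IsIntegral i
      module J = IsIntegral j
      lem : ∀ x y d e → x * y * (d * e) ≡ x * d * (y * e)
      lem = solve-∀ ℚ-ring

    isIntegral-neg : ∀ {x} → IsIntegral x → IsIntegral (- x)
    isIntegral-neg {x} i = record
      { denominator = I.denominator
      ; numerator   = ℤ.- I.numerator
      ; p∤          = I.p∤
      ; equality    = trans (sym (ℚ.neg-distribˡ-* x (ι I.denominator))) (trans (cong -_ I.equality) (sym (/1-homo-neg I.numerator)))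
      }
      where module I = IsIntegral i

    isIntegral-/1 : ∀ i → IsIntegral (i / 1)
    isIntegral-/1 i = record { denominator = 1 ; numerator = i ; p∤ = p∤1 ; equality = ℚ.*-identityʳ (i / 1) }

  _⊕_ _⊛_ : ℤ₍ₚ₎ → ℤ₍ₚ₎ → ℤ₍ₚ₎
  (x , i) ⊕ (y , j) = (x + y) , isIntegral-+ i j
  (x , i) ⊛ (y , j) = (x * y) , isIntegral-* i j

  ⊖_ : ℤ₍ₚ₎ → ℤ₍ₚ₎
  ⊖ (x , i) = (- x) , isIntegral-neg i

  ⟦_⟧ : ℕ → ℤ₍ₚ₎
  ⟦ n ⟧ = ι n , isIntegral-/1 (ℤ.+ n)

  Π : ℤ₍ₚ₎
  Π = ⟦ p ⟧

  opaque
    -- The reciprocal of n, or 0 when n is not a unit.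
    inv : ℕ → ℤ₍ₚ₎
    inv zero = ⟦ 0 ⟧
    inv n@(suc _) with p ∣? n
    ... | yes _   = ⟦ 0 ⟧
    ... | no  p∤n = ℤ.+ 1 / n , record { denominator = n ; numerator = ℤ.+ 1 ; p∤ = p∤n ; equality = /-*-cancel (ℤ.+ 1) n }

    inv-0 : val (inv 0) ≡ 0ℚ
    inv-0 = refl

    inv-inverse : ∀ {n} → ¬ p ∣ n → ι n * val (inv n) ≡ 1ℚ
    inv-inverse {zero} p∤0 = contradiction (p ℕ.∣0) p∤0
    inv-inverse {suc n} p∤n with p ∣? suc n
    ... | yes p∣n = contradiction p∣n p∤n
    ... | no  _   = trans (ℚ.*-comm (ι (suc n)) (ℤ.+ 1 / suc n)) (/-*-cancel (ℤ.+ 1) (suc n))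

  invℤ : ℤ → ℤ₍ₚ₎
  invℤ (ℤ.+ n)    = inv n
  invℤ ℤ.-[1+ n ] = ⊖ inv (suc n)

  invℤ-inverse : ∀ {i} → ¬ p ∣ ℤ.∣ i ∣ → i / 1 * val (invℤ i) ≡ 1ℚ
  invℤ-inverse {ℤ.+ n} p∤i = inv-inverse p∤i
  invℤ-inverse {ℤ.-[1+ n ]} p∤i = trans (cong (_* (- val (inv (suc n)))) (/1-homo-neg (ℤ.+ suc n))) (trans (lem (ι (suc n)) (val (inv (suc n)))) (inv-inverse p∤i))
    where
    lem = solve 2 (λ x y → :- x :* :- y := x :* y) refl

  module 1+π (a : ℤ₍ₚ₎) where
    private
      open module I = IsIntegral (integral a)
      e = ℤ.+ denominator ℤ.+ ℤ.+ p ℤ.* numerator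
      p∤e : ¬ p ∣ ℤ.∣ e ∣
      p∤e p∣e = p∤ (ℤᵈ.∣⇒∣ᵤ {ℤ.+ p} {ℤ.+ denominator} (ℤᵈ.∣m+n∣n⇒∣m {ℤ.+ p} {ℤ.+ denominator} {ℤ.+ p ℤ.* numerator} (ℤᵈ.∣ᵤ⇒∣ {ℤ.+ p} {e} p∣e) (ℤᵈ.divides numerator (ℤ.*-comm (ℤ.+ p) numerator))))
      lem = solve 4 (λ x a d y → (con 1 :+ x :* a) :* (d :* y) := (d :+ x :* (a :* d)) :* y) refl

    opaque
      ⁻¹ : ℤ₍ₚ₎
      ⁻¹ = ⟦ denominator ⟧ ⊛ invℤ e

      inverse : (1ℚ + π * val a) * val ⁻¹ ≡ 1ℚ
      inverse = begin
        (1ℚ + π * val a) * (ι denominator * val (invℤ e)) ≡⟨ lem π (val a) (ι denominator) (val (invℤ e)) ⟩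
        (ι denominator + π * (val a * ι denominator)) * val (invℤ e) ≡⟨ cong (λ x → (ι denominator + π * x) * val (invℤ e)) I.equality ⟩
        (ι denominator + π * (numerator / 1)) * val (invℤ e) ≡⟨ cong (λ x → (ι denominator + x) * val (invℤ e)) (/1-homo-* (ℤ.+ p) numerator) ⟨
        (ι denominator + (ℤ.+ p ℤ.* numerator) / 1) * val (invℤ e) ≡⟨ cong (_* val (invℤ e)) (/1-homo-+ (ℤ.+ denominator) (ℤ.+ p ℤ.* numerator)) ⟨
        e / 1 * val (invℤ e) ≡⟨ invℤ-inverse {e} p∤e ⟩
        1ℚ ∎

  p∤⇒coprime : ∀ {n} → ¬ p ∣ n → Coprime p n
  p∤⇒coprime p∤n (i∣p , i∣n) with prime⇒irreducible p-prime i∣p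
  ... | inj₁ i≡1 = i≡1
  ... | inj₂ refl = contradiction i∣n p∤n

  isIntegral⇒Integral : ∀ {x} → IsIntegral x → Integral p x
  isIntegral⇒Integral {x@(mkℚ a c-1 coprime)} i = p∤⇒coprime λ p∣c → p∤ (ℕ.∣-trans p∣c c∣d)
    where
    open IsIntegral i renaming (denominator to d; numerator to n)
    c = suc c-1
    eq : (a ℤ.* ℤ.+ d) / 1 ≡ (n ℤ.* ℤ.+ c) / 1
    eq = begin
      (a ℤ.* ℤ.+ d) / 1 ≡⟨ /1-homo-* a (ℤ.+ d) ⟩
      a / 1 * ι d ≡⟨ cong (_* ι d) (trans (sym (/-*-cancel a c)) (cong (_* ι c) (ℚ.↥p/↧p≡p x))) ⟩
      x * ι c * ι d ≡⟨ lem x (ι c) (ι d) ⟩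
      x * ι d * ι c ≡⟨ cong (_* ι c) equality ⟩
      n / 1 * ι c ≡⟨ /1-homo-* n (ℤ.+ c) ⟨
      (n ℤ.* ℤ.+ c) / 1 ∎
      where
      lem = solve 3 (λ x y z → x :* y :* z := x :* z :* y) refl
    c∣d : c ∣ d
    c∣d = coprime-divisor (Coprime.sym (Coprime.recompute coprime))
      (divides ℤ.∣ n ∣ (trans (sym (ℤ.abs-* a (ℤ.+ d))) (trans (cong ℤ.∣_∣ (/1-injective {a ℤ.* ℤ.+ d} {n ℤ.* ℤ.+ c} eq)) (ℤ.abs-* n (ℤ.+ c)))))

  infix 4 _≈[_]_
  record _≈[_]_ (x : ℚ) (i : ℕ) (y : ℚ) : Set where
    constructor _by_
    field
      quotient : ℤ₍ₚ₎
      equality : x ≡ y + π ^ i * val quotient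

  ≡⇒≈ : ∀ {i x y} → x ≡ y → x ≈[ i ] y
  ≡⇒≈ {i} {x} refl = ⟦ 0 ⟧ by lem x (π ^ i)
    where
    lem = solve 2 (λ x z → x := x :+ z :* con 0) refl

  ≈-sym : ∀ {i x y} → x ≈[ i ] y → y ≈[ i ] x
  ≈-sym {i} {x} {y} (q by eq) = (⊖ q) by trans (lem y (π ^ i) (val q)) (cong (_+ π ^ i * - val q) (sym eq))
    where
    lem = solve 3 (λ y z q → y := y :+ z :* q :+ z :* :- q) refl

  ≈-trans : ∀ {i x y z} → x ≈[ i ] y → y ≈[ i ] z → x ≈[ i ] z
  ≈-trans {i} {x} {y} {z} (q by eq) (r by eq′) = (r ⊕ q) by trans eq (trans (cong (_+ π ^ i * val q) eq′) (lem z (π ^ i) (val r) (val q)))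
    where
    lem = solve 4 (λ z w r q → z :+ w :* r :+ w :* q := z :+ w :* (r :+ q)) refl

  infix  3 _■
  infixr 2 _≈⟨_⟩_ _≐⟨_⟩_ _≐⟨_⟨_

  _■ : ∀ x {i} → x ≈[ i ] x
  x ■ = ≡⇒≈ refl

  _≈⟨_⟩_ : ∀ x {i y z} → x ≈[ i ] y → y ≈[ i ] z → x ≈[ i ] z
  x ≈⟨ x≈y ⟩ y≈z = ≈-trans x≈y y≈z

  _≐⟨_⟩_ : ∀ x {i y z} → x ≡ y → y ≈[ i ] z → x ≈[ i ] z
  x ≐⟨ refl ⟩ y≈z = y≈z

  _≐⟨_⟨_ : ∀ x {i y z} → y ≡ x → y ≈[ i ] z → x ≈[ i ] z
  x ≐⟨ refl ⟨ y≈z = y≈z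

  ≈-+ : ∀ {i x x′ y y′} → x ≈[ i ] x′ → y ≈[ i ] y′ → x + y ≈[ i ] x′ + y′
  ≈-+ {i} {x} {x′} {y} {y′} (q by eq) (r by eq′) = (q ⊕ r) by trans (cong₂ _+_ eq eq′) (lem x′ y′ (π ^ i) (val q) (val r))
    where
    lem = solve 5 (λ x y w q r → x :+ w :* q :+ (y :+ w :* r) := x :+ y :+ w :* (q :+ r)) refl

  ≈-*ˡ : ∀ {i} u {x y} → x ≈[ i ] y → val u * x ≈[ i ] val u * y
  ≈-*ˡ {i} u {x} {y} (q by eq) = (u ⊛ q) by trans (cong (val u *_) eq) (lem (val u) y (π ^ i) (val q))
    where
    lem = solve 4 (λ u y w q → u :* (y :+ w :* q) := u :* y :+ w :* (u :* q)) refl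

  ≈-*ʳ : ∀ {i} u {x y} → x ≈[ i ] y → x * val u ≈[ i ] y * val u
  ≈-*ʳ u {x} {y} x≈y = ≈-trans (≡⇒≈ (ℚ.*-comm x (val u))) (≈-trans (≈-*ˡ u x≈y) (≡⇒≈ (ℚ.*-comm (val u) y)))

  ≈-neg : ∀ {i x y} → x ≈[ i ] y → - x ≈[ i ] - y
  ≈-neg {i} {x} {y} (q by eq) = (⊖ q) by trans (cong -_ eq) (lem y (π ^ i) (val q))
    where
    lem = solve 3 (λ y w q → :- (y :+ w :* q) := :- y :+ w :* :- q) refl

  ≈-π : ∀ {i x y} → x ≈[ i ] y → π * x ≈[ suc i ] π * y
  ≈-π {i} {x} {y} (q by eq) = q by trans (cong (π *_) eq) (lem π y (π ^ i) (val q))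
    where
    lem = solve 4 (λ π y w q → π :* (y :+ w :* q) := π :* y :+ π :* w :* q) refl

  ≈-cancel : ∀ {i} u v {x y} → val u * val v ≡ 1ℚ → val u * x ≈[ i ] val u * y → x ≈[ i ] y
  ≈-cancel u v {x} {y} uv≡1 ux≈uy = ≈-trans (≡⇒≈ (sym (vu x))) (≈-trans (≈-*ˡ v ux≈uy) (≡⇒≈ (vu y)))
    where
    lem = solve 3 (λ u v x → v :* (u :* x) := u :* v :* x) refl
    vu : ∀ x → val v * (val u * x) ≡ x
    vu x = trans (lem (val u) (val v) x) (trans (cong (_* x) uv≡1) (ℚ.*-identityˡ x))

C-suc-* : ∀ k d → ι ((k ℕ.+ suc d) C suc k) * (1ℚ + ι k) ≡ ι ((k ℕ.+ suc d) C k) * (1ℚ + ι d)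
C-suc-* k d = begin
  ι ((k ℕ.+ suc d) C suc k) * (1ℚ + ι k) ≡⟨ cong (λ m → ι (m C suc k) * (1ℚ + ι k)) (ℕ.+-suc k d) ⟩
  ι ((suc k ℕ.+ d) C suc k) * (1ℚ + ι k) ≡⟨ cong (_* (1ℚ + ι k)) (C≡ (suc k) d) ⟩
  fac (suc k ℕ.+ d) * (!⁻¹ (suc k) * !⁻¹ d) * (1ℚ + ι k) ≡⟨ cong₂ (λ n x → fac n * (!⁻¹ (suc k) * x) * (1ℚ + ι k)) (sym (ℕ.+-suc k d)) (!⁻¹-suc d) ⟩
  fac (k ℕ.+ suc d) * (!⁻¹ (suc k) * ((1ℚ + ι d) * !⁻¹ (suc d))) * (1ℚ + ι k) ≡⟨ lem (fac (k ℕ.+ suc d)) (!⁻¹ (suc k)) (!⁻¹ (suc d)) (ι k) (ι d) ⟩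
  fac (k ℕ.+ suc d) * ((1ℚ + ι k) * !⁻¹ (suc k) * !⁻¹ (suc d)) * (1ℚ + ι d) ≡⟨ cong (λ x → fac (k ℕ.+ suc d) * (x * !⁻¹ (suc d)) * (1ℚ + ι d)) (!⁻¹-suc k) ⟨
  fac (k ℕ.+ suc d) * (!⁻¹ k * !⁻¹ (suc d)) * (1ℚ + ι d) ≡⟨ cong (_* (1ℚ + ι d)) (C≡ k (suc d)) ⟨
  ι ((k ℕ.+ suc d) C k) * (1ℚ + ι d) ∎
  where
  lem = solve 5 (λ f a b k d → f :* (a :* ((con 1 :+ d) :* b)) :* (con 1 :+ k) := f :* ((con 1 :+ k) :* a :* b) :* (con 1 :+ d)) refl

C-step : ∀ {n k} → k < n → ι (n C suc k) * (1ℚ + ι k) ≡ ι (n C k) * (ι n - ι k)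
C-step {n} {k} k<n = subst (λ m → ι (m C suc k) * (1ℚ + ι k) ≡ ι (m C k) * (ι m - ι k)) n≡
  (trans (C-suc-* k d) (cong (ι ((k ℕ.+ suc d) C k) *_) (trans (lem (ι k) (ι d)) (cong (_- ι k) (sym (trans (ι-+ k (suc d)) (cong (ι k +_) (ι-suc d))))))))
  where
  d = n ∸ suc k
  n≡ : k ℕ.+ suc d ≡ n
  n≡ = trans (ℕ.+-suc k d) (ℕ.m+[n∸m]≡n k<n)
  lem = solve 2 (λ k d → con 1 :+ d := k :+ (con 1 :+ d) :- k) refl

C-absorb : ∀ {n k} → k ≤ n → ι (suc n C suc k) * (1ℚ + ι k) ≡ (1ℚ + ι n) * ι (n C k)
C-absorb {n} {k} k≤n = subst (λ n → ι (suc n C suc k) * (1ℚ + ι k) ≡ (1ℚ + ι n) * ι (n C k)) (ℕ.m+[n∸m]≡n k≤n) (begin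
  ι (suc (k ℕ.+ d) C suc k) * (1ℚ + ι k) ≡⟨ cong (_* (1ℚ + ι k)) (C≡ (suc k) d) ⟩
  fac (suc (k ℕ.+ d)) * (!⁻¹ (suc k) * !⁻¹ d) * (1ℚ + ι k) ≡⟨ cong (λ x → x * (!⁻¹ (suc k) * !⁻¹ d) * (1ℚ + ι k)) (fac-suc (k ℕ.+ d)) ⟩
  (1ℚ + ι (k ℕ.+ d)) * fac (k ℕ.+ d) * (!⁻¹ (suc k) * !⁻¹ d) * (1ℚ + ι k) ≡⟨ lem (1ℚ + ι (k ℕ.+ d)) (fac (k ℕ.+ d)) (!⁻¹ (suc k)) (!⁻¹ d) (1ℚ + ι k) ⟩
  (1ℚ + ι (k ℕ.+ d)) * (fac (k ℕ.+ d) * ((1ℚ + ι k) * !⁻¹ (suc k) * !⁻¹ d)) ≡⟨ cong (λ x → (1ℚ + ι (k ℕ.+ d)) * (fac (k ℕ.+ d) * (x * !⁻¹ d))) (!⁻¹-suc k) ⟨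
  (1ℚ + ι (k ℕ.+ d)) * (fac (k ℕ.+ d) * (!⁻¹ k * !⁻¹ d)) ≡⟨ cong ((1ℚ + ι (k ℕ.+ d)) *_) (C≡ k d) ⟨
  (1ℚ + ι (k ℕ.+ d)) * ι ((k ℕ.+ d) C k) ∎)
  where
  d = n ∸ k
  lem = solve 5 (λ n f a b k → n :* f :* (a :* b) :* k := n :* (f :* (k :* a :* b))) refl

∑C : ℕ → ℕ → ℕ
∑C n zero = 0
∑C n (suc k) = ∑C n k ℕ.+ n C k

∑C-suc : ∀ n k → ∑C (suc n) (suc k) ≡ ∑C n (suc k) ℕ.+ ∑C n k
∑C-suc n zero = refl
∑C-suc n (suc k) = begin
  ∑C (suc n) (suc k) ℕ.+ suc n C suc k ≡⟨ cong₂ ℕ._+_ (∑C-suc n k) (sym (nCk+nC[k+1]≡[n+1]C[k+1] n k)) ⟩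
  ∑C n (suc k) ℕ.+ ∑C n k ℕ.+ (n C k ℕ.+ n C suc k) ≡⟨ lem (∑C n (suc k)) (∑C n k) (n C k) (n C suc k) ⟩
  ∑C n (suc k) ℕ.+ n C suc k ℕ.+ (∑C n k ℕ.+ n C k) ∎
  where
  lem : ∀ a b c d → a ℕ.+ b ℕ.+ (c ℕ.+ d) ≡ a ℕ.+ d ℕ.+ (b ℕ.+ c)
  lem = ℕ-Solver.solve-∀

∑C-row : ∀ n → ∑C n (suc n) ≡ 2 ℕ.^ n
∑C-row zero = refl
∑C-row (suc n) = begin
  ∑C (suc n) (suc (suc n)) ≡⟨ ∑C-suc n (suc n) ⟩
  ∑C n (suc n) ℕ.+ n C suc n ℕ.+ ∑C n (suc n) ≡⟨ cong (λ x → ∑C n (suc n) ℕ.+ x ℕ.+ ∑C n (suc n)) (k>n⇒nCk≡0 (ℕ.n<1+n n)) ⟩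
  ∑C n (suc n) ℕ.+ 0 ℕ.+ ∑C n (suc n) ≡⟨ cong (λ x → x ℕ.+ 0 ℕ.+ x) (∑C-row n) ⟩
  2 ℕ.^ n ℕ.+ 0 ℕ.+ 2 ℕ.^ n ≡⟨ ℕ.+-comm (2 ℕ.^ n ℕ.+ 0) (2 ℕ.^ n) ⟩
  2 ℕ.^ suc n ∎

∑C-half-row : ∀ n → ∑C (suc (n ℕ.+ n)) (suc n) ≡ 4 ℕ.^ n
∑C-half-row zero = refl
∑C-half-row (suc n) = begin
  ∑C (suc (suc n ℕ.+ suc n)) (2 ℕ.+ n) ≡⟨ cong (λ m → ∑C (suc m) (2 ℕ.+ n)) (Double.suc+suc n) ⟩
  ∑C (suc (suc N)) (2 ℕ.+ n) ≡⟨ trans (∑C-suc (suc N) (suc n)) (cong₂ ℕ._+_ (∑C-suc N (suc n)) (∑C-suc N n)) ⟩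
  ∑C N (suc n) ℕ.+ N C suc n ℕ.+ ∑C N (suc n) ℕ.+ (∑C N (suc n) ℕ.+ ∑C N n) ≡⟨ cong (λ x → ∑C N (suc n) ℕ.+ x ℕ.+ ∑C N (suc n) ℕ.+ (∑C N (suc n) ℕ.+ ∑C N n)) middle ⟩
  ∑C N (suc n) ℕ.+ N C n ℕ.+ ∑C N (suc n) ℕ.+ (∑C N (suc n) ℕ.+ ∑C N n) ≡⟨ lem (∑C N n) (N C n) ⟩
  4 ℕ.* ∑C N (suc n) ≡⟨ cong (4 ℕ.*_) (∑C-half-row n) ⟩
  4 ℕ.^ suc n ∎
  where
  N = suc (n ℕ.+ n)
  middle : N C suc n ≡ N C n
  middle = trans (nCk≡nC[n∸k] {suc n} {N} (s≤s (ℕ.m≤m+n n n))) (cong (N C_) (ℕ.m+n∸m≡n n n))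
  lem : ∀ a b → a ℕ.+ b ℕ.+ b ℕ.+ (a ℕ.+ b) ℕ.+ (a ℕ.+ b ℕ.+ a) ≡ 4 ℕ.* (a ℕ.+ b)
  lem = ℕ-Solver.solve-∀

sgn² : ∀ n → sgn n * sgn n ≡ 1ℚ
sgn² zero = refl
sgn² (suc n) = trans (lem (sgn n)) (sgn² n)
  where
  lem = solve 1 (λ x → :- x :* :- x := x :* x) refl

sgn-even : ∀ n → sgn (n ℕ.+ n) ≡ 1ℚ
sgn-even zero = refl
sgn-even (suc n) = trans (cong sgn (Double.suc+suc n)) (trans (lem (sgn (n ℕ.+ n))) (sgn-even n))
  where
  lem = solve 1 (λ x → :- (:- x) := x) refl

module Sums (p : ℕ) (p-prime : Prime p) where
  open Localisation p p-prime

  ∑ ∏ : ℕ → (ℕ → ℤ₍ₚ₎) → ℤ₍ₚ₎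
  ∑ zero    f = ⟦ 0 ⟧
  ∑ (suc n) f = ∑ n f ⊕ f n
  ∏ zero    f = ⟦ 1 ⟧
  ∏ (suc n) f = ∏ n f ⊛ f n

  ∑-cong : ∀ {i} n (f g : ℕ → ℤ₍ₚ₎) → (∀ j → j < n → val (f j) ≈[ i ] val (g j)) → val (∑ n f) ≈[ i ] val (∑ n g)
  ∑-cong zero    f g f≈g = ≡⇒≈ refl
  ∑-cong (suc n) f g f≈g = ≈-+ (∑-cong n f g (λ j j<n → f≈g j (ℕ.m<n⇒m<1+n j<n))) (f≈g n (ℕ.n<1+n n))

  ∑-head : ∀ n f → val (∑ (suc n) f) ≡ val (f 0) + val (∑ n (f ∘ suc))
  ∑-head zero    f = ℚ.+-comm 0ℚ (val (f 0))
  ∑-head (suc n) f = trans (cong (_+ val (f (suc n))) (∑-head n f)) (ℚ.+-assoc (val (f 0)) (val (∑ n (f ∘ suc))) (val (f (suc n))))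

  ∑-linear : ∀ n (a b : ℚ) (f g h : ℕ → ℤ₍ₚ₎) → (∀ j → j < n → val (h j) ≡ a * val (f j) + b * val (g j)) → val (∑ n h) ≡ a * val (∑ n f) + b * val (∑ n g)
  ∑-linear zero    a b f g h eq = lem a b
    where
    lem = solve 2 (λ a b → con 0 := a :* con 0 :+ b :* con 0) refl
  ∑-linear (suc n) a b f g h eq = trans (cong₂ _+_ (∑-linear n a b f g h (λ j j<n → eq j (ℕ.m<n⇒m<1+n j<n))) (eq n (ℕ.n<1+n n))) (lem a b (val (∑ n f)) (val (∑ n g)) (val (f n)) (val (g n)))
    where
    lem = solve 6 (λ a b x y u v → a :* x :+ b :* y :+ (a :* u :+ b :* v) := a :* (x :+ u) :+ b :* (y :+ v)) refl

  ∑-split : ∀ m n f → val (∑ (m ℕ.+ n) f) ≡ val (∑ m f) + val (∑ n (λ j → f (m ℕ.+ j)))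
  ∑-split m zero f = trans (cong (λ k → val (∑ k f)) (ℕ.+-identityʳ m)) (sym (ℚ.+-identityʳ (val (∑ m f))))
  ∑-split m (suc n) f = trans (cong (λ k → val (∑ k f)) (ℕ.+-suc m n)) (trans (cong (_+ val (f (m ℕ.+ n))) (∑-split m n f)) (ℚ.+-assoc (val (∑ m f)) (val (∑ n (λ j → f (m ℕ.+ j)))) (val (f (m ℕ.+ n)))))

  ∑-parity : ∀ n f → val (∑ (n ℕ.+ n) f) ≡ val (∑ n (λ j → f (j ℕ.+ j))) + val (∑ n (λ j → f (suc (j ℕ.+ j))))
  ∑-parity zero f = refl
  ∑-parity (suc n) f = trans (cong (λ k → val (∑ k f)) (Double.suc+suc n)) (trans (cong (λ x → x + val (f (n ℕ.+ n)) + val (f (suc (n ℕ.+ n)))) (∑-parity n f))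
    (lem (val (∑ n (λ j → f (j ℕ.+ j)))) (val (∑ n (λ j → f (suc (j ℕ.+ j))))) (val (f (n ℕ.+ n))) (val (f (suc (n ℕ.+ n))))))
    where
    lem = solve 4 (λ a b c d → a :+ b :+ c :+ d := a :+ c :+ (b :+ d)) refl

  ∑-reverse : ∀ {i} n (f g : ℕ → ℤ₍ₚ₎) → (∀ j k → suc (j ℕ.+ k) ≡ n → val (f j) ≈[ i ] val (g k)) → val (∑ n f) ≈[ i ] val (∑ n g)
  ∑-reverse zero    f g f≈g = ≡⇒≈ refl
  ∑-reverse (suc n) f g f≈g = ≈-trans (≡⇒≈ (trans (∑-head n f) (ℚ.+-comm (val (f 0)) (val (∑ n (f ∘ suc))))))
    (≈-+ (∑-reverse n (f ∘ suc) g (λ j k eq → f≈g (suc j) k (cong suc eq))) (f≈g 0 n refl))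

  ∏-1+π² : ∀ n (a : ℕ → ℤ₍ₚ₎) → val (∏ n (λ j → ⟦ 1 ⟧ ⊕ Π ⊛ Π ⊛ a j)) ≈[ 3 ] 1ℚ + π * π * val (∑ n a)
  ∏-1+π² zero a = ≡⇒≈ (lem (π * π))
    where
    lem = solve 1 (λ x → con 1 := con 1 :+ x :* con 0) refl
  ∏-1+π² (suc n) a = ≈-trans (≈-*ʳ (⟦ 1 ⟧ ⊕ Π ⊛ Π ⊛ a n) (∏-1+π² n a)) ((Π ⊛ ∑ n a ⊛ a n) by lem π (val (∑ n a)) (val (a n)))
    where
    lem = solve 3 (λ π s a →
      (con 1 :+ π :* π :* s) :* (con 1 :+ π :* π :* a)
      := con 1 :+ π :* π :* (s :+ a) :+ π :* (π :* (π :* con 1)) :* (π :* s :* a)) refl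

  ∏-1-π : ∀ n (a : ℕ → ℤ₍ₚ₎) → let H = val (∑ n a) in
    ι 2 * val (∏ n (λ j → ⟦ 1 ⟧ ⊕ ⊖ (Π ⊛ a j))) ≈[ 3 ] ι 2 - ι 2 * (π * H) + (π * H * (π * H) - π * π * val (∑ n (λ j → a j ⊛ a j)))
  ∏-1-π zero a = ≡⇒≈ (lem π)
    where
    lem = solve 1 (λ π → con 2 :* con 1 := con 2 :- con 2 :* (π :* con 0) :+ (π :* con 0 :* (π :* con 0) :- π :* π :* con 0)) refl
  ∏-1-π (suc n) a = ≈-trans (≡⇒≈ (sym (ℚ.*-assoc (ι 2) (val (∏ n (λ j → ⟦ 1 ⟧ ⊕ ⊖ (Π ⊛ a j)))) (1ℚ - π * val (a n)))))
    (≈-trans (≈-*ʳ (⟦ 1 ⟧ ⊕ ⊖ (Π ⊛ a n)) (∏-1-π n a)) ((⊖ (a n ⊛ (∑ n a ⊛ ∑ n a ⊕ ⊖ ∑ n (λ j → a j ⊛ a j)))) by lem π (val (∑ n a)) (val (∑ n (λ j → a j ⊛ a j))) (val (a n))))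
    where
    lem = solve 4 (λ π H S a →
      (con 2 :- con 2 :* (π :* H) :+ (π :* H :* (π :* H) :- π :* π :* S)) :* (con 1 :- π :* a)
      := con 2 :- con 2 :* (π :* (H :+ a)) :+ (π :* (H :+ a) :* (π :* (H :+ a)) :- π :* π :* (S :+ a :* a)) :+ π :* (π :* (π :* con 1)) :* :- (a :* (H
        :* H :- S))) refl

  ∑C-even : ∀ n k → val (∑ (suc k) (λ j → ⟦ suc n C (j ℕ.+ j) ⟧)) ≡ ι (∑C n (suc (k ℕ.+ k)))
  ∑C-even n zero = refl
  ∑C-even n (suc k) = begin
    val (∑ (suc k) (λ j → ⟦ suc n C (j ℕ.+ j) ⟧)) + ι (suc n C (suc k ℕ.+ suc k))
      ≡⟨ cong₂ _+_ (∑C-even n k) (trans (cong (λ m → ι (suc n C m)) (Double.suc+suc k)) (trans (cong ι (sym (nCk+nC[k+1]≡[n+1]C[k+1] n (suc (k ℕ.+ k))))) (ι-+ (n C suc (k ℕ.+ k)) (n C suc (suc (k ℕ.+ k)))))) ⟩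
    ι (∑C n (suc (k ℕ.+ k))) + (ι (n C suc (k ℕ.+ k)) + ι (n C suc (suc (k ℕ.+ k)))) ≡⟨ ℚ.+-assoc (ι (∑C n (suc (k ℕ.+ k)))) (ι (n C suc (k ℕ.+ k))) (ι (n C suc (suc (k ℕ.+ k)))) ⟨
    ι (∑C n (suc (k ℕ.+ k))) + ι (n C suc (k ℕ.+ k)) + ι (n C suc (suc (k ℕ.+ k)))
      ≡⟨ trans (cong (_+ ι (n C suc (suc (k ℕ.+ k)))) (sym (ι-+ (∑C n (suc (k ℕ.+ k))) (n C suc (k ℕ.+ k))))) (sym (ι-+ (∑C n (suc (suc (k ℕ.+ k)))) (n C suc (suc (k ℕ.+ k))))) ⟩
    ι (∑C n (suc (suc (suc (k ℕ.+ k))))) ≡⟨ cong (λ m → ι (∑C n (suc m))) (Double.suc+suc k) ⟨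
    ι (∑C n (suc (suc k ℕ.+ suc k))) ∎

module OddPrime (P : ℕ) (p-prime : Prime (suc (P ℕ.+ P))) (1<P : 1 < P) where
  p : ℕ
  p = suc (P ℕ.+ P)

  open Localisation p p-prime
  open Sums p p-prime

  p∤ : ∀ {j} .{{_ : NonZero j}} → j < p → ¬ p ∣ j
  p∤ j<p p∣j = ℕ.<⇒≱ j<p (ℕ.∣⇒≤ p∣j)

  inv-unique : ∀ {n} x → ¬ p ∣ n → ι n * x ≡ 1ℚ → x ≡ val (inv n)
  inv-unique {n} x p∤n eq = begin
    x ≡⟨ ℚ.*-identityʳ x ⟨
    x * 1ℚ ≡⟨ cong (x *_) (inv-inverse p∤n) ⟨
    x * (ι n * val (inv n)) ≡⟨ lem x (ι n) (val (inv n)) ⟩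
    ι n * x * val (inv n) ≡⟨ cong (_* val (inv n)) eq ⟩
    1ℚ * val (inv n) ≡⟨ ℚ.*-identityˡ (val (inv n)) ⟩
    val (inv n) ∎
    where
    lem = solve 3 (λ x n i → x :* (n :* i) := n :* x :* i) refl

  inv-reflect : ∀ a b .{{_ : NonZero a}} .{{_ : NonZero b}} → a ℕ.+ b ≡ p → val (inv a) ≈[ 1 ] - val (inv b)
  inv-reflect a b a+b≡p = (inv a ⊛ inv b) by (begin
    A ≡⟨ lem A B (ι a) (ι b) ⟩
    - (ι a * A * B) + A * (1ℚ - ι b * B) + (ι a + ι b) * (A * B)
      ≡⟨ cong₂ (λ x y → - (x * B) + A * (1ℚ - y) + (ι a + ι b) * (A * B)) (inv-inverse (p∤ a<p)) (inv-inverse (p∤ b<p)) ⟩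
    - (1ℚ * B) + A * (1ℚ - 1ℚ) + (ι a + ι b) * (A * B) ≡⟨ cong (λ x → - (1ℚ * B) + A * (1ℚ - 1ℚ) + x * (A * B)) (trans (sym (ι-+ a b)) (cong ι a+b≡p)) ⟩
    - (1ℚ * B) + A * (1ℚ - 1ℚ) + π * (A * B) ≡⟨ lem′ A B π ⟩
    - B + π * 1ℚ * (A * B) ∎)
    where
    A = val (inv a)
    B = val (inv b)
    a<p : a < p
    a<p = subst (a <_) a+b≡p (ℕ.m<m+n a (ℕ.>-nonZero⁻¹ b))
    b<p : b < p
    b<p = subst (b <_) a+b≡p (ℕ.m<n+m b (ℕ.>-nonZero⁻¹ a))
    lem = solve 4 (λ A B a b → A := :- (a :* A :* B) :+ A :* (con 1 :- b :* B) :+ (a :+ b) :* (A :* B)) refl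
    lem′ = solve 3 (λ A B π → :- (con 1 :* B) :+ A :* (con 1 :- con 1) :+ π :* (A :* B) := :- B :+ π :* con 1 :* (A :* B)) refl

  inv-reflect² : ∀ a b .{{_ : NonZero a}} .{{_ : NonZero b}} → a ℕ.+ b ≡ p → val (inv a) * val (inv a) ≈[ 1 ] val (inv b) * val (inv b)
  inv-reflect² a b eq = ≈-trans (≈-*ʳ (inv a) (inv-reflect a b eq)) (≈-trans (≈-*ˡ (⊖ inv b) (inv-reflect a b eq)) (≡⇒≈ (lem (val (inv b)))))
    where
    lem = solve 1 (λ x → :- x :* :- x := x :* x) refl

  y : ℕ → ℤ₍ₚ₎
  y j = inv (suc j)

  H : ℕ → ℤ₍ₚ₎
  H n = ∑ n y

  S₂ O₂ : ℤ₍ₚ₎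
  S₂ = ∑ P (λ j → y j ⊛ y j)
  O₂ = ∑ P (λ j → y (j ℕ.+ j) ⊛ y (j ℕ.+ j))

  P≤2P : P ≤ P ℕ.+ P
  P≤2P = ℕ.m≤m+n P P

  2j+1<2P : ∀ {j} → j < P → suc (j ℕ.+ j) < P ℕ.+ P
  2j+1<2P {j} j<P = subst (_≤ P ℕ.+ P) (Double.suc+suc j) (ℕ.+-mono-≤ j<P j<P)

  y-even : ∀ {j} → j < P → val (y (suc (j ℕ.+ j))) ≡ ½ * val (y j)
  y-even {j} j<P = sym (inv-unique (½ * val (y j)) (p∤ (s≤s (2j+1<2P j<P))) (begin
    ι (suc (suc (j ℕ.+ j))) * (½ * val (y j)) ≡⟨ cong (λ m → ι m * (½ * val (y j))) (Double.suc+suc j) ⟨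
    ι (suc j ℕ.+ suc j) * (½ * val (y j)) ≡⟨ cong (_* (½ * val (y j))) (Double.ι2n (suc j)) ⟩
    ι 2 * ι (suc j) * (½ * val (y j)) ≡⟨ lem (ι (suc j)) (val (y j)) ⟩
    ι (suc j) * val (y j) ≡⟨ inv-inverse (p∤ (s≤s (ℕ.≤-trans j<P P≤2P))) ⟩
    1ℚ ∎))
    where
    lem = solve 2 (λ j y → con 2 :* j :* (Κ ½ :* y) := j :* y) refl

  even² : val (∑ P (λ j → y (suc (j ℕ.+ j)) ⊛ y (suc (j ℕ.+ j)))) ≡ (ℤ.+ 1 / 4) * val S₂
  even² = trans (∑-linear P (ℤ.+ 1 / 4) 0ℚ (λ j → y j ⊛ y j) (λ _ → ⟦ 0 ⟧) (λ j → y (suc (j ℕ.+ j)) ⊛ y (suc (j ℕ.+ j)))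
    (λ j j<P → trans (cong (λ x → x * x) (y-even j<P)) (lem (val (y j))))) (lem′ (val S₂) (val (∑ P (λ _ → ⟦ 0 ⟧))))
    where
    lem = solve 1 (λ y → Κ ½ :* y :* (Κ ½ :* y) := Κ (ℤ.+ 1 / 4) :* (y :* y) :+ con 0 :* con 0) refl
    lem′ = solve 2 (λ s z → Κ (ℤ.+ 1 / 4) :* s :+ con 0 :* z := Κ (ℤ.+ 1 / 4) :* s) refl

  ι4*¼ = solve 1 (λ x → con 4 :* (Κ (ℤ.+ 1 / 4) :* x) := x) refl

  -- The reflection j ↦ p − j exchanges the odd and the even j < p.
  4O₂≈S₂ : ι 4 * val O₂ ≈[ 1 ] val S₂
  4O₂≈S₂ = ≈-trans (≈-*ˡ ⟦ 4 ⟧ (∑-reverse P (λ j → y (j ℕ.+ j) ⊛ y (j ℕ.+ j)) (λ j → y (suc (j ℕ.+ j)) ⊛ y (suc (j ℕ.+ j))) λ j k eq → inv-reflect² (suc (j ℕ.+ j)) (suc (suc (k ℕ.+ k))) (trans (lem j k) (cong (λ n → suc (n ℕ.+ n)) eq))))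
    (≡⇒≈ (trans (cong (ι 4 *_) even²) (ι4*¼ (val S₂))))
    where
    lem : ∀ j k → suc (j ℕ.+ j) ℕ.+ suc (suc (k ℕ.+ k)) ≡ suc (suc (j ℕ.+ k) ℕ.+ suc (j ℕ.+ k))
    lem = ℕ-Solver.solve-∀

  S₂+S₂ : val (∑ (P ℕ.+ P) (λ j → y j ⊛ y j)) ≈[ 1 ] val S₂ + val S₂
  S₂+S₂ = ≈-trans (≡⇒≈ (∑-split P P (λ j → y j ⊛ y j))) (≈-+ (val S₂ ■)
    (∑-reverse P (λ j → y (P ℕ.+ j) ⊛ y (P ℕ.+ j)) (λ j → y j ⊛ y j) λ j k eq → inv-reflect² (suc (P ℕ.+ j)) (suc k) (trans (lem P j k) (cong (λ n → suc (P ℕ.+ n)) eq))))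
    where
    lem : ∀ P j k → suc (P ℕ.+ j) ℕ.+ suc k ≡ suc (P ℕ.+ suc (j ℕ.+ k))
    lem = ℕ-Solver.solve-∀

  4<p : 4 < p
  4<p = s≤s (ℕ.+-mono-≤ 1<P 1<P)

  S₂≈0 : val S₂ ≈[ 1 ] 0ℚ
  S₂≈0 = ≈-cancel ⟦ 6 ⟧ (inv 6) (inv-inverse (p∤* {2} {3} (p∤ (ℕ.≤-trans (s≤s (s≤s (s≤s z≤n))) 4<p)) (p∤ (ℕ.≤-trans (s≤s (s≤s (s≤s (s≤s z≤n)))) 4<p)))) (
    ι 6 * val S₂ ≐⟨ lem (val S₂) ⟩
    ι 4 * (val S₂ + val S₂) + - (ι 2 * val S₂) ≈⟨ ≈-+ (≈-*ˡ ⟦ 4 ⟧ (≈-sym S₂+S₂)) (≡⇒≈ refl) ⟩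
    ι 4 * val (∑ (P ℕ.+ P) (λ j → y j ⊛ y j)) + - (ι 2 * val S₂) ≐⟨ cong (λ x → ι 4 * x + - (ι 2 * val S₂)) (trans (∑-parity P (λ j → y j ⊛ y j)) (cong (val O₂ +_) even²)) ⟩
    ι 4 * (val O₂ + (ℤ.+ 1 / 4) * val S₂) + - (ι 2 * val S₂) ≐⟨ lem₁ (val O₂) (val S₂) ⟩
    ι 4 * val O₂ + - val S₂ ≈⟨ ≈-+ 4O₂≈S₂ (≡⇒≈ refl) ⟩
    val S₂ + - val S₂ ≐⟨ lem₂ (val S₂) ⟩
    ι 6 * 0ℚ ■)
    where
    lem = solve 1 (λ s → con 6 :* s := con 4 :* (s :+ s) :+ :- (con 2 :* s)) refl
    lem₁ = solve 2 (λ o s → con 4 :* (o :+ Κ (ℤ.+ 1 / 4) :* s) :+ :- (con 2 :* s) := con 4 :* o :+ :- s) refl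
    lem₂ = solve 1 (λ s → s :+ :- s := con 6 :* con 0) refl

  π²S₂≈0 : π * π * val S₂ ≈[ 3 ] 0ℚ
  π²S₂≈0 = ≈-trans (≡⇒≈ (ℚ.*-assoc π π (val S₂))) (≈-trans (≈-π (≈-π S₂≈0)) (≡⇒≈ (lem π)))
    where
    lem = solve 1 (λ π → π :* (π :* con 0) := con 0) refl

  fac≡∏ : ∀ n → fac n ≡ val (∏ n (λ j → ⟦ suc j ⟧))
  fac≡∏ zero = refl
  fac≡∏ (suc n) = trans (ι-* (suc n) (n !)) (trans (ℚ.*-comm (ι (suc n)) (fac n)) (cong (_* ι (suc n)) (fac≡∏ n)))

  ∏rise ∏fall : ℕ → ℕ → ℤ₍ₚ₎
  ∏rise a n = ∏ n (λ j → ⟦ a ⟧ ⊕ ⟦ suc j ⟧)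
  ∏fall a n = ∏ n (λ j → ⟦ a ⟧ ⊕ ⊖ ⟦ j ⟧)

  fac-rise : ∀ a n → fac (a ℕ.+ n) ≡ fac a * val (∏rise a n)
  fac-rise a zero = trans (cong fac (ℕ.+-identityʳ a)) (sym (ℚ.*-identityʳ (fac a)))
  fac-rise a (suc n) = begin
    fac (a ℕ.+ suc n) ≡⟨ cong fac (ℕ.+-suc a n) ⟩
    fac (suc (a ℕ.+ n)) ≡⟨ ι-* (suc (a ℕ.+ n)) ((a ℕ.+ n) !) ⟩
    ι (suc (a ℕ.+ n)) * fac (a ℕ.+ n) ≡⟨ cong₂ _*_ (trans (cong ι (sym (ℕ.+-suc a n))) (ι-+ a (suc n))) (fac-rise a n) ⟩
    (ι a + ι (suc n)) * (fac a * val (∏rise a n)) ≡⟨ lem (ι a + ι (suc n)) (fac a) (val (∏rise a n)) ⟩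
    fac a * (val (∏rise a n) * (ι a + ι (suc n))) ∎
    where
    lem = solve 3 (λ x y z → x :* (y :* z) := y :* (z :* x)) refl

  fac-fall : ∀ {c} k m → k ℕ.+ m ≡ c → fac c ≡ fac k * val (∏fall c m)
  fac-fall k zero refl = trans (cong fac (ℕ.+-identityʳ k)) (sym (ℚ.*-identityʳ (fac k)))
  fac-fall {c} k (suc m) eq = begin
    fac c ≡⟨ fac-fall (suc k) m (trans (sym (ℕ.+-suc k m)) eq) ⟩
    fac (suc k) * val (∏fall c m) ≡⟨ cong (_* val (∏fall c m)) (ι-* (suc k) (k !)) ⟩
    ι (suc k) * fac k * val (∏fall c m) ≡⟨ lem (ι (suc k)) (fac k) (val (∏fall c m)) (ι m) ⟩
    fac k * (val (∏fall c m) * (ι (suc k) + ι m - ι m)) ≡⟨ cong (λ x → fac k * (val (∏fall c m) * (x - ι m))) (trans (sym (ι-+ (suc k) m)) (cong ι (trans (sym (ℕ.+-suc k m)) eq))) ⟩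
    fac k * (val (∏fall c m) * (ι c - ι m)) ∎
    where
    lem = solve 4 (λ x y z m → x :* y :* z := y :* (z :* (x :+ m :- m))) refl

  y-inverse : ∀ {j} → j < P ℕ.+ P → ι (suc j) * val (y j) ≡ 1ℚ
  y-inverse j<2P = inv-inverse (p∤ (s≤s j<2P))

  2P : ℕ
  2P = P ℕ.+ P

  ι2P : ι 2P ≡ π - 1ℚ
  ι2P = trans (lem (ι 2P)) (cong (_- 1ℚ) (sym (ι-suc 2P)))
    where
    lem = solve 1 (λ x → x := con 1 :+ x :- con 1) refl

  -- B and Γ are (−1)^P C(p−1, P) and C(p+P, P), and W is C(2p−1, p).
  B Γ W : ℤ₍ₚ₎
  B = ∏ P (λ j → ⟦ 1 ⟧ ⊕ ⊖ (Π ⊛ y j))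
  Γ = ∏ P (λ j → ⟦ 1 ⟧ ⊕ Π ⊛ y j)
  W = ∏ P (λ j → ⟦ 1 ⟧ ⊕ Π ⊛ Π ⊛ (⟦ 2 ⟧ ⊛ (y j ⊛ inv (2P ∸ j))))

  fac-2P : fac 2P ≡ fac P * fac P * (sgn P * val B)
  fac-2P = begin
    fac 2P ≡⟨ fac-fall P P refl ⟩
    fac P * val (∏fall 2P P) ≡⟨ cong (fac P *_) (trans (go P ℕ.≤-refl) (cong (_* (sgn P * val B)) (sym (fac≡∏ P)))) ⟩
    fac P * (fac P * (sgn P * val B)) ≡⟨ ℚ.*-assoc (fac P) (fac P) (sgn P * val B) ⟨
    fac P * fac P * (sgn P * val B) ∎
    where
    lem = solve 6 (λ a s b j y π →
      a :* (s :* b) :* (π :- con 1 :- j)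
      := a :* (con 1 :+ j) :* (:- s :* (b :* (con 1 :- π :* y))) :- a :* s :* b :* π :* ((con 1 :+ j) :* y :- con 1)) refl
    lem′ = solve 2 (λ x a → x :- a :* (con 1 :- con 1) := x) refl
    go : ∀ n → n ≤ P → val (∏fall 2P n) ≡ val (∏ n (λ j → ⟦ suc j ⟧)) * (sgn n * val (∏ n (λ j → ⟦ 1 ⟧ ⊕ ⊖ (Π ⊛ y j))))
    go zero    _ = refl
    go (suc n) n<P = begin
      val (∏fall 2P n) * (ι 2P - ι n) ≡⟨ cong₂ (λ x y → x * (y - ι n)) (go n (ℕ.<⇒≤ n<P)) ι2P ⟩
      a * (sgn n * b) * (π - 1ℚ - ι n) ≡⟨ lem a (sgn n) b (ι n) (val (y n)) π ⟩
      a * (1ℚ + ι n) * (- sgn n * (b * (1ℚ - π * val (y n)))) - a * sgn n * b * π * ((1ℚ + ι n) * val (y n) - 1ℚ)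
        ≡⟨ cong (λ x → a * (1ℚ + ι n) * (- sgn n * (b * (1ℚ - π * val (y n)))) - a * sgn n * b * π * (x * val (y n) - 1ℚ)) (ι-suc n) ⟨
      a * (1ℚ + ι n) * (- sgn n * (b * (1ℚ - π * val (y n)))) - a * sgn n * b * π * (ι (suc n) * val (y n) - 1ℚ)
        ≡⟨ cong₂ (λ x z → a * x * (- sgn n * (b * (1ℚ - π * val (y n)))) - a * sgn n * b * π * (z - 1ℚ)) (sym (ι-suc n)) (y-inverse (ℕ.≤-trans n<P P≤2P)) ⟩
      a * ι (suc n) * (- sgn n * (b * (1ℚ - π * val (y n)))) - a * sgn n * b * π * (1ℚ - 1ℚ)
        ≡⟨ lem′ (a * ι (suc n) * (- sgn n * (b * (1ℚ - π * val (y n))))) (a * sgn n * b * π) ⟩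
      a * ι (suc n) * (- sgn n * (b * (1ℚ - π * val (y n)))) ∎
      where
      a = val (∏ n (λ j → ⟦ suc j ⟧))
      b = val (∏ n (λ j → ⟦ 1 ⟧ ⊕ ⊖ (Π ⊛ y j)))

  fac-p+P : fac (p ℕ.+ P) ≡ fac p * fac P * val Γ
  fac-p+P = begin
    fac (p ℕ.+ P) ≡⟨ fac-rise p P ⟩
    fac p * val (∏rise p P) ≡⟨ cong (fac p *_) (trans (go P ℕ.≤-refl) (cong (_* val Γ) (sym (fac≡∏ P)))) ⟩
    fac p * (fac P * val Γ) ≡⟨ ℚ.*-assoc (fac p) (fac P) (val Γ) ⟨
    fac p * fac P * val Γ ∎
    where
    lem = solve 5 (λ a b j y π → a :* b :* (π :+ j) := a :* j :* (b :* (con 1 :+ π :* y)) :- a :* b :* π :* (j :* y :- con 1)) refl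
    lem′ = solve 2 (λ x a → x :- a :* (con 1 :- con 1) := x) refl
    go : ∀ n → n ≤ P → val (∏rise p n) ≡ val (∏ n (λ j → ⟦ suc j ⟧)) * val (∏ n (λ j → ⟦ 1 ⟧ ⊕ Π ⊛ y j))
    go zero    _ = refl
    go (suc n) n<P = begin
      val (∏rise p n) * (π + ι (suc n)) ≡⟨ cong (_* (π + ι (suc n))) (go n (ℕ.<⇒≤ n<P)) ⟩
      a * b * (π + ι (suc n)) ≡⟨ lem a b (ι (suc n)) (val (y n)) π ⟩
      a * ι (suc n) * (b * (1ℚ + π * val (y n))) - a * b * π * (ι (suc n) * val (y n) - 1ℚ)
        ≡⟨ cong (λ z → a * ι (suc n) * (b * (1ℚ + π * val (y n))) - a * b * π * (z - 1ℚ)) (y-inverse (ℕ.≤-trans n<P P≤2P)) ⟩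
      a * ι (suc n) * (b * (1ℚ + π * val (y n))) - a * b * π * (1ℚ - 1ℚ) ≡⟨ lem′ (a * ι (suc n) * (b * (1ℚ + π * val (y n)))) (a * b * π) ⟩
      a * ι (suc n) * (b * (1ℚ + π * val (y n))) ∎
      where
      a = val (∏ n (λ j → ⟦ suc j ⟧))
      b = val (∏ n (λ j → ⟦ 1 ⟧ ⊕ Π ⊛ y j))

  fac-p+2P : fac (p ℕ.+ 2P) ≡ fac p * fac 2P * val W
  fac-p+2P = begin
    fac (p ℕ.+ 2P) ≡⟨ fac-fall (p ℕ.+ P) P (ℕ.+-assoc p P P) ⟩
    fac (p ℕ.+ P) * val (∏fall (p ℕ.+ 2P) P) ≡⟨ cong (_* val (∏fall (p ℕ.+ 2P) P)) (fac-rise p P) ⟩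
    fac p * val (∏rise p P) * val (∏fall (p ℕ.+ 2P) P) ≡⟨ ℚ.*-assoc (fac p) (val (∏rise p P)) (val (∏fall (p ℕ.+ 2P) P)) ⟩
    fac p * (val (∏rise p P) * val (∏fall (p ℕ.+ 2P) P)) ≡⟨ cong (fac p *_) (go P ℕ.≤-refl) ⟩
    fac p * (val (∏ P (λ j → ⟦ suc j ⟧)) * val (∏fall 2P P) * val W) ≡⟨ cong (λ x → fac p * (x * val (∏fall 2P P) * val W)) (fac≡∏ P) ⟨
    fac p * (fac P * val (∏fall 2P P) * val W) ≡⟨ cong (λ x → fac p * (x * val W)) (fac-fall P P refl) ⟨
    fac p * (fac 2P * val W) ≡⟨ ℚ.*-assoc (fac p) (fac 2P) (val W) ⟨
    fac p * fac 2P * val W ∎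
    where
    ιp+2P : ι (p ℕ.+ 2P) ≡ ι 2 * π - 1ℚ
    ιp+2P = trans (ι-+ p 2P) (trans (cong (π +_) ι2P) (lem π))
      where
      lem = solve 1 (λ π → π :+ (π :- con 1) := con 2 :* π :- con 1) refl
    lem = solve 7 (λ a b w π n y z →
      a :* b :* w :* ((π :+ (con 1 :+ n)) :* (con 2 :* π :- con 1 :- n))
      := a :* (con 1 :+ n) :* (b :* (π :- con 1 :- n)) :* (w :* (con 1 :+ π :* π :* (con 2 :* (y :* z)))) :- a :* b :* w :* (con 2 :* π :* π)
        :* ((con 1 :+ n) :* y :* ((π :- con 1 :- n) :* z) :- con 1)) refl
    lem₁ = solve 2 (λ x a → x :- a :* (con 1 :* con 1 :- con 1) := x) refl
    lem₃ = solve 2 (λ x y → x :+ y :- y := x) refl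
    lem₂ = solve 4 (λ a b c d → a :* b :* (c :* d) := a :* c :* (b :* d)) refl
    go : ∀ n → n ≤ P → val (∏rise p n) * val (∏fall (p ℕ.+ 2P) n) ≡ val (∏ n (λ j → ⟦ suc j ⟧)) * val (∏fall 2P n) * val (∏ n (λ j → ⟦ 1 ⟧ ⊕ Π ⊛ Π ⊛ (⟦ 2 ⟧ ⊛ (y j ⊛ inv (2P ∸ j)))))
    go zero    _ = refl
    go (suc n) n<P = begin
      val (∏rise p n) * (π + ι (suc n)) * (val (∏fall (p ℕ.+ 2P) n) * (ι (p ℕ.+ 2P) - ι n))
        ≡⟨ lem₂ (val (∏rise p n)) (π + ι (suc n)) (val (∏fall (p ℕ.+ 2P) n)) (ι (p ℕ.+ 2P) - ι n) ⟩
      val (∏rise p n) * val (∏fall (p ℕ.+ 2P) n) * ((π + ι (suc n)) * (ι (p ℕ.+ 2P) - ι n)) ≡⟨ cong₂ _*_ (go n (ℕ.<⇒≤ n<P)) (cong₂ (λ x z → (π + x) * (z - ι n)) (ι-suc n) ιp+2P) ⟩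
      a * b * w * ((π + (1ℚ + ι n)) * (ι 2 * π - 1ℚ - ι n)) ≡⟨ lem a b w π (ι n) (val (y n)) (val (inv (2P ∸ n))) ⟩
      a * (1ℚ + ι n) * (b * (π - 1ℚ - ι n)) * r - a * b * w * (ι 2 * π * π) * ((1ℚ + ι n) * val (y n) * ((π - 1ℚ - ι n) * val (inv (2P ∸ n))) - 1ℚ)
        ≡⟨ cong₂ (λ x z → a * x * (b * (z - ι n)) * r - a * b * w * (ι 2 * π * π) * (x * val (y n) * ((z - ι n) * val (inv (2P ∸ n))) - 1ℚ)) (ι-suc n) ι2P ⟨
      a * ι (suc n) * (b * (ι 2P - ι n)) * r - a * b * w * (ι 2 * π * π) * (ι (suc n) * val (y n) * ((ι 2P - ι n) * val (inv (2P ∸ n))) - 1ℚ)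
        ≡⟨ cong₂ (λ x z → a * ι (suc n) * (b * (ι 2P - ι n)) * r - a * b * w * (ι 2 * π * π) * (x * z - 1ℚ)) (y-inverse n<2P) inverse ⟩
      a * ι (suc n) * (b * (ι 2P - ι n)) * r - a * b * w * (ι 2 * π * π) * (1ℚ * 1ℚ - 1ℚ) ≡⟨ lem₁ (a * ι (suc n) * (b * (ι 2P - ι n)) * r) (a * b * w * (ι 2 * π * π)) ⟩
      a * ι (suc n) * (b * (ι 2P - ι n)) * r ∎
      where
      a = val (∏ n (λ j → ⟦ suc j ⟧))
      b = val (∏fall 2P n)
      w = val (∏ n (λ j → ⟦ 1 ⟧ ⊕ Π ⊛ Π ⊛ (⟦ 2 ⟧ ⊛ (y j ⊛ inv (2P ∸ j)))))
      r = w * (1ℚ + π * π * (ι 2 * (val (y n) * val (inv (2P ∸ n)))))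
      n<2P : n < 2P
      n<2P = ℕ.≤-trans n<P P≤2P
      ι∸ : ι 2P - ι n ≡ ι (2P ∸ n)
      ι∸ = trans (cong (_- ι n) (trans (cong ι (sym (ℕ.m∸n+n≡m (ℕ.<⇒≤ n<2P)))) (ι-+ (2P ∸ n) n))) (lem₃ (ι (2P ∸ n)) (ι n))
      inverse : (ι 2P - ι n) * val (inv (2P ∸ n)) ≡ 1ℚ
      inverse = trans (cong (_* val (inv (2P ∸ n))) ι∸) (inv-inverse (p∤ {{ℕ.>-nonZero (ℕ.m<n⇒0<n∸m n<2P)}} (s≤s (ℕ.m∸n≤m 2P n))))

  W≈1 : val W ≈[ 3 ] 1ℚ
  W≈1 = val W ≈⟨ ∏-1+π² P (λ j → ⟦ 2 ⟧ ⊛ (y j ⊛ inv (2P ∸ j))) ⟩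
    1ℚ + π * π * val (∑ P (λ j → ⟦ 2 ⟧ ⊛ (y j ⊛ inv (2P ∸ j)))) ≐⟨ cong (1ℚ +_) (ℚ.*-assoc π π (val (∑ P (λ j → ⟦ 2 ⟧ ⊛ (y j ⊛ inv (2P ∸ j)))))) ⟩
    1ℚ + π * (π * val (∑ P (λ j → ⟦ 2 ⟧ ⊛ (y j ⊛ inv (2P ∸ j))))) ≈⟨ ≈-+ (1ℚ ■) (≈-π (≈-π sum≈)) ⟩
    1ℚ + π * (π * (- ι 2 * val S₂)) ≐⟨ lem π (val S₂) ⟩
    1ℚ + - ι 2 * (π * π * val S₂) ≈⟨ ≈-+ (1ℚ ■) (≈-*ˡ (⊖ ⟦ 2 ⟧) π²S₂≈0) ⟩
    1ℚ + - ι 2 * 0ℚ ■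
    where
    lem = solve 2 (λ π s → con 1 :+ π :* (π :* (:- con 2 :* s)) := con 1 :+ :- con 2 :* (π :* π :* s)) refl
    lem₁ = solve 1 (λ y → con 2 :* (y :* :- y) := :- con 2 :* (y :* y) :+ con 0 :* con 0) refl
    lem₂ = solve 2 (λ s z → :- con 2 :* s :+ con 0 :* z := :- con 2 :* s) refl
    reflect : ∀ {j} → j < P → val (inv (2P ∸ j)) ≈[ 1 ] - val (y j)
    reflect {j} j<P = inv-reflect (2P ∸ j) (suc j) {{ℕ.>-nonZero (ℕ.m<n⇒0<n∸m (ℕ.≤-trans j<P P≤2P))}}
      (trans (ℕ.+-suc (2P ∸ j) j) (cong suc (ℕ.m∸n+n≡m (ℕ.<⇒≤ (ℕ.≤-trans j<P P≤2P)))))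
    sum≈ : val (∑ P (λ j → ⟦ 2 ⟧ ⊛ (y j ⊛ inv (2P ∸ j)))) ≈[ 1 ] - ι 2 * val S₂
    sum≈ = val (∑ P (λ j → ⟦ 2 ⟧ ⊛ (y j ⊛ inv (2P ∸ j)))) ≈⟨ ∑-cong P (λ j → ⟦ 2 ⟧ ⊛ (y j ⊛ inv (2P ∸ j))) (λ j → ⟦ 2 ⟧ ⊛ (y j ⊛ ⊖ y j)) (λ j j<P → ≈-*ˡ ⟦ 2 ⟧ (≈-*ˡ (y j) (reflect j<P))) ⟩
      val (∑ P (λ j → ⟦ 2 ⟧ ⊛ (y j ⊛ ⊖ y j))) ≐⟨ ∑-linear P (- ι 2) 0ℚ (λ j → y j ⊛ y j) (λ _ → ⟦ 0 ⟧) (λ j → ⟦ 2 ⟧ ⊛ (y j ⊛ ⊖ y j)) (λ j _ → lem₁ (val (y j))) ⟩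
      - ι 2 * val S₂ + 0ℚ * val (∑ P (λ _ → ⟦ 0 ⟧)) ≐⟨ lem₂ (val S₂) (val (∑ P (λ _ → ⟦ 0 ⟧))) ⟩
      - ι 2 * val S₂ ■

  BΓ≈1 : val B * val Γ ≈[ 3 ] 1ℚ
  BΓ≈1 = val B * val Γ ≐⟨ go P ⟩
    val (∏ P (λ j → ⟦ 1 ⟧ ⊕ Π ⊛ Π ⊛ (⊖ (y j ⊛ y j)))) ≈⟨ ∏-1+π² P (λ j → ⊖ (y j ⊛ y j)) ⟩
    1ℚ + π * π * val (∑ P (λ j → ⊖ (y j ⊛ y j))) ≐⟨ cong (λ x → 1ℚ + π * π * x) (∑-linear P (- 1ℚ) 0ℚ (λ j → y j ⊛ y j) (λ _ → ⟦ 0 ⟧) (λ j → ⊖ (y j ⊛ y j)) (λ j _ → lem₁ (val (y j)))) ⟩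
    1ℚ + π * π * (- 1ℚ * val S₂ + 0ℚ * val (∑ P (λ _ → ⟦ 0 ⟧))) ≐⟨ lem₂ π (val S₂) (val (∑ P (λ _ → ⟦ 0 ⟧))) ⟩
    1ℚ + - 1ℚ * (π * π * val S₂) ≈⟨ ≈-+ (1ℚ ■) (≈-*ˡ (⊖ ⟦ 1 ⟧) π²S₂≈0) ⟩
    1ℚ + - 1ℚ * 0ℚ ■
    where
    lem = solve 4 (λ a b y π → a :* (con 1 :- π :* y) :* (b :* (con 1 :+ π :* y)) := a :* b :* (con 1 :+ π :* π :* :- (y :* y))) refl
    lem₁ = solve 1 (λ y → :- (y :* y) := :- con 1 :* (y :* y) :+ con 0 :* con 0) refl
    lem₂ = solve 3 (λ π s z → con 1 :+ π :* π :* (:- con 1 :* s :+ con 0 :* z) := con 1 :+ :- con 1 :* (π :* π :* s)) refl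
    go : ∀ n → val (∏ n (λ j → ⟦ 1 ⟧ ⊕ ⊖ (Π ⊛ y j))) * val (∏ n (λ j → ⟦ 1 ⟧ ⊕ Π ⊛ y j)) ≡ val (∏ n (λ j → ⟦ 1 ⟧ ⊕ Π ⊛ Π ⊛ (⊖ (y j ⊛ y j))))
    go zero = refl
    go (suc n) = trans (lem (val (∏ n (λ j → ⟦ 1 ⟧ ⊕ ⊖ (Π ⊛ y j)))) (val (∏ n (λ j → ⟦ 1 ⟧ ⊕ Π ⊛ y j))) (val (y n)) π) (cong (_* (1ℚ + π * π * - (val (y n) * val (y n)))) (go n))

  sgnᶻ : ℕ → ℤ₍ₚ₎
  sgnᶻ zero    = ⟦ 1 ⟧
  sgnᶻ (suc n) = ⊖ sgnᶻ n

  sgnᶻ≡ : ∀ n → val (sgnᶻ n) ≡ sgn n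
  sgnᶻ≡ zero    = refl
  sgnᶻ≡ (suc n) = cong -_ (sgnᶻ≡ n)

  C-≈ : ∀ x N → 1ℚ + ι N ≡ ι x * π → 2P ≤ N → ∀ i → i ≤ 2P → ι (N C i) ≈[ 2 ] val (sgnᶻ i) * (1ℚ - ι x * (π * val (H i)))
  C-≈ x N ιN 2P≤N zero    _ = ≡⇒≈ (lem (ι x) π)
    where
    lem = solve 2 (λ x π → con 1 := con 1 :* (con 1 :- x :* (π :* con 0))) refl
  C-≈ x N ιN 2P≤N (suc i) i<2P =
    ι (N C suc i) ≐⟨ step ⟩
    (ι x * π * Y - 1ℚ) * ι (N C i) ≈⟨ ≈-*ˡ (⟦ x ⟧ ⊛ Π ⊛ y i ⊕ ⊖ ⟦ 1 ⟧) (C-≈ x N ιN 2P≤N i (ℕ.<⇒≤ i<2P)) ⟩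
    (ι x * π * Y - 1ℚ) * (s * (1ℚ - ι x * (π * h))) ≈⟨ (⊖ (sgnᶻ i ⊛ ⟦ x ⟧ ⊛ ⟦ x ⟧ ⊛ y i ⊛ H i)) by lem (ι x) π Y s h ⟩
    - s * (1ℚ - ι x * (π * (h + Y))) ■
    where
    Y = val (y i)
    s = val (sgnᶻ i)
    h = val (H i)
    lem = solve 5 (λ x π y s h →
      (x :* π :* y :- con 1) :* (s :* (con 1 :- x :* (π :* h)))
      := :- s :* (con 1 :- x :* (π :* (h :+ y))) :+ π :* (π :* con 1) :* :- (s :* x :* x :* y :* h)) refl
    lem₂ = solve 5 (λ c x π k y → c :* y :* (x :* π :- (con 1 :+ k)) := (x :* π :* y :- con 1) :* c :- c :* ((con 1 :+ k) :* y :- con 1)) refl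
    lem₃ = solve 2 (λ n k → n :- k := con 1 :+ n :- (con 1 :+ k)) refl
    lem₅ = solve 2 (λ z c → z :- c :* (con 1 :- con 1) := z) refl
    lem₆ = solve 3 (λ c z y → c :* z :* y := c :* y :* z) refl
    1+i*Y : (1ℚ + ι i) * Y ≡ 1ℚ
    1+i*Y = trans (cong (_* Y) (sym (ι-suc i))) (y-inverse i<2P)
    step : ι (N C suc i) ≡ (ι x * π * Y - 1ℚ) * ι (N C i)
    step = begin
      ι (N C suc i) ≡⟨ ℚ.*-identityʳ (ι (N C suc i)) ⟨
      ι (N C suc i) * 1ℚ ≡⟨ cong (ι (N C suc i) *_) 1+i*Y ⟨
      ι (N C suc i) * ((1ℚ + ι i) * Y) ≡⟨ ℚ.*-assoc (ι (N C suc i)) (1ℚ + ι i) Y ⟨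
      ι (N C suc i) * (1ℚ + ι i) * Y ≡⟨ cong (_* Y) (C-step (ℕ.≤-trans i<2P 2P≤N)) ⟩
      ι (N C i) * (ι N - ι i) * Y ≡⟨ lem₆ (ι (N C i)) (ι N - ι i) Y ⟩
      ι (N C i) * Y * (ι N - ι i) ≡⟨ cong (ι (N C i) * Y *_) (trans (lem₃ (ι N) (ι i)) (cong (_- (1ℚ + ι i)) ιN)) ⟩
      ι (N C i) * Y * (ι x * π - (1ℚ + ι i)) ≡⟨ lem₂ (ι (N C i)) (ι x) π (ι i) Y ⟩
      (ι x * π * Y - 1ℚ) * ι (N C i) - ι (N C i) * ((1ℚ + ι i) * Y - 1ℚ) ≡⟨ cong (λ z → (ι x * π * Y - 1ℚ) * ι (N C i) - ι (N C i) * (z - 1ℚ)) 1+i*Y ⟩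
      (ι x * π * Y - 1ℚ) * ι (N C i) - ι (N C i) * (1ℚ - 1ℚ) ≡⟨ lem₅ ((ι x * π * Y - 1ℚ) * ι (N C i)) (ι (N C i)) ⟩
      (ι x * π * Y - 1ℚ) * ι (N C i) ∎

  sgnᶻ-odd : ∀ j → val (sgnᶻ (suc (j ℕ.+ j))) ≡ - 1ℚ
  sgnᶻ-odd j = cong -_ (trans (sgnᶻ≡ (j ℕ.+ j)) (sgn-even j))

  C-≈-odd : ∀ x N → 1ℚ + ι N ≡ ι x * π → 2P ≤ N → ∀ j → j < P → ι (N C suc (j ℕ.+ j)) ≈[ 2 ] - 1ℚ * (1ℚ - ι x * (π * val (H (suc (j ℕ.+ j)))))
  C-≈-odd x N ιN 2P≤N j j<P = ≈-trans (C-≈ x N ιN 2P≤N (suc (j ℕ.+ j)) (ℕ.<⇒≤ (2j+1<2P j<P))) (≡⇒≈ (cong (_* (1ℚ - ι x * (π * val (H (suc (j ℕ.+ j)))))) (sgnᶻ-odd j)))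

  absorb : ∀ N k → k < 2P → k ≤ N → ι (suc N C suc k) ≡ (1ℚ + ι N) * (val (y k) * ι (N C k))
  absorb N k k<2P k≤N = begin
    c ≡⟨ ℚ.*-identityʳ c ⟨
    c * 1ℚ ≡⟨ cong (c *_) (trans (cong (_* Y) (sym (ι-suc k))) (y-inverse k<2P)) ⟨
    c * ((1ℚ + ι k) * Y) ≡⟨ ℚ.*-assoc c (1ℚ + ι k) Y ⟨
    c * (1ℚ + ι k) * Y ≡⟨ cong (_* Y) (C-absorb k≤N) ⟩
    (1ℚ + ι N) * ι (N C k) * Y ≡⟨ lem (1ℚ + ι N) (ι (N C k)) Y ⟩
    (1ℚ + ι N) * (Y * ι (N C k)) ∎
    where
    c = ι (suc N C suc k)
    Y = val (y k)
    lem = solve 3 (λ n c y → n :* c :* y := n :* (y :* c)) refl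

  1+ι2P : 1ℚ + ι 2P ≡ ι 1 * π
  1+ι2P = trans (sym (ι-suc 2P)) (sym (ℚ.*-identityˡ π))

  1+ι[p+2P] : 1ℚ + ι (p ℕ.+ 2P) ≡ ι 2 * π
  1+ι[p+2P] = trans (cong (1ℚ +_) (trans (ι-+ p 2P) (cong (π +_) ι2P))) (lem π)
    where
    lem = solve 1 (λ π → con 1 :+ (π :+ (π :- con 1)) := con 2 :* π) refl

  -- Modulo p³, C(xp, 2j) / x is affine in x.  The combination 4 C(p, 2j) − C(2p, 2j)
  -- extrapolates to x = 0, where no harmonic number is left.
  odd even₁ even₂ : ℕ → ℕ
  odd j = suc (j ℕ.+ j)
  even₁ j = p C (suc j ℕ.+ suc j)
  even₂ j = suc (p ℕ.+ 2P) C (suc j ℕ.+ suc j)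

  even₁≡ : ∀ j → j < P → ι (even₁ j) ≡ π * (val (y (odd j)) * ι (2P C odd j))
  even₁≡ j j<P = trans (cong (λ n → ι (p C n)) (Double.suc+suc j)) (trans (absorb 2P (odd j) (2j+1<2P j<P) (ℕ.<⇒≤ (2j+1<2P j<P)))
    (cong (_* (val (y (odd j)) * ι (2P C odd j))) (sym (ι-suc 2P))))

  even₂≡ : ∀ j → j < P → ι (even₂ j) ≡ ι 2 * π * (val (y (odd j)) * ι ((p ℕ.+ 2P) C odd j))
  even₂≡ j j<P = trans (cong (λ n → ι (suc (p ℕ.+ 2P) C n)) (Double.suc+suc j)) (trans (absorb (p ℕ.+ 2P) (odd j) (2j+1<2P j<P) (ℕ.≤-trans (ℕ.<⇒≤ (2j+1<2P j<P)) (ℕ.m≤n+m 2P p)))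
    (cong (_* (val (y (odd j)) * ι ((p ℕ.+ 2P) C odd j))) 1+ι[p+2P]))

  4even₁-even₂ : ∀ j → j < P → ι 4 * ι (even₁ j) - ι (even₂ j) ≈[ 3 ] - π * val (y j)
  4even₁-even₂ j j<P =
    ι 4 * ι (even₁ j) - ι (even₂ j) ≐⟨ cong₂ (λ a b → ι 4 * a - b) (even₁≡ j j<P) (even₂≡ j j<P) ⟩
    ι 4 * (π * (v * c₁)) - ι 2 * π * (v * c₂) ≐⟨ lem π v c₁ c₂ ⟩
    π * (v * (ι 4 * c₁ + - ι 2 * c₂)) ≈⟨ ≈-π (≈-*ˡ (y (odd j)) (≈-+ (≈-*ˡ ⟦ 4 ⟧ (C-≈-odd 1 2P 1+ι2P ℕ.≤-refl j j<P)) (≈-*ˡ (⊖ ⟦ 2 ⟧) (C-≈-odd 2 (p ℕ.+ 2P) 1+ι[p+2P] (ℕ.m≤n+m 2P p) j j<P)))) ⟩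
    π * (v * (ι 4 * (- 1ℚ * (1ℚ - ι 1 * (π * h))) + - ι 2 * (- 1ℚ * (1ℚ - ι 2 * (π * h))))) ≐⟨ lem₁ π v h ⟩
    - π * (ι 2 * v) ≐⟨ cong (λ x → - π * (ι 2 * x)) (y-even j<P) ⟩
    - π * (ι 2 * (½ * val (y j))) ≐⟨ lem₂ π (val (y j)) ⟩
    - π * val (y j) ■
    where
    v = val (y (odd j))
    c₁ = ι (2P C odd j)
    c₂ = ι ((p ℕ.+ 2P) C odd j)
    h = val (H (odd j))
    lem = solve 4 (λ π v c d → con 4 :* (π :* (v :* c)) :- con 2 :* π :* (v :* d) := π :* (v :* (con 4 :* c :+ :- con 2 :* d))) refl
    lem₁ = solve 3 (λ π v h →
      π :* (v :* (con 4 :* (:- con 1 :* (con 1 :- con 1 :* (π :* h))) :+ :- con 2 :* (:- con 1 :* (con 1 :- con 2 :* (π :* h)))))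
      := :- π :* (con 2 :* v)) refl
    lem₂ = solve 2 (λ π y → :- π :* (con 2 :* (Κ ½ :* y)) := :- π :* y) refl

  M : ℕ
  M = 2 ℕ.^ 2P

  m : ℚ
  m = ι M

  4^2P : ι (4 ℕ.^ 2P) ≡ m * m
  4^2P = trans (cong ι (trans (ℕ.^-*-assoc 2 2 2P) (trans (cong (2 ℕ.^_) (trans (ℕ.*-distribʳ-+ 2P 1 1) (cong₂ ℕ._+_ (ℕ.+-identityʳ 2P) (ℕ.+-identityʳ 2P)))) (ℕ.^-distribˡ-+-* 2 2P 2P)))) (ι-* M M)

  tail : ∀ n f x → val (∑ (suc n) f) ≡ x → val (f 0) ≡ 1ℚ → val (∑ n (f ∘ suc)) ≡ x - 1ℚ
  tail n f x ∑f≡x f0≡1 = trans (lem (val (f 0)) (val (∑ n (f ∘ suc)))) (cong₂ _-_ (trans (sym (∑-head n f)) ∑f≡x) f0≡1)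
    where
    lem = solve 2 (λ a b → b := a :+ b :- a) refl

  ∑even₁ : val (∑ P (⟦_⟧ ∘ even₁)) ≡ m - 1ℚ
  ∑even₁ = tail P (λ j → ⟦ p C (j ℕ.+ j) ⟧) m (trans (∑C-even 2P P) (cong ι (∑C-row 2P))) refl

  ∑even₂ : val (∑ P (⟦_⟧ ∘ even₂)) ≡ m * m - 1ℚ
  ∑even₂ = tail P (λ j → ⟦ suc (p ℕ.+ 2P) C (j ℕ.+ j) ⟧) (m * m) (trans (∑C-even (p ℕ.+ 2P) P) (trans (cong ι (∑C-half-row 2P)) 4^2P)) refl

  q : ℤ₍ₚ₎
  q = ∑ P (λ j → y (odd j) ⊛ ⟦ 2P C odd j ⟧)

  m-1≡πq : m - 1ℚ ≡ π * val q
  m-1≡πq = trans (sym ∑even₁) (trans (∑-linear P π 0ℚ (λ j → y (odd j) ⊛ ⟦ 2P C odd j ⟧) (λ _ → ⟦ 0 ⟧) (⟦_⟧ ∘ even₁) (λ j j<P → trans (even₁≡ j j<P) (lem (π * (val (y (odd j)) * ι (2P C odd j))))))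
    (lem₁ (π * val q) (val (∑ P (λ _ → ⟦ 0 ⟧)))))
    where
    lem = solve 1 (λ x → x := x :+ con 0 :* con 0) refl
    lem₁ = solve 2 (λ x z → x :+ con 0 :* z := x) refl

  m≡1+πq : m ≡ 1ℚ + π * val q
  m≡1+πq = trans (lem m) (cong (1ℚ +_) m-1≡πq)
    where
    lem = solve 1 (λ m → m := con 1 :+ (m :- con 1)) refl

  πH≈ : π * val (H P) ≈[ 3 ] (m - 1ℚ) * (m - ι 3)
  πH≈ = π * val (H P) ≐⟨ lem (π * val (H P)) ⟩
    - (- (π * val (H P))) ≈⟨ ≈-neg (≈-sym sum≈) ⟩
    - (ι 4 * val (∑ P (⟦_⟧ ∘ even₁)) + - 1ℚ * val (∑ P (⟦_⟧ ∘ even₂))) ≐⟨ cong₂ (λ a b → - (ι 4 * a + - 1ℚ * b)) ∑even₁ ∑even₂ ⟩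
    - (ι 4 * (m - 1ℚ) + - 1ℚ * (m * m - 1ℚ)) ≐⟨ lem₁ m ⟩
    (m - 1ℚ) * (m - ι 3) ■
    where
    lem = solve 1 (λ x → x := :- (:- x)) refl
    lem₁ = solve 1 (λ m → :- (con 4 :* (m :- con 1) :+ :- con 1 :* (m :* m :- con 1)) := (m :- con 1) :* (m :- con 3)) refl
    lem₂ = solve 2 (λ a b → con 4 :* a :- b := con 4 :* a :+ :- con 1 :* b) refl
    lem₄ = solve 2 (λ π a → :- π :* a := :- π :* a :+ con 0 :* con 0) refl
    lem₃ : ∀ a → - π * a ≡ - π * a + 0ℚ * 0ℚ
    lem₃ a = lem₄ π a
    lem₅ = solve 3 (λ π h z → :- π :* h :+ con 0 :* z := :- (π :* h)) refl
    sum≈ : ι 4 * val (∑ P (⟦_⟧ ∘ even₁)) + - 1ℚ * val (∑ P (⟦_⟧ ∘ even₂)) ≈[ 3 ] - (π * val (H P))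
    sum≈ = ι 4 * val (∑ P (⟦_⟧ ∘ even₁)) + - 1ℚ * val (∑ P (⟦_⟧ ∘ even₂))
        ≐⟨ sym (∑-linear P (ι 4) (- 1ℚ) (⟦_⟧ ∘ even₁) (⟦_⟧ ∘ even₂) (λ j → ⟦ 4 ⟧ ⊛ ⟦ even₁ j ⟧ ⊕ ⊖ ⟦ even₂ j ⟧) (λ j _ → lem₂ (ι (even₁ j)) (ι (even₂ j)))) ⟩
      val (∑ P (λ j → ⟦ 4 ⟧ ⊛ ⟦ even₁ j ⟧ ⊕ ⊖ ⟦ even₂ j ⟧)) ≈⟨ ∑-cong P (λ j → ⟦ 4 ⟧ ⊛ ⟦ even₁ j ⟧ ⊕ ⊖ ⟦ even₂ j ⟧) (λ j → ⊖ Π ⊛ y j) 4even₁-even₂ ⟩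
      val (∑ P (λ j → ⊖ Π ⊛ y j)) ≐⟨ ∑-linear P (- π) 0ℚ y (λ _ → ⟦ 0 ⟧) (λ j → ⊖ Π ⊛ y j) (λ j _ → lem₃ (val (y j))) ⟩
      - π * val (H P) + 0ℚ * val (∑ P (λ _ → ⟦ 0 ⟧)) ≐⟨ lem₅ π (val (H P)) (val (∑ P (λ _ → ⟦ 0 ⟧))) ⟩
      - (π * val (H P)) ■

  p∤2 : ¬ p ∣ 2
  p∤2 = p∤ (ℕ.≤-trans (s≤s (s≤s (s≤s z≤n))) 4<p)

  B≈m² : val B ≈[ 3 ] m * m
  B≈m² = ≈-cancel ⟦ 2 ⟧ (inv 2) (inv-inverse p∤2) (
    ι 2 * val B ≈⟨ ∏-1-π P y ⟩
    ι 2 - ι 2 * x + (x * x - π * π * val S₂) ≐⟨ lem x (π * π * val S₂) ⟩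
    ι 2 + - ι 2 * x + (x * x + - 1ℚ * (π * π * val S₂))
      ≈⟨ ≈-+ (≈-+ (ι 2 ■) (≈-*ˡ (⊖ ⟦ 2 ⟧) πH≈)) (≈-+ (≈-trans (≈-*ˡ (Π ⊛ H P) πH≈) (≈-*ʳ tᶻ πH≈)) (≈-*ˡ (⊖ ⟦ 1 ⟧) π²S₂≈0)) ⟩
    ι 2 + - ι 2 * t + (t * t + - 1ℚ * 0ℚ) ≐⟨ cong (λ m → ι 2 + - ι 2 * ((m - 1ℚ) * (m - ι 3)) + ((m - 1ℚ) * (m - ι 3) * ((m - 1ℚ) * (m - ι 3)) + - 1ℚ * 0ℚ)) m≡1+πq ⟩
    ι 2 + - ι 2 * t′ + (t′ * t′ + - 1ℚ * 0ℚ) ≈⟨ (q ⊛ q ⊛ q ⊛ (Π ⊛ q ⊕ ⊖ ⟦ 4 ⟧)) by lem₁ π (val q) ⟩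
    ι 2 * ((1ℚ + π * val q) * (1ℚ + π * val q)) ≐⟨ cong (λ m → ι 2 * (m * m)) m≡1+πq ⟨
    ι 2 * (m * m) ■)
    where
    x = π * val (H P)
    t = (m - 1ℚ) * (m - ι 3)
    t′ = (1ℚ + π * val q - 1ℚ) * (1ℚ + π * val q - ι 3)
    tᶻ = (⟦ M ⟧ ⊕ ⊖ ⟦ 1 ⟧) ⊛ (⟦ M ⟧ ⊕ ⊖ ⟦ 3 ⟧)
    lem = solve 2 (λ x s → con 2 :- con 2 :* x :+ (x :* x :- s) := con 2 :+ :- con 2 :* x :+ (x :* x :+ :- con 1 :* s)) refl
    lem₁ = solve 2 (λ π q →
      con 2 :+ :- con 2 :* ((con 1 :+ π :* q :- con 1) :* (con 1 :+ π :* q :- con 3)) :+ ((con 1 :+ π :* q :- con 1) :* (con 1 :+ π :* q :- con 3)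
        :* ((con 1 :+ π :* q :- con 1) :* (con 1 :+ π :* q :- con 3)) :+ :- con 1 :* con 0)
      := con 2 :* ((con 1 :+ π :* q) :* (con 1 :+ π :* q)) :+ π :* (π :* (π :* con 1)) :* (q :* q :* q :* (π :* q :+ :- con 4))) refl

  y₂ y₁ y₃ v u : ℕ → ℤ₍ₚ₎
  v k = inv k
  u k = y k
  y₁ k = y (k ℕ.+ k)
  y₂ k = y (suc (k ℕ.+ k))
  y₃ k = y (suc (suc (k ℕ.+ k)))

  A : ℕ → ℤ₍ₚ₎
  A zero    = ⟦ 1 ⟧
  A (suc k) = A k ⊛ (⟦ 1 ⟧ ⊕ Π ⊛ y₂ k) ⊛ (⟦ 1 ⟧ ⊕ Π ⊛ ⊖ y₁ k) ⊛ (⟦ 1 ⟧ ⊕ Π ⊛ ⊖ v k)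
    ⊛ 1+π.⁻¹ (⊖ y₂ k) ⊛ 1+π.⁻¹ (y₃ k) ⊛ 1+π.⁻¹ (u (suc k))

  α : ℕ → ℤ₍ₚ₎
  α zero    = ⟦ 0 ⟧
  α (suc k) = α k ⊕ y₂ k ⊕ ⊖ y₁ k ⊕ ⊖ v k ⊕ y₂ k ⊕ ⊖ y₃ k ⊕ ⊖ u (suc k)

  ≈-1+π-* : ∀ (x a z b : ℤ₍ₚ₎) → val x ≈[ 2 ] 1ℚ + π * val a → val z ≈[ 2 ] 1ℚ + π * val b → val x * val z ≈[ 2 ] 1ℚ + π * (val a + val b)
  ≈-1+π-* x a z b x≈ z≈ = val x * val z ≈⟨ ≈-*ˡ x z≈ ⟩
    val x * (1ℚ + π * val b) ≈⟨ ≈-*ʳ (⟦ 1 ⟧ ⊕ Π ⊛ b) x≈ ⟩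
    (1ℚ + π * val a) * (1ℚ + π * val b) ≈⟨ (a ⊛ b) by lem π (val a) (val b) ⟩
    1ℚ + π * (val a + val b) ■
    where
    lem = solve 3 (λ π a b → (con 1 :+ π :* a) :* (con 1 :+ π :* b) := con 1 :+ π :* (a :+ b) :+ π :* (π :* con 1) :* (a :* b)) refl

  ≈-1+π-⁻¹ : ∀ a → val (1+π.⁻¹ a) ≈[ 2 ] 1ℚ + π * - val a
  ≈-1+π-⁻¹ a = (a ⊛ a ⊛ 1+π.⁻¹ a) by trans (lem π (val a) (val (1+π.⁻¹ a))) (trans (cong (λ x → 1ℚ + π * - val a + π * (π * 1ℚ) * (val a * val a * val (1+π.⁻¹ a)) + (1ℚ - π * val a) * (x - 1ℚ)) (1+π.inverse a))
    (lem₁ (1ℚ + π * - val a + π * (π * 1ℚ) * (val a * val a * val (1+π.⁻¹ a))) (1ℚ - π * val a)))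
    where
    lem = solve 3 (λ π a x →
      x
      := con 1 :+ π :* :- a :+ π :* (π :* con 1) :* (a :* a :* x) :+ (con 1 :- π :* a) :* ((con 1 :+ π :* a) :* x :- con 1)) refl
    lem₁ = solve 2 (λ x y → x :+ y :* (con 1 :- con 1) := x) refl

  A≈ : ∀ k → val (A k) ≈[ 2 ] 1ℚ + π * val (α k)
  A≈ zero    = ≡⇒≈ (lem π)
    where
    lem = solve 1 (λ π → con 1 := con 1 :+ π :* con 0) refl
  A≈ (suc k) = ≈-trans (≈-1+π-* A₅ α₅ (1+π.⁻¹ (u (suc k))) (⊖ u (suc k))
      (≈-1+π-* A₄ α₄ (1+π.⁻¹ (y₃ k)) (⊖ y₃ k)
      (≈-1+π-* A₃ α₃ (1+π.⁻¹ (⊖ y₂ k)) (⊖ (⊖ y₂ k))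
      (≈-1+π-* A₂ α₂ (⟦ 1 ⟧ ⊕ Π ⊛ ⊖ v k) (⊖ v k)
      (≈-1+π-* A₁ α₁ (⟦ 1 ⟧ ⊕ Π ⊛ ⊖ y₁ k) (⊖ y₁ k)
      (≈-1+π-* (A k) (α k) (⟦ 1 ⟧ ⊕ Π ⊛ y₂ k) (y₂ k) (A≈ k) (≡⇒≈ refl)) (≡⇒≈ refl)) (≡⇒≈ refl)) (≈-1+π-⁻¹ (⊖ y₂ k))) (≈-1+π-⁻¹ (y₃ k))) (≈-1+π-⁻¹ (u (suc k))))
    (≡⇒≈ (cong (λ x → 1ℚ + π * (val α₃ + x + - val (y₃ k) + - val (u (suc k)))) (lem (val (y₂ k)))))
    where
    A₁ = A k ⊛ (⟦ 1 ⟧ ⊕ Π ⊛ y₂ k)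
    A₂ = A₁ ⊛ (⟦ 1 ⟧ ⊕ Π ⊛ ⊖ y₁ k)
    A₃ = A₂ ⊛ (⟦ 1 ⟧ ⊕ Π ⊛ ⊖ v k)
    A₄ = A₃ ⊛ 1+π.⁻¹ (⊖ y₂ k)
    A₅ = A₄ ⊛ 1+π.⁻¹ (y₃ k)
    α₁ = α k ⊕ y₂ k
    α₂ = α₁ ⊕ ⊖ y₁ k
    α₃ = α₂ ⊕ ⊖ v k
    α₄ = α₃ ⊕ ⊖ (⊖ y₂ k)
    α₅ = α₄ ⊕ ⊖ y₃ k
    lem = solve 1 (λ x → :- (:- x) := x) refl

  inverse : ∀ k → k < 2P → (1ℚ + ι k) * val (y k) ≡ 1ℚ
  inverse k k<2P = trans (cong (_* val (y k)) (sym (ι-suc k))) (y-inverse k<2P)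

  inverse₁ : ∀ k → k < P → (1ℚ + ι 2 * ι k) * val (y₁ k) ≡ 1ℚ
  inverse₁ k k<P = trans (cong (λ x → (1ℚ + x) * val (y₁ k)) (sym (Double.ι2n k))) (inverse (k ℕ.+ k) (ℕ.<⇒≤ (2j+1<2P k<P)))

  inverse₂ : ∀ k → k < P → (ι 2 + ι 2 * ι k) * val (y₂ k) ≡ 1ℚ
  inverse₂ k k<P = trans (cong ((ι 2 + ι 2 * ι k) *_) (y-even k<P)) (trans (lem (ι k) (val (y k))) (inverse k (ℕ.≤-trans k<P P≤2P)))
    where
    lem = solve 2 (λ k y → (con 2 :+ con 2 :* k) :* (Κ ½ :* y) := (con 1 :+ k) :* y) refl

  inverse₃ : ∀ k → suc k < P → (ι 3 + ι 2 * ι k) * val (y₃ k) ≡ 1ℚ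
  inverse₃ k k<P = trans (cong (_* val (y₃ k)) (trans (lem (ι k)) (cong (λ x → 1ℚ + ι 2 * x) (sym (ι-suc k))))) (trans (cong (λ n → (1ℚ + ι 2 * ι (suc k)) * val (y n)) (sym (Double.suc+suc k))) (inverse₁ (suc k) k<P))
    where
    lem = solve 1 (λ k → con 3 :+ con 2 :* k := con 1 :+ con 2 :* (con 1 :+ k)) refl

  -- The quotient F k (P − k) / F 0 P, for 0 < k < P; A k is its 1-unit part, and
  -- 1 + p α k approximates A k modulo p².
  ρ : ℕ → ℤ₍ₚ₎
  ρ k = ⊖ (Π ⊛ v k ⊛ u k ⊛ y₁ k ⊛ A k)

  module Step (k r : ℕ) (k+r : k ℕ.+ suc (suc r) ≡ P) where
    k+1<P : suc k < P
    k+1<P = subst (suc k <_) k+r (subst (suc (suc k) ≤_) (sym (trans (ℕ.+-suc k (suc r)) (cong suc (ℕ.+-suc k r)))) (s≤s (s≤s (ℕ.m≤m+n k r))))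
    k<P : k < P
    k<P = ℕ.<⇒≤ k+1<P
    K R N : ℚ
    K = ι k
    R = ι (suc r)
    N = ι (suc (k ℕ.+ suc (suc r)))
    N≡ : N ≡ ι 2 + (K + R)
    N≡ = trans (ι-suc (k ℕ.+ suc (suc r))) (trans (cong (1ℚ +_) (trans (ι-+ k (suc (suc r))) (cong (K +_) (ι-suc (suc r))))) (lem K R))
      where
      lem = solve 2 (λ k r → con 1 :+ (k :+ (con 1 :+ r)) := con 2 :+ (k :+ r)) refl
    π≡ : π ≡ 1ℚ + ι 2 * (K + (1ℚ + R))
    π≡ = trans (ι-suc 2P) (cong (1ℚ +_) (trans (Double.ι2n P) (cong (ι 2 *_) (trans (cong ι (sym k+r)) (trans (ι-+ k (suc (suc r))) (cong (K +_) (ι-suc (suc r))))))))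

    recurrence : F (suc k) (suc r) * ((π - ι 2 * K - ι 2) * (π + ι 2 * K + ι 3) * (π + K + ι 2))
      ≡ - (F k (suc (suc r)) * ((π + ι 2 * K + ι 2) * (π - ι 2 * K - 1ℚ) * (π - K)))
    recurrence = begin
      f′ * ((π - ι 2 * K - ι 2) * (π + ι 2 * K + ι 3) * (π + K + ι 2)) ≡⟨ cong (λ π → f′ * ((π - ι 2 * K - ι 2) * (π + ι 2 * K + ι 3) * (π + K + ι 2))) π≡ ⟩
      f′ * ((1ℚ + ι 2 * (K + (1ℚ + R)) - ι 2 * K - ι 2) * (1ℚ + ι 2 * (K + (1ℚ + R)) + ι 2 * K + ι 3) * (1ℚ + ι 2 * (K + (1ℚ + R)) + K + ι 2)) ≡⟨ lem f′ K R ⟩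
      ι 2 * (f′ * ((ι 2 * R + 1ℚ) * (ι 2 + (K + R) + K + 1ℚ) * (ι 2 * (ι 2 + (K + R)) + K + 1ℚ))) ≡⟨ cong (λ N → ι 2 * (f′ * ((ι 2 * R + 1ℚ) * (N + K + 1ℚ) * (ι 2 * N + K + 1ℚ)))) N≡ ⟨
      ι 2 * (f′ * ((ι 2 * R + 1ℚ) * (N + K + 1ℚ) * (ι 2 * N + K + 1ℚ))) ≡⟨ cong (ι 2 *_) (F-ratio k (suc r)) ⟩
      ι 2 * - (f * ((ι 2 * (N + K) + 1ℚ) * (1ℚ + R) * (N + R + 1ℚ))) ≡⟨ cong (λ N → ι 2 * - (f * ((ι 2 * (N + K) + 1ℚ) * (1ℚ + R) * (N + R + 1ℚ)))) N≡ ⟩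
      ι 2 * - (f * ((ι 2 * (ι 2 + (K + R) + K) + 1ℚ) * (1ℚ + R) * (ι 2 + (K + R) + R + 1ℚ))) ≡⟨ lem₁ f K R ⟩
      - (f * ((1ℚ + ι 2 * (K + (1ℚ + R)) + ι 2 * K + ι 2) * (1ℚ + ι 2 * (K + (1ℚ + R)) - ι 2 * K - 1ℚ) * (1ℚ + ι 2 * (K + (1ℚ + R)) - K)))
        ≡⟨ cong (λ π → - (f * ((π + ι 2 * K + ι 2) * (π - ι 2 * K - 1ℚ) * (π - K)))) π≡ ⟨
      - (f * ((π + ι 2 * K + ι 2) * (π - ι 2 * K - 1ℚ) * (π - K))) ∎
      where
      f′ = F (suc k) (suc r)
      f = F k (suc (suc r))
      lem = solve 3 (λ f k r →
        f :* ((con 1 :+ con 2 :* (k :+ (con 1 :+ r)) :- con 2 :* k :- con 2) :* (con 1 :+ con 2 :* (k :+ (con 1 :+ r)) :+ con 2 :* k :+ con 3)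
          :* (con 1 :+ con 2 :* (k :+ (con 1 :+ r)) :+ k :+ con 2))
        := con 2 :* (f :* ((con 2 :* r :+ con 1) :* (con 2 :+ (k :+ r) :+ k :+ con 1) :* (con 2 :* (con 2 :+ (k :+ r)) :+ k :+ con 1)))) refl
      lem₁ = solve 3 (λ f k r →
        con 2 :* :- (f :* ((con 2 :* (con 2 :+ (k :+ r) :+ k) :+ con 1) :* (con 1 :+ r) :* (con 2 :+ (k :+ r) :+ r :+ con 1)))
        := :- (f :* ((con 1 :+ con 2 :* (k :+ (con 1 :+ r)) :+ con 2 :* k :+ con 2) :* (con 1 :+ con 2 :* (k :+ (con 1 :+ r)) :- con 2 :* k :- con 1)
          :* (con 1 :+ con 2 :* (k :+ (con 1 :+ r)) :- k)))) refl

    Y Z W₃ U U₁ U₂ U₃ : ℚ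
    Y  = val (y₂ k)
    Z  = val (y₁ k)
    W₃ = val (y₃ k)
    U  = val (u (suc k))
    U₁ = val (1+π.⁻¹ (⊖ y₂ k))
    U₂ = val (1+π.⁻¹ (y₃ k))
    U₃ = val (1+π.⁻¹ (u (suc k)))

    a b c : ℚ
    a = ι 2 + ι 2 * K
    b = ι 3 + ι 2 * K
    c = 1ℚ + (1ℚ + K)

    aY : a * Y ≡ 1ℚ
    aY = inverse₂ k k<P

    bW : b * W₃ ≡ 1ℚ
    bW = inverse₃ k k+1<P

    cU : c * U ≡ 1ℚ
    cU = trans (cong (λ z → (1ℚ + z) * U) (sym (ι-suc k))) (inverse (suc k) (ℕ.≤-trans k+1<P P≤2P))

    [π-a]⁻¹ : (π - a) * (Y * U₁) ≡ - 1ℚ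
    [π-a]⁻¹ = trans (lem π a Y U₁) (trans (cong₂ (λ s t → - s + π * (1ℚ - 1ℚ) + (1ℚ - t) * U₁) (1+π.inverse (⊖ y₂ k)) aY) (lem₁ π U₁))
      where
      lem = solve 4 (λ π a y u → (π :- a) :* (y :* u) := :- ((con 1 :+ π :* :- y) :* u) :+ π :* (con 1 :- con 1) :+ (con 1 :- a :* y) :* u) refl
      lem₁ = solve 2 (λ π u → :- con 1 :+ π :* (con 1 :- con 1) :+ (con 1 :- con 1) :* u := :- con 1) refl

    [π+d]⁻¹ : ∀ d (z : ℤ₍ₚ₎) → d * val z ≡ 1ℚ → (π + d) * (val z * val (1+π.⁻¹ z)) ≡ 1ℚ
    [π+d]⁻¹ d z dz≡1 = trans (lem π d (val z) (val (1+π.⁻¹ z))) (trans (cong₂ (λ s t → s + (t - 1ℚ) * val (1+π.⁻¹ z)) (1+π.inverse z) dz≡1) (lem₁ (val (1+π.⁻¹ z))))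
      where
      lem = solve 4 (λ π d z u → (π :+ d) :* (z :* u) := (con 1 :+ π :* z) :* u :+ (d :* z :- con 1) :* u) refl
      lem₁ = solve 1 (λ u → con 1 :+ (con 1 :- con 1) :* u := con 1) refl

    F-suc : F (suc k) (suc r) ≡ F k (suc (suc r)) * ((1ℚ + π * Y) * (π - ι 2 * K - 1ℚ) * (π - K)) * (W₃ * U * (U₁ * U₂ * U₃))
    F-suc = begin
      f′ ≡⟨ lem f′ ⟩
      - (f′ * (- 1ℚ * 1ℚ * 1ℚ)) ≡⟨ cong₂ (λ s t → - (f′ * (s * t))) (cong₂ _*_ [π-a]⁻¹ ([π+d]⁻¹ b (y₃ k) bW)) ([π+d]⁻¹ c (u (suc k)) cU) ⟨
      - (f′ * ((π - a) * (Y * U₁) * ((π + b) * (W₃ * U₂)) * ((π + c) * (U * U₃)))) ≡⟨ lem₁ f′ π K Y W₃ U U₁ U₂ U₃ ⟩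
      - (f′ * ((π - ι 2 * K - ι 2) * (π + ι 2 * K + ι 3) * (π + K + ι 2)) * (Y * W₃ * U * (U₁ * U₂ * U₃))) ≡⟨ cong (λ z → - (z * (Y * W₃ * U * (U₁ * U₂ * U₃)))) recurrence ⟩
      - (- (f * ((π + ι 2 * K + ι 2) * (π - ι 2 * K - 1ℚ) * (π - K))) * (Y * W₃ * U * (U₁ * U₂ * U₃))) ≡⟨ lem₂ f π K Y W₃ U (U₁ * U₂ * U₃) (π - ι 2 * K - 1ℚ) (π - K) ⟩
      f * ((a * Y + π * Y) * (π - ι 2 * K - 1ℚ) * (π - K)) * (W₃ * U * (U₁ * U₂ * U₃)) ≡⟨ cong (λ z → f * ((z + π * Y) * (π - ι 2 * K - 1ℚ) * (π - K)) * (W₃ * U * (U₁ * U₂ * U₃))) aY ⟩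
      f * ((1ℚ + π * Y) * (π - ι 2 * K - 1ℚ) * (π - K)) * (W₃ * U * (U₁ * U₂ * U₃)) ∎
      where
      f′ = F (suc k) (suc r)
      f = F k (suc (suc r))
      lem = solve 1 (λ f → f := :- (f :* (:- con 1 :* con 1 :* con 1))) refl
      lem₁ = solve 9 (λ f π K Y W U U₁ U₂ U₃ →
        :- (f :* ((π :- (con 2 :+ con 2 :* K)) :* (Y :* U₁) :* ((π :+ (con 3 :+ con 2 :* K)) :* (W :* U₂)) :* ((π :+ (con 1 :+ (con 1 :+ K))) :* (U
          :* U₃))))
        := :- (f :* ((π :- con 2 :* K :- con 2) :* (π :+ con 2 :* K :+ con 3) :* (π :+ K :+ con 2)) :* (Y :* W :* U :* (U₁ :* U₂ :* U₃)))) refl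
      lem₂ = solve 9 (λ f π K Y W U V s t →
        :- (:- (f :* ((π :+ con 2 :* K :+ con 2) :* s :* t)) :* (Y :* W :* U :* V))
        := f :* (((con 2 :+ con 2 :* K) :* Y :+ π :* Y) :* s :* t) :* (W :* U :* V)) refl

  F≡κρ : ∀ i r → suc i ℕ.+ suc r ≡ P → F (suc i) (suc r) ≡ F 0 P * val (ρ (suc i))
  F≡κρ zero r refl = begin
    F 1 (suc r) ≡⟨ F-suc ⟩
    F 0 P * ((1ℚ + π * Y) * (π - ι 2 * 0ℚ - 1ℚ) * (π - 0ℚ)) * (W₃ * U * (U₁ * U₂ * U₃)) ≡⟨ lem (F 0 P) π Y W₃ U (U₁ * U₂ * U₃) ⟩
    F 0 P * - (π * 1ℚ * U * W₃ * (1ℚ * (1ℚ + π * Y) * (1ℚ + π * - 1ℚ) * (1ℚ + π * - 0ℚ) * (U₁ * U₂ * U₃)))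
      ≡⟨ cong₂ (λ s t → F 0 P * - (π * s * U * W₃ * (1ℚ * (1ℚ + π * Y) * (1ℚ + π * - s) * (1ℚ + π * - t) * (U₁ * U₂ * U₃)))) inv-1 inv-0 ⟨
    F 0 P * - (π * Z * U * W₃ * (1ℚ * (1ℚ + π * Y) * (1ℚ + π * - Z) * (1ℚ + π * - val (v 0)) * (U₁ * U₂ * U₃)))
      ≡⟨ lem₁ (F 0 P) (π * Z * U * W₃) (1ℚ * (1ℚ + π * Y) * (1ℚ + π * - Z) * (1ℚ + π * - val (v 0))) U₁ U₂ U₃ ⟩
    F 0 P * val (ρ 1) ∎
    where
    open Step 0 r refl
    inv-1 : Z ≡ 1ℚ
    inv-1 = trans (sym (ℚ.*-identityˡ Z)) (y-inverse (ℕ.≤-trans k<P P≤2P))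
    lem = solve 6 (λ f π Y W U V →
      f :* ((con 1 :+ π :* Y) :* (π :- con 2 :* con 0 :- con 1) :* (π :- con 0)) :* (W :* U :* V)
      := f :* :- (π :* con 1 :* U :* W :* (con 1 :* (con 1 :+ π :* Y) :* (con 1 :+ π :* :- con 1) :* (con 1 :+ π :* :- con 0) :* V))) refl
    lem₁ = solve 6 (λ f s t a b c → f :* :- (s :* (t :* (a :* b :* c))) := f :* :- (s :* (t :* a :* b :* c))) refl
  F≡κρ (suc i) r eq = begin
    F (suc k) (suc r) ≡⟨ F-suc ⟩
    F k (suc (suc r)) * ((1ℚ + π * Y) * (π - ι 2 * K - 1ℚ) * (π - K)) * (W₃ * U * (U₁ * U₂ * U₃))
      ≡⟨ cong (λ z → z * ((1ℚ + π * Y) * (π - ι 2 * K - 1ℚ) * (π - K)) * (W₃ * U * (U₁ * U₂ * U₃))) (F≡κρ i (suc r) k+r) ⟩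
    κ * - (π * V * u₀ * Z * A₀) * ((1ℚ + π * Y) * (π - ι 2 * K - 1ℚ) * (π - K)) * (W₃ * U * (U₁ * U₂ * U₃))
      ≡⟨ lem κ π V u₀ Z A₀ (1ℚ + π * Y) (π - ι 2 * K - 1ℚ) (π - K) W₃ U U₁ U₂ U₃ ⟩
    κ * - (π * u₀ * U * W₃ * (A₀ * (1ℚ + π * Y) * ((π - ι 2 * K - 1ℚ) * Z) * ((π - K) * V) * U₁ * U₂ * U₃))
      ≡⟨ cong₂ (λ s t → κ * - (π * u₀ * U * W₃ * (A₀ * (1ℚ + π * Y) * s * t * U₁ * U₂ * U₃))) (lem₂ π K Z) (lem₃ π K V) ⟩
    κ * - (π * u₀ * U * W₃ * (A₀ * (1ℚ + π * Y) * (π * Z - (1ℚ + ι 2 * K) * Z) * (π * V - K * V) * U₁ * U₂ * U₃))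
      ≡⟨ cong₂ (λ s t → κ * - (π * u₀ * U * W₃ * (A₀ * (1ℚ + π * Y) * (π * Z - s) * (π * V - t) * U₁ * U₂ * U₃))) (inverse₁ k k<P) (inv-inverse (p∤ (s≤s (ℕ.<⇒≤ (ℕ.≤-trans k<P P≤2P))))) ⟩
    κ * - (π * u₀ * U * W₃ * (A₀ * (1ℚ + π * Y) * (π * Z - 1ℚ) * (π * V - 1ℚ) * U₁ * U₂ * U₃)) ≡⟨ lem₁ κ (π * u₀ * U * W₃) A₀ (1ℚ + π * Y) (π * Z) (π * V) U₁ U₂ U₃ ⟩
    κ * - (π * u₀ * U * W₃ * (A₀ * (1ℚ + π * Y) * (1ℚ + - (π * Z)) * (1ℚ + - (π * V)) * U₁ * U₂ * U₃))
      ≡⟨ cong₂ (λ a b → κ * - (π * u₀ * U * W₃ * (A₀ * (1ℚ + π * Y) * (1ℚ + a) * (1ℚ + b) * U₁ * U₂ * U₃))) (lem₄ π Z) (lem₄ π V) ⟩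
    κ * - (π * u₀ * U * W₃ * (A₀ * (1ℚ + π * Y) * (1ℚ + π * - Z) * (1ℚ + π * - V) * U₁ * U₂ * U₃)) ≡⟨ cong (λ n → κ * - (π * u₀ * U * val (y (suc n)) * val (A (suc k)))) (ℕ.+-suc k k) ⟨
    κ * val (ρ (suc k)) ∎
    where
    k = suc i
    k+r : k ℕ.+ suc (suc r) ≡ P
    k+r = trans (ℕ.+-suc k (suc r)) eq
    open Step k r k+r
    κ = F 0 P
    V = val (v k)
    u₀ = val (u k)
    A₀ = val (A k)
    lem = solve 14 (λ κ π V u Z A e s t W U U₁ U₂ U₃ →
      κ :* :- (π :* V :* u :* Z :* A) :* (e :* s :* t) :* (W :* U :* (U₁ :* U₂ :* U₃))
      := κ :* :- (π :* u :* U :* W :* (A :* e :* (s :* Z) :* (t :* V) :* U₁ :* U₂ :* U₃))) refl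
    lem₁ = solve 9 (λ κ s A t z v U₁ U₂ U₃ →
      κ :* :- (s :* (A :* t :* (z :- con 1) :* (v :- con 1) :* U₁ :* U₂ :* U₃))
      := κ :* :- (s :* (A :* t :* (con 1 :+ :- z) :* (con 1 :+ :- v) :* U₁ :* U₂ :* U₃))) refl
    lem₂ = solve 3 (λ π K Z → (π :- con 2 :* K :- con 1) :* Z := π :* Z :- (con 1 :+ con 2 :* K) :* Z) refl
    lem₃ = solve 3 (λ π K V → (π :- K) :* V := π :* V :- K :* V) refl
    lem₄ = solve 2 (λ π z → :- (π :* z) := π :* :- z) refl

  α≡ : ∀ i → suc i < P → val (α (suc i)) ≡ ι 2 - ι 2 * val (H (odd i)) - val (u (suc i)) - val (y₁ (suc i))
  α≡ zero 1<P = begin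
    0ℚ + Y + - Z + - val (v 0) + Y + - W₃ + - U ≡⟨ cong (λ t → 0ℚ + Y + - Z + - t + Y + - W₃ + - U) inv-0 ⟩
    0ℚ + Y + - Z + - 0ℚ + Y + - W₃ + - U ≡⟨ lem Y Z W₃ U ⟩
    ι 2 * Y + (1ℚ - ι 2 * 0ℚ) * Z - ι 2 * (0ℚ + Z) - U - W₃ ≡⟨ cong₂ (λ s t → s + t - ι 2 * (0ℚ + Z) - U - W₃) (inverse₂ 0 0<P) inverse′ ⟩
    1ℚ + 1ℚ - ι 2 * (0ℚ + Z) - U - W₃ ∎
    where
    0<P : 0 < P
    0<P = ℕ.<⇒≤ 1<P
    Y = val (y₂ 0)
    Z = val (y₁ 0)
    W₃ = val (y₃ 0)
    U = val (u 1)
    inverse′ : (1ℚ - ι 2 * 0ℚ) * Z ≡ 1ℚ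
    inverse′ = inverse₁ 0 0<P
    lem = solve 4 (λ Y Z W U →
      con 0 :+ Y :+ :- Z :+ :- con 0 :+ Y :+ :- W :+ :- U
      := con 2 :* Y :+ (con 1 :- con 2 :* con 0) :* Z :- con 2 :* (con 0 :+ Z) :- U :- W) refl
  α≡ (suc i) k+1<P = begin
    val (α k) + Y + - Z + - V + Y + - W₃ + - U ≡⟨ cong (λ t → t + Y + - Z + - V + Y + - W₃ + - U) (α≡ i k<P) ⟩
    ι 2 - ι 2 * h - u₀ - Z + Y + - Z + - V + Y + - W₃ + - U ≡⟨ cong₂ (λ s t → ι 2 - ι 2 * h - u₀ - Z + s + - Z + - t + s + - W₃ + - U) (y-even k<P) V≡ ⟩
    ι 2 - ι 2 * h - u₀ - Z + ½ * u₀ + - Z + - (ι 2 * T) + ½ * u₀ + - W₃ + - U ≡⟨ lem h u₀ Z T W₃ U ⟩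
    ι 2 - ι 2 * (h + T + Z) - U - W₃ ≡⟨ cong₂ (λ m n → ι 2 - ι 2 * (h + T + val (y (suc m))) - U - val (y n)) (ℕ.+-suc i i) (sym (Double.suc+suc k)) ⟩
    ι 2 - ι 2 * (h + T + val (y (suc (suc (i ℕ.+ i))))) - U - val (y₁ (suc k)) ≡⟨ cong (λ n → ι 2 - ι 2 * val (H (suc n)) - U - val (y₁ (suc k))) (Double.suc+suc i) ⟨
    ι 2 - ι 2 * val (H (odd k)) - U - val (y₁ (suc k)) ∎
    where
    k = suc i
    k<P : k < P
    k<P = ℕ.<⇒≤ k+1<P
    V = val (v k)
    Y = val (y₂ k)
    Z = val (y₁ k)
    W₃ = val (y₃ k)
    U = val (u (suc k))
    u₀ = val (u k)
    h = val (H (odd i))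
    T = val (y (odd i))
    V≡ : V ≡ ι 2 * T
    V≡ = trans (lem (val (y i))) (cong (ι 2 *_) (sym (y-even (ℕ.<⇒≤ k<P))))
      where
      lem = solve 1 (λ y → y := con 2 :* (Κ ½ :* y)) refl
    lem = solve 6 (λ h u Z T W U →
      con 2 :- con 2 :* h :- u :- Z :+ Κ ½ :* u :+ :- Z :+ :- (con 2 :* T) :+ Κ ½ :* u :+ :- W :+ :- U
      := con 2 :- con 2 :* (h :+ T :+ Z) :- U :- W) refl

  C₂ : ℕ → ℕ
  C₂ j = suc (suc (p ℕ.+ p)) C (j ℕ.+ j)

  ι2p : ι (p ℕ.+ p) ≡ ι 2 * π
  ι2p = Double.ι2n p

  C₂≡ : ∀ i → suc i < P → let k = suc i in
    ι (C₂ (suc k)) ≡ (1ℚ + π) * (1ℚ + ι 2 * π) * (π * val (v k) * val (u k) * val (y₁ k) * ι ((p ℕ.+ 2P) C odd i))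
  C₂≡ i k<P = begin
    ι (C₂ (suc k)) ≡⟨ cong (λ n → ι (suc (suc (p ℕ.+ p)) C n)) (Double.suc+suc k) ⟩
    ι (suc (suc (p ℕ.+ p)) C suc (odd k)) ≡⟨ absorb (suc (p ℕ.+ p)) (odd k) (2j+1<2P k<P) (ℕ.≤-trans (ℕ.<⇒≤ (2j+1<2P k<P)) (ℕ.≤-trans (ℕ.n≤1+n 2P) (ℕ.≤-trans (ℕ.m≤m+n p p) (ℕ.n≤1+n (p ℕ.+ p))))) ⟩
    (1ℚ + ι (suc (p ℕ.+ p))) * (val (y₂ k) * ι (suc (p ℕ.+ p) C suc (k ℕ.+ k)))
      ≡⟨ cong (λ c → (1ℚ + ι (suc (p ℕ.+ p))) * (val (y₂ k) * c)) (absorb (p ℕ.+ p) (k ℕ.+ k) 2k<2P (ℕ.≤-trans (ℕ.<⇒≤ 2k<2P) (ℕ.≤-trans (ℕ.n≤1+n 2P) (ℕ.m≤m+n p p)))) ⟩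
    (1ℚ + ι (suc (p ℕ.+ p))) * (val (y₂ k) * ((1ℚ + ι (p ℕ.+ p)) * (val (y₁ k) * ι ((p ℕ.+ p) C (k ℕ.+ k)))))
      ≡⟨ cong₂ (λ a c → (1ℚ + a) * (val (y₂ k) * ((1ℚ + ι (p ℕ.+ p)) * (val (y₁ k) * c)))) (ι-suc (p ℕ.+ p)) (trans (cong₂ (λ a b → ι (a C b)) (ℕ.+-suc p 2P) (Double.suc+suc i)) (absorb (p ℕ.+ 2P) (odd i) (2j+1<2P i<P) (ℕ.≤-trans (ℕ.<⇒≤ (2j+1<2P i<P)) (ℕ.m≤n+m 2P p)))) ⟩
    (1ℚ + (1ℚ + ι (p ℕ.+ p))) * (val (y₂ k) * ((1ℚ + ι (p ℕ.+ p)) * (val (y₁ k) * ((1ℚ + ι (p ℕ.+ 2P)) * (val (y (odd i)) * c)))))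
      ≡⟨ cong₂ (λ a b → (1ℚ + (1ℚ + a)) * (val (y₂ k) * ((1ℚ + a) * (val (y₁ k) * (b * (val (y (odd i)) * c)))))) ι2p 1+ι[p+2P] ⟩
    (1ℚ + (1ℚ + ι 2 * π)) * (val (y₂ k) * ((1ℚ + ι 2 * π) * (val (y₁ k) * (ι 2 * π * (val (y (odd i)) * c)))))
      ≡⟨ cong₂ (λ a b → (1ℚ + (1ℚ + ι 2 * π)) * (a * ((1ℚ + ι 2 * π) * (val (y₁ k) * (ι 2 * π * (b * c)))))) (y-even k<P) (y-even i<P) ⟩
    (1ℚ + (1ℚ + ι 2 * π)) * (½ * val (u k) * ((1ℚ + ι 2 * π) * (val (y₁ k) * (ι 2 * π * (½ * val (y i) * c))))) ≡⟨ lem π (val (u k)) (val (y₁ k)) (val (y i)) c ⟩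
    (1ℚ + π) * (1ℚ + ι 2 * π) * (π * val (v k) * val (u k) * val (y₁ k) * c) ∎
    where
    k = suc i
    c = ι ((p ℕ.+ 2P) C odd i)
    i<P : i < P
    i<P = ℕ.<⇒≤ k<P
    2k<2P : k ℕ.+ k < 2P
    2k<2P = ℕ.<⇒≤ (2j+1<2P k<P)
    lem = solve 5 (λ π u z v c →
      (con 1 :+ (con 1 :+ con 2 :* π)) :* (Κ ½ :* u :* ((con 1 :+ con 2 :* π) :* (z :* (con 2 :* π :* (Κ ½ :* v :* c)))))
      := (con 1 :+ π) :* (con 1 :+ con 2 :* π) :* (π :* v :* u :* z :* c)) refl

  partial-fractions : ∀ i → suc i < P → let k = suc i; V = val (v k); U = val (u k); Z = val (y₁ k) in
    V * U * Z * (ι 2 - U - Z) ≡ ι 4 * (Z * Z) - U * U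
  partial-fractions i k<P = begin
    V * U * Z * (ι 2 - U - Z) ≡⟨ lem V U Z ⟩
    U * Z * (ι 2 * V - V * U - V * Z) ≡⟨ cong₂ (λ a b → U * Z * (ι 2 * V - a - b)) VU VZ ⟩
    U * Z * (ι 2 * V - (V - U) - (V - ι 2 * Z)) ≡⟨ cong (_* (ι 2 * V - (V - U) - (V - ι 2 * Z))) UZ ⟩
    (ι 2 * Z - U) * (ι 2 * V - (V - U) - (V - ι 2 * Z)) ≡⟨ lem₁ V U Z ⟩
    ι 4 * (Z * Z) - U * U ∎
    where
    k = suc i
    K = ι k
    V = val (v k)
    U = val (u k)
    Z = val (y₁ k)
    KV : K * V ≡ 1ℚ
    KV = y-inverse (ℕ.≤-trans (ℕ.<⇒≤ k<P) P≤2P)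
    KU : (1ℚ + K) * U ≡ 1ℚ
    KU = inverse k (ℕ.≤-trans k<P P≤2P)
    KZ : (1ℚ + ι 2 * K) * Z ≡ 1ℚ
    KZ = inverse₁ k k<P
    lem = solve 3 (λ V U Z → V :* U :* Z :* (con 2 :- U :- Z) := U :* Z :* (con 2 :* V :- V :* U :- V :* Z)) refl
    lem₁ = solve 3 (λ V U Z → (con 2 :* Z :- U) :* (con 2 :* V :- (V :- U) :- (V :- con 2 :* Z)) := con 4 :* (Z :* Z) :- U :* U) refl
    lem₂ = solve 3 (λ K V U → V :* U := V :* ((con 1 :+ K) :* U) :- U :* (K :* V)) refl
    lem₃ = solve 3 (λ K V Z → V :* Z := V :* ((con 1 :+ con 2 :* K) :* Z) :- con 2 :* Z :* (K :* V)) refl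
    lem₄ = solve 3 (λ K U Z → U :* Z := con 2 :* Z :* ((con 1 :+ K) :* U) :- U :* ((con 1 :+ con 2 :* K) :* Z)) refl
    lem₅ = solve 2 (λ a b → a :* con 1 :- b :* con 1 := a :- b) refl
    VU : V * U ≡ V - U
    VU = trans (lem₂ K V U) (trans (cong₂ (λ a b → V * a - U * b) KU KV) (lem₅ V U))
    VZ : V * Z ≡ V - ι 2 * Z
    VZ = trans (lem₃ K V Z) (trans (cong₂ (λ a b → V * a - ι 2 * Z * b) KZ KV) (lem₅ V (ι 2 * Z)))
    UZ : U * Z ≡ ι 2 * Z - U
    UZ = trans (lem₄ K U Z) (trans (cong₂ (λ a b → ι 2 * Z * a - U * b) KU KZ) (lem₅ (ι 2 * Z) U))

  ρ≈ : ∀ i → suc i < P → let k = suc i in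
    (1ℚ + π) * (1ℚ + ι 2 * π) * val (ρ k) ≈[ 3 ] ι (C₂ (suc k)) - π * (π * (ι 4 * (val (y₁ k) * val (y₁ k)) - val (u k) * val (u k)))
  ρ≈ i k<P =
    (1ℚ + π) * (1ℚ + ι 2 * π) * - (π * V * U * Z * a) ≐⟨ lem π V U Z a ⟩
    π * ((1ℚ + π) * (1ℚ + ι 2 * π) * - (V * U * Z) * a) ≈⟨ ≈-π (≈-*ˡ ((⟦ 1 ⟧ ⊕ Π) ⊛ (⟦ 1 ⟧ ⊕ ⟦ 2 ⟧ ⊛ Π) ⊛ ⊖ (v k ⊛ u k ⊛ y₁ k)) (≈-trans (A≈ k) (≡⇒≈ (cong (λ x → 1ℚ + π * x) (α≡ i k<P))))) ⟩
    π * ((1ℚ + π) * (1ℚ + ι 2 * π) * - (V * U * Z) * (1ℚ + π * (ι 2 - ι 2 * h - U - Z))) ≈⟨ (⊖ (⟦ 3 ⟧ ⊕ ⟦ 2 ⟧ ⊛ Π) ⊛ (v k ⊛ u k ⊛ y₁ k ⊛ (⟦ 2 ⟧ ⊕ ⊖ u k ⊕ ⊖ y₁ k))) by lem₁ π V U Z h ⟩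
    π * ((1ℚ + π) * (1ℚ + ι 2 * π) * (V * U * Z) * (- 1ℚ * (1ℚ - ι 2 * (π * h)))) - π * (π * (V * U * Z * (ι 2 - U - Z)))
      ≈⟨ ≈-+ (≈-π (≈-*ˡ ((⟦ 1 ⟧ ⊕ Π) ⊛ (⟦ 1 ⟧ ⊕ ⟦ 2 ⟧ ⊛ Π) ⊛ (v k ⊛ u k ⊛ y₁ k)) (≈-sym (C-≈-odd 2 (p ℕ.+ 2P) 1+ι[p+2P] (ℕ.m≤n+m 2P p) i (ℕ.<⇒≤ k<P))))) (_ ■) ⟩
    π * ((1ℚ + π) * (1ℚ + ι 2 * π) * (V * U * Z) * c) - π * (π * (V * U * Z * (ι 2 - U - Z))) ≐⟨ cong₂ (λ a b → a - π * (π * b)) (trans (lem₂ π V U Z c) (sym (C₂≡ i k<P))) (partial-fractions i k<P) ⟩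
    ι (C₂ (suc k)) - π * (π * (ι 4 * (Z * Z) - U * U)) ■
    where
    k = suc i
    V = val (v k)
    U = val (u k)
    Z = val (y₁ k)
    a = val (A k)
    h = val (H (odd i))
    c = ι ((p ℕ.+ 2P) C odd i)
    lem = solve 5 (λ π V U Z a →
      (con 1 :+ π) :* (con 1 :+ con 2 :* π) :* :- (π :* V :* U :* Z :* a)
      := π :* ((con 1 :+ π) :* (con 1 :+ con 2 :* π) :* :- (V :* U :* Z) :* a)) refl
    lem₁ = solve 5 (λ π V U Z h →
      π :* ((con 1 :+ π) :* (con 1 :+ con 2 :* π) :* :- (V :* U :* Z) :* (con 1 :+ π :* (con 2 :- con 2 :* h :- U :- Z)))
      := π :* ((con 1 :+ π) :* (con 1 :+ con 2 :* π) :* (V :* U :* Z) :* (:- con 1 :* (con 1 :- con 2 :* (π :* h)))) :- π :* (π :* (V :* U :* Z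
        :* (con 2 :- U :- Z))) :+ π :* (π :* (π :* con 1)) :* (:- (con 3 :+ con 2 :* π) :* (V :* U :* Z :* (con 2 :+ :- U :+ :- Z)))) refl
    lem₂ = solve 5 (λ π V U Z c →
      π :* ((con 1 :+ π) :* (con 1 :+ con 2 :* π) :* (V :* U :* Z) :* c)
      := (con 1 :+ π) :* (con 1 :+ con 2 :* π) :* (π :* V :* U :* Z :* c)) refl

  C₂-middle : (1ℚ + π) * ι (suc (p ℕ.+ p) C p) ≡ ι 2 * (1ℚ + ι 2 * π) * val W
  C₂-middle = begin
    (1ℚ + π) * ι (suc (p ℕ.+ p) C p) ≡⟨ cong (λ n → (1ℚ + π) * ι (n C p)) (ℕ.+-suc p p) ⟨
    (1ℚ + π) * ι ((p ℕ.+ suc p) C p) ≡⟨ cong ((1ℚ + π) *_) (C≡ p (suc p)) ⟩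
    (1ℚ + π) * (fac (p ℕ.+ suc p) * (!⁻¹ p * !⁻¹ (suc p))) ≡⟨ cong (λ f → (1ℚ + π) * (f * (!⁻¹ p * !⁻¹ (suc p)))) fac-2p+1 ⟩
    (1ℚ + π) * ((1ℚ + ι 2 * π) * (ι 2 * π * (fac p * fac 2P * val W)) * (!⁻¹ p * !⁻¹ (suc p))) ≡⟨ lem π (fac p) (fac 2P) (val W) (!⁻¹ p) (!⁻¹ (suc p)) ⟩
    ι 2 * (1ℚ + ι 2 * π) * val W * (fac p * ((1ℚ + π) * !⁻¹ (suc p))) * (π * fac 2P * !⁻¹ p) ≡⟨ cong₂ (λ a b → ι 2 * (1ℚ + ι 2 * π) * val W * (fac p * a) * (b * !⁻¹ p)) (!⁻¹-suc p) (ι-* p (2P !)) ⟨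
    ι 2 * (1ℚ + ι 2 * π) * val W * (fac p * !⁻¹ p) * (fac p * !⁻¹ p) ≡⟨ cong (λ a → ι 2 * (1ℚ + ι 2 * π) * val W * a * a) (fac-inverse p) ⟩
    ι 2 * (1ℚ + ι 2 * π) * val W * 1ℚ * 1ℚ ≡⟨ lem₁ (ι 2 * (1ℚ + ι 2 * π) * val W) ⟩
    ι 2 * (1ℚ + ι 2 * π) * val W ∎
    where
    lem = solve 6 (λ π f g W i j →
      (con 1 :+ π) :* ((con 1 :+ con 2 :* π) :* (con 2 :* π :* (f :* g :* W)) :* (i :* j))
      := con 2 :* (con 1 :+ con 2 :* π) :* W :* (f :* ((con 1 :+ π) :* j)) :* (π :* g :* i)) refl
    lem₁ = solve 1 (λ x → x :* con 1 :* con 1 := x) refl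
    fac-2p+1 : fac (p ℕ.+ suc p) ≡ (1ℚ + ι 2 * π) * (ι 2 * π * (fac p * fac 2P * val W))
    fac-2p+1 = begin
      fac (p ℕ.+ suc p) ≡⟨ cong fac (ℕ.+-suc p p) ⟩
      fac (suc (p ℕ.+ p)) ≡⟨ trans (fac-suc (p ℕ.+ p)) (cong₂ (λ a n → (1ℚ + a) * fac n) ι2p (ℕ.+-suc p 2P)) ⟩
      (1ℚ + ι 2 * π) * fac (suc (p ℕ.+ 2P)) ≡⟨ cong ((1ℚ + ι 2 * π) *_) (trans (fac-suc (p ℕ.+ 2P)) (cong₂ _*_ 1+ι[p+2P] fac-p+2P)) ⟩
      (1ℚ + ι 2 * π) * (ι 2 * π * (fac p * fac 2P * val W)) ∎

  module Assembly (P′ : ℕ) (P≡ : P ≡ suc P′) where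
    open Corners P (sgn P * val B) (val Γ) (val W) fac-2P fac-p+P fac-p+2P using (F-first; F-last)

    <P : ∀ {l} → l < P′ → suc l < P
    <P l<P′ = subst (suc (suc _) ≤_) (sym P≡) (s≤s l<P′)

    ∑C₂ : val (∑ P′ (λ l → ⟦ C₂ (suc (suc l)) ⟧)) ≡ ι 4 * (m * m) - ι (suc (p ℕ.+ p) C p) - 1ℚ - (1ℚ + π) * (1ℚ + ι 2 * π)
    ∑C₂ = begin
      s ≡⟨ lem s (ι (C₂ 1)) c ⟩
      1ℚ + (ι (C₂ 1) + s) + c - c - 1ℚ - ι (C₂ 1) ≡⟨ cong₂ (λ a b → a + c - c - 1ℚ - b) (trans (cong (1ℚ +_) (sym (∑-head P′ (⟦_⟧ ∘ C₂ ∘ suc)))) (trans (sym (∑-head (suc P′) (⟦_⟧ ∘ C₂))) (cong (λ n → val (∑ (suc n) (⟦_⟧ ∘ C₂))) (sym P≡)))) C₂-1 ⟩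
      val (∑ (suc P) (⟦_⟧ ∘ C₂)) + c - c - 1ℚ - (1ℚ + π) * (1ℚ + ι 2 * π)
        ≡⟨ cong (λ a → a - c - 1ℚ - (1ℚ + π) * (1ℚ + ι 2 * π)) (trans (cong (_+ c) (∑C-even (suc (p ℕ.+ p)) P)) (trans (sym (ι-+ (∑C (suc (p ℕ.+ p)) p) (suc (p ℕ.+ p) C p))) (trans (cong ι (∑C-half-row p)) (trans (ι-* 4 (4 ℕ.^ 2P)) (cong (ι 4 *_) 4^2P))))) ⟩
      ι 4 * (m * m) - c - 1ℚ - (1ℚ + π) * (1ℚ + ι 2 * π) ∎
      where
      s = val (∑ P′ (λ l → ⟦ C₂ (suc (suc l)) ⟧))
      c = ι (suc (p ℕ.+ p) C p)
      lem = solve 3 (λ s d c → s := con 1 :+ (d :+ s) :+ c :- c :- con 1 :- d) refl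
      C₂-1 : ι (C₂ 1) ≡ (1ℚ + π) * (1ℚ + ι 2 * π)
      C₂-1 = begin
        ι (suc (suc (p ℕ.+ p)) C 2) ≡⟨ absorb (suc (p ℕ.+ p)) 1 (2j+1<2P {0} (ℕ.<⇒≤ 1<P)) (s≤s z≤n) ⟩
        (1ℚ + ι (suc (p ℕ.+ p))) * (val (y 1) * ι (suc (p ℕ.+ p) C 1)) ≡⟨ cong₂ (λ a b → (1ℚ + a) * (val (y 1) * b)) sp (trans (cong ι (nC1≡n (suc (p ℕ.+ p)))) sp) ⟩
        (1ℚ + (1ℚ + ι 2 * π)) * (val (y 1) * (1ℚ + ι 2 * π)) ≡⟨ lem₁ π (val (y 1)) ⟩
        (1ℚ + π) * (1ℚ + ι 2 * π) * ((ι 2 + ι 2 * 0ℚ) * val (y 1)) ≡⟨ cong ((1ℚ + π) * (1ℚ + ι 2 * π) *_) (inverse₂ 0 (ℕ.<⇒≤ 1<P)) ⟩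
        (1ℚ + π) * (1ℚ + ι 2 * π) * 1ℚ ≡⟨ ℚ.*-identityʳ ((1ℚ + π) * (1ℚ + ι 2 * π)) ⟩
        (1ℚ + π) * (1ℚ + ι 2 * π) ∎
        where
        sp : ι (suc (p ℕ.+ p)) ≡ 1ℚ + ι 2 * π
        sp = trans (ι-suc (p ℕ.+ p)) (cong (1ℚ +_) ι2p)
        lem₁ = solve 2 (λ π y →
          (con 1 :+ (con 1 :+ con 2 :* π)) :* (y :* (con 1 :+ con 2 :* π))
          := (con 1 :+ π) :* (con 1 :+ con 2 :* π) :* ((con 2 :+ con 2 :* con 0) :* y)) refl

    R : ℤ₍ₚ₎
    R = ∑ P′ (ρ ∘ suc)

    squares : ℕ → ℤ₍ₚ₎
    squares l = ⟦ 4 ⟧ ⊛ (y₁ (suc l) ⊛ y₁ (suc l)) ⊕ ⊖ (u (suc l) ⊛ u (suc l))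

    ∑squares≈ : val (∑ P′ squares) ≈[ 1 ] - ι 3
    ∑squares≈ = val (∑ P′ squares) ≐⟨ ∑-linear P′ (ι 4) (- 1ℚ) (λ l → y₁ (suc l) ⊛ y₁ (suc l)) (λ l → u (suc l) ⊛ u (suc l)) squares (λ l _ → lem (val (y₁ (suc l)) * val (y₁ (suc l))) (val (u (suc l)) * val (u (suc l)))) ⟩
      ι 4 * o + - 1ℚ * s ≐⟨ lem₁ o s 1² ⟩
      ι 4 * (1² + o) + - 1ℚ * (1² + s) - ι 3 * 1² ≐⟨ cong₂ (λ a b → ι 4 * a + - 1ℚ * b - ι 3 * 1²) (trans (sym (∑-head P′ (λ l → y₁ l ⊛ y₁ l))) (cong (λ n → val (∑ n (λ l → y₁ l ⊛ y₁ l))) (sym P≡)))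
        (trans (sym (∑-head P′ (λ l → u l ⊛ u l))) (cong (λ n → val (∑ n (λ l → u l ⊛ u l))) (sym P≡))) ⟩
      ι 4 * val O₂ + - 1ℚ * val S₂ - ι 3 * 1² ≈⟨ ≈-+ (≈-+ 4O₂≈S₂ ((- 1ℚ * val S₂) ■)) ((- (ι 3 * 1²)) ■) ⟩
      val S₂ + - 1ℚ * val S₂ - ι 3 * 1² ≐⟨ trans (lem₂ (val S₂) 1²) (cong (λ z → - (ι 3 * (z * z))) y0≡1) ⟩
      - ι 3 ■
      where
      o = val (∑ P′ (λ l → y₁ (suc l) ⊛ y₁ (suc l)))
      s = val (∑ P′ (λ l → u (suc l) ⊛ u (suc l)))
      1² = val (y 0) * val (y 0)
      y0≡1 : val (y 0) ≡ 1ℚ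
      y0≡1 = trans (sym (ℚ.*-identityˡ (val (y 0)))) (y-inverse (ℕ.≤-trans (ℕ.<⇒≤ 1<P) P≤2P))
      lem = solve 2 (λ a b → con 4 :* a :+ :- b := con 4 :* a :+ :- con 1 :* b) refl
      lem₁ = solve 3 (λ o s e → con 4 :* o :+ :- con 1 :* s := con 4 :* (e :+ o) :+ :- con 1 :* (e :+ s) :- con 3 :* e) refl
      lem₂ = solve 2 (λ s e → s :+ :- con 1 :* s :- con 3 :* e := :- (con 3 :* e)) refl

    R≈ : (1ℚ + π) * (1ℚ + ι 2 * π) * val R ≈[ 3 ] ι 4 * (m * m) - ι (suc (p ℕ.+ p) C p) - 1ℚ - (1ℚ + π) * (1ℚ + ι 2 * π) + ι 3 * (π * π)
    R≈ = (1ℚ + π) * (1ℚ + ι 2 * π) * val R ≐⟨ lem₁ ((1ℚ + π) * (1ℚ + ι 2 * π)) (val R) (val (∑ P′ (ρ ∘ suc))) ⟩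
      (1ℚ + π) * (1ℚ + ι 2 * π) * val R + 0ℚ * val (∑ P′ (ρ ∘ suc)) ≐⟨ ∑-linear P′ ((1ℚ + π) * (1ℚ + ι 2 * π)) 0ℚ (ρ ∘ suc) (ρ ∘ suc) cρ (λ l _ → lem₁ ((1ℚ + π) * (1ℚ + ι 2 * π)) (val (ρ (suc l))) (val (ρ (suc l)))) ⟨
      val (∑ P′ cρ) ≈⟨ ∑-cong P′ cρ cC (λ l l<P′ → ρ≈ l (<P l<P′)) ⟩
      val (∑ P′ cC) ≐⟨ ∑-linear P′ 1ℚ (- (π * π)) (λ l → ⟦ C₂ (suc (suc l)) ⟧) squares cC (λ l _ → lem₂ π (ι (C₂ (suc (suc l)))) (val (squares l))) ⟩
      1ℚ * val (∑ P′ (λ l → ⟦ C₂ (suc (suc l)) ⟧)) + - (π * π) * val (∑ P′ squares) ≐⟨ trans (cong (λ s → 1ℚ * s + - (π * π) * val (∑ P′ squares)) ∑C₂) (lem₃ π t (val (∑ P′ squares))) ⟩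
      t + - (π * (π * val (∑ P′ squares))) ≈⟨ ≈-+ (t ■) (≈-neg (≈-π (≈-π ∑squares≈))) ⟩
      t + - (π * (π * - ι 3)) ≐⟨ lem₄ π t ⟩
      t + ι 3 * (π * π) ■
      where
      cρ cC : ℕ → ℤ₍ₚ₎
      cρ l = (⟦ 1 ⟧ ⊕ Π) ⊛ (⟦ 1 ⟧ ⊕ ⟦ 2 ⟧ ⊛ Π) ⊛ ρ (suc l)
      cC l = ⟦ C₂ (suc (suc l)) ⟧ ⊕ ⊖ (Π ⊛ (Π ⊛ squares l))
      t = ι 4 * (m * m) - ι (suc (p ℕ.+ p) C p) - 1ℚ - (1ℚ + π) * (1ℚ + ι 2 * π)
      lem₁ = solve 3 (λ a x z → a :* x := a :* x :+ con 0 :* z) refl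
      lem₂ = solve 3 (λ π c s → c :- π :* (π :* s) := con 1 :* c :+ :- (π :* π) :* s) refl
      lem₃ = solve 3 (λ π t s → con 1 :* t :+ :- (π :* π) :* s := t :+ :- (π :* (π :* s))) refl
      lem₄ = solve 2 (λ π t → t :+ :- (π :* (π :* :- con 3)) := t :+ con 3 :* (π :* π)) refl

    diagonal≡ : diagonal 0 P ≡ F 0 P * (1ℚ + val R) + F P 0
    diagonal≡ = begin
      diagonal 0 P ≡⟨ cong (diagonal 0) P≡ ⟩
      F 0 (suc P′) + diagonal 1 P′ ≡⟨ cong₂ (λ n d → F 0 n + d) (sym P≡) (go 0 P′ (sym P≡)) ⟩
      F 0 P + (F 0 P * val (∑ P′ (λ l → ρ (suc l))) + F P 0) ≡⟨ lem (F 0 P) (val R) (F P 0) ⟩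
      F 0 P * (1ℚ + val R) + F P 0 ∎
      where
      lem = solve 3 (λ κ r f → κ :+ (κ :* r :+ f) := κ :* (con 1 :+ r) :+ f) refl
      lem₁ = solve 4 (λ κ a s f → κ :* a :+ (κ :* s :+ f) := κ :* (a :+ s) :+ f) refl
      lem₂ = solve 2 (λ κ f → f := κ :* con 0 :+ f) refl
      go : ∀ i r → suc i ℕ.+ r ≡ P → diagonal (suc i) r ≡ F 0 P * val (∑ r (λ l → ρ (suc (i ℕ.+ l)))) + F P 0
      go i zero eq = trans (cong (λ n → F n 0) (trans (sym (ℕ.+-identityʳ (suc i))) eq)) (lem₂ (F 0 P) (F P 0))
      go i (suc r) eq = begin
        F (suc i) (suc r) + diagonal (suc (suc i)) r ≡⟨ cong₂ _+_ (F≡κρ i r eq) (go (suc i) r (trans (sym (ℕ.+-suc (suc i) r)) eq)) ⟩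
        F 0 P * val (ρ (suc i)) + (F 0 P * val (∑ r (λ l → ρ (suc (suc i ℕ.+ l)))) + F P 0) ≡⟨ lem₁ (F 0 P) (val (ρ (suc i))) (val (∑ r (λ l → ρ (suc (suc i ℕ.+ l))))) (F P 0) ⟩
        F 0 P * (val (ρ (suc i)) + val (∑ r (λ l → ρ (suc (suc i ℕ.+ l))))) + F P 0 ≡⟨ cong (λ s → F 0 P * s + F P 0) shift ⟩
        F 0 P * val (∑ (suc r) (λ l → ρ (suc (i ℕ.+ l)))) + F P 0 ∎
        where
        shift : val (ρ (suc i)) + val (∑ r (λ l → ρ (suc (suc i ℕ.+ l)))) ≡ val (∑ (suc r) (λ l → ρ (suc (i ℕ.+ l))))
        shift = trans (cong₂ _+_ (cong (λ n → val (ρ (suc n))) (sym (ℕ.+-identityʳ i))) (∑-ext r)) (sym (∑-head r (λ l → ρ (suc (i ℕ.+ l)))))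
          where
          ∑-ext : ∀ r → val (∑ r (λ l → ρ (suc (suc i ℕ.+ l)))) ≡ val (∑ r (λ l → ρ (suc (i ℕ.+ suc l))))
          ∑-ext zero = refl
          ∑-ext (suc r) = cong₂ (λ s n → s + val (ρ (suc n))) (∑-ext r) (sym (ℕ.+-suc i r))

    μ ε : ℤ₍ₚ₎
    μ = inv M
    ε = 1+π.⁻¹ ⟦ 1 ⟧

    mμ : m * val μ ≡ 1ℚ
    mμ = inv-inverse (p∤^ 2P p∤2)

    h²≡μ : 2⁻^ P * 2⁻^ P ≡ val μ
    h²≡μ = inv-unique (2⁻^ P * 2⁻^ P) (p∤^ 2P p∤2) (trans (cong (m *_) (sym (2⁻^-double P))) (2^*2⁻^ 2P))

    ε-inverse : (1ℚ + π) * val ε ≡ 1ℚ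
    ε-inverse = trans (cong (λ x → (1ℚ + x) * val ε) (sym (ℚ.*-identityʳ π))) (1+π.inverse ⟦ 1 ⟧)

    μ⁶ : ℤ₍ₚ₎
    μ⁶ = μ ⊛ μ ⊛ μ ⊛ μ ⊛ μ ⊛ μ

    κ′ φ′ S′ : ℤ₍ₚ₎
    κ′ = ⟦ 3 ⟧ ⊛ ((⟦ 1 ⟧ ⊕ ⟦ 2 ⟧ ⊛ Π) ⊛ (⟦ 1 ⟧ ⊕ ⟦ 3 ⟧ ⊛ Π)) ⊛ (ε ⊛ ε) ⊛ (μ⁶ ⊛ (B ⊛ B) ⊛ W ⊛ (B ⊛ Γ))
    φ′ = ⟦ 6 ⟧ ⊛ (⟦ 1 ⟧ ⊕ ⟦ 2 ⟧ ⊛ Π) ⊛ ε ⊛ (μ⁶ ⊛ (B ⊛ B) ⊛ (W ⊛ W))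
    S′ = κ′ ⊛ (⟦ 1 ⟧ ⊕ R) ⊕ φ′

    F-first≡ : F 0 P ≡ π * (π * val κ′)
    F-first≡ = begin
      F 0 P ≡⟨ trans (lem (F 0 P)) (cong (λ e → F 0 P * (e * e)) (sym ε-inverse)) ⟩
      F 0 P * ((1ℚ + π) * e * ((1ℚ + π) * e)) ≡⟨ lem₁ (F 0 P) (1ℚ + π) e ⟩
      F 0 P * ((1ℚ + π) * (1ℚ + π)) * (e * e) ≡⟨ cong (_* (e * e)) F-first ⟩
      ι 3 * (π * π) * ((ι 2 * π + 1ℚ) * (ι 3 * π + 1ℚ)) * (h * h * (h * h) * (h * h) * (h * h) * (h * h) * (h * h)) * val W * (s * val B * (s * val B)) * (s * (s * val B * val Γ)) * (e * e)
        ≡⟨ cong (λ x → ι 3 * (π * π) * ((ι 2 * π + 1ℚ) * (ι 3 * π + 1ℚ)) * (x * x * x * x * x * x) * val W * (s * val B * (s * val B)) * (s * (s * val B * val Γ)) * (e * e)) h²≡μ ⟩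
      ι 3 * (π * π) * ((ι 2 * π + 1ℚ) * (ι 3 * π + 1ℚ)) * val μ⁶ * val W * (s * val B * (s * val B)) * (s * (s * val B * val Γ)) * (e * e) ≡⟨ lem₂ π (val μ⁶) (val W) s (val B) (val Γ) e ⟩
      π * (π * (ι 3 * ((1ℚ + ι 2 * π) * (1ℚ + ι 3 * π)) * (e * e) * (val μ⁶ * (val B * val B) * val W * (val B * val Γ)))) * (s * s) * (s * s) ≡⟨ cong (λ x → π * (π * val κ′) * x * x) (sgn² P) ⟩
      π * (π * val κ′) * 1ℚ * 1ℚ ≡⟨ lem₃ (π * (π * val κ′)) ⟩
      π * (π * val κ′) ∎
      where
      e = val ε
      h = 2⁻^ P
      s = sgn P
      lem = solve 1 (λ x → x := x :* (con 1 :* con 1)) refl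
      lem₁ = solve 3 (λ f a e → f :* (a :* e :* (a :* e)) := f :* (a :* a) :* (e :* e)) refl
      lem₂ = solve 7 (λ π μ W s B Γ e →
        con 3 :* (π :* π) :* ((con 2 :* π :+ con 1) :* (con 3 :* π :+ con 1)) :* μ :* W :* (s :* B :* (s :* B)) :* (s :* (s :* B :* Γ)) :* (e :* e)
        := π :* (π :* (con 3 :* ((con 1 :+ con 2 :* π) :* (con 1 :+ con 3 :* π)) :* (e :* e) :* (μ :* (B :* B) :* W :* (B :* Γ)))) :* (s :* s) :* (s
          :* s)) refl
      lem₃ = solve 1 (λ x → x :* con 1 :* con 1 := x) refl

    F-last≡ : F P 0 ≡ π * (π * val φ′)
    F-last≡ = begin
      F P 0 ≡⟨ trans (lem (F P 0)) (cong (F P 0 *_) (sym ε-inverse)) ⟩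
      F P 0 * ((1ℚ + π) * e) ≡⟨ ℚ.*-assoc (F P 0) (1ℚ + π) e ⟨
      F P 0 * (1ℚ + π) * e ≡⟨ cong (_* e) F-last ⟩
      ι 6 * (π * π) * (ι 2 * π + 1ℚ) * (h * h * (h * h) * (h * h) * (h * h) * (h * h) * (h * h)) * (s * val B * (s * val B)) * (val W * val W) * e
        ≡⟨ cong (λ x → ι 6 * (π * π) * (ι 2 * π + 1ℚ) * (x * x * x * x * x * x) * (s * val B * (s * val B)) * (val W * val W) * e) h²≡μ ⟩
      ι 6 * (π * π) * (ι 2 * π + 1ℚ) * val μ⁶ * (s * val B * (s * val B)) * (val W * val W) * e ≡⟨ lem₂ π (val μ⁶) (val W) s (val B) e ⟩
      π * (π * val φ′) * (s * s) ≡⟨ cong (π * (π * val φ′) *_) (sgn² P) ⟩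
      π * (π * val φ′) * 1ℚ ≡⟨ ℚ.*-identityʳ (π * (π * val φ′)) ⟩
      π * (π * val φ′) ∎
      where
      e = val ε
      h = 2⁻^ P
      s = sgn P
      lem = solve 1 (λ x → x := x :* con 1) refl
      lem₂ = solve 6 (λ π μ W s B e →
        con 6 :* (π :* π) :* (con 2 :* π :+ con 1) :* μ :* (s :* B :* (s :* B)) :* (W :* W) :* e
        := π :* (π :* (con 6 :* (con 1 :+ con 2 :* π) :* e :* (μ :* (B :* B) :* (W :* W)))) :* (s :* s)) refl

    sum≡π²S′ : (∑[ k ≤ P ] summand (toℕ k)) ≡ π * (π * val S′)
    sum≡π²S′ = trans (∑summand≡diagonal P) (trans (diagonal≡) (trans (cong₂ (λ a b → a * (1ℚ + val R) + b) F-first≡ F-last≡) (lem π (val κ′) (val R) (val φ′))))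
      where
      lem = solve 4 (λ π κ r φ → π :* (π :* κ) :* (con 1 :+ r) :+ π :* (π :* φ) := π :* (π :* (κ :* (con 1 :+ r) :+ φ))) refl

    μ⁶B²≈μ² : val μ⁶ * (val B * val B) ≈[ 3 ] val μ * val μ
    μ⁶B²≈μ² = val μ⁶ * (val B * val B) ≈⟨ ≈-*ˡ μ⁶ (≈-trans (≈-*ˡ B B≈m²) (≈-*ʳ (⟦ M ⟧ ⊛ ⟦ M ⟧) B≈m²)) ⟩
      val μ⁶ * (m * m * (m * m)) ≐⟨ lem (val μ) m ⟩
      m * val μ * (m * val μ) * (m * val μ) * (m * val μ) * (val μ * val μ) ≐⟨ cong (λ x → x * x * x * x * (val μ * val μ)) mμ ⟩
      1ℚ * 1ℚ * 1ℚ * 1ℚ * (val μ * val μ) ≐⟨ lem₁ (val μ * val μ) ⟩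
      val μ * val μ ■
      where
      lem = solve 2 (λ u m → u :* u :* u :* u :* u :* u :* (m :* m :* (m :* m)) := m :* u :* (m :* u) :* (m :* u) :* (m :* u) :* (u :* u)) refl
      lem₁ = solve 1 (λ x → con 1 :* con 1 :* con 1 :* con 1 :* x := x) refl

    ≈-*1 : ∀ {x} (a z : ℤ₍ₚ₎) → x ≈[ 3 ] val a → val z ≈[ 3 ] 1ℚ → x * val z ≈[ 3 ] val a
    ≈-*1 {x} a z x≈a z≈1 = x * val z ≈⟨ ≈-*ʳ z x≈a ⟩
      val a * val z ≈⟨ ≈-*ˡ a z≈1 ⟩
      val a * 1ℚ ≐⟨ ℚ.*-identityʳ (val a) ⟩
      val a ■

    μ² : ℤ₍ₚ₎
    μ² = μ ⊛ μ

    κ″ φ″ : ℤ₍ₚ₎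
    κ″ = ⟦ 3 ⟧ ⊛ ((⟦ 1 ⟧ ⊕ ⟦ 2 ⟧ ⊛ Π) ⊛ (⟦ 1 ⟧ ⊕ ⟦ 3 ⟧ ⊛ Π)) ⊛ (ε ⊛ ε)
    φ″ = ⟦ 6 ⟧ ⊛ (⟦ 1 ⟧ ⊕ ⟦ 2 ⟧ ⊛ Π) ⊛ ε

    κ′≈ : val κ′ ≈[ 3 ] val κ″ * val μ²
    κ′≈ = ≈-*ˡ κ″ (≈-*1 μ² (B ⊛ Γ) (≈-*1 μ² W μ⁶B²≈μ² W≈1) BΓ≈1)

    φ′≈ : val φ′ ≈[ 3 ] val φ″ * val μ²
    φ′≈ = ≈-*ˡ φ″ (≈-trans (≡⇒≈ (sym (ℚ.*-assoc (val μ⁶ * (val B * val B)) (val W) (val W)))) (≈-*1 μ² W (≈-*1 μ² W μ⁶B²≈μ² W≈1) W≈1))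

    T′ : ℤ₍ₚ₎
    T′ = ⟦ 9 ⟧ ⊕ ⟦ 6 ⟧ ⊛ (Π ⊛ q) ⊕ ⊖ (⟦ 9 ⟧ ⊛ (Π ⊛ q ⊛ (Π ⊛ q)))

    D : ℤ₍ₚ₎
    D = ⟦ M ⟧ ⊛ ⟦ M ⟧ ⊛ ((⟦ 1 ⟧ ⊕ Π) ⊛ (⟦ 1 ⟧ ⊕ Π) ⊛ ((⟦ 1 ⟧ ⊕ Π) ⊛ (⟦ 1 ⟧ ⊕ Π)))

    -- Multiplication by D = m² (1 + p)⁴ removes all inverses, and leaves a polynomial
    -- congruence in p and q.
    S′≈T′ : val S′ ≈[ 3 ] val T′
    S′≈T′ = ≈-cancel D (μ² ⊛ (ε ⊛ ε ⊛ (ε ⊛ ε))) D-inverse (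
      val D * (val κ′ * (1ℚ + val R) + val φ′) ≈⟨ ≈-*ˡ D (≈-+ (≈-*ʳ (⟦ 1 ⟧ ⊕ R) κ′≈) φ′≈) ⟩
      val D * (val κ″ * val μ² * (1ℚ + val R) + val φ″ * val μ²) ≐⟨ lem π m (val μ) (val ε) (val R) ⟩
      g (m * val μ) ((1ℚ + π) * val ε) ((1ℚ + π) * (1ℚ + ι 2 * π) * val R) ≐⟨ cong₂ (λ a b → g a b ((1ℚ + π) * (1ℚ + ι 2 * π) * val R)) mμ ε-inverse ⟩
      g 1ℚ 1ℚ ((1ℚ + π) * (1ℚ + ι 2 * π) * val R) ≐⟨ lem₁ π ((1ℚ + π) * (1ℚ + ι 2 * π) * val R) ⟩
      g′ + val G′ * ((1ℚ + π) * (1ℚ + ι 2 * π) * val R) ≈⟨ ≈-+ (g′ ■) (≈-*ˡ G′ (R≈)) ⟩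
      g′ + val G′ * (ι 4 * (m * m) - c - 1ℚ - (1ℚ + π) * (1ℚ + ι 2 * π) + ι 3 * (π * π)) ≐⟨ lem₂ π m c ⟩
      g′ + (ι 3 * (1ℚ + ι 3 * π) * ((1ℚ + π) * (ι 4 * (m * m) - 1ℚ - (1ℚ + π) * (1ℚ + ι 2 * π) + ι 3 * (π * π)))) + - (ι 3 * (1ℚ + ι 3 * π)) * ((1ℚ + π) * c)
        ≐⟨ cong (λ x → g′ + g″ m + - (ι 3 * (1ℚ + ι 3 * π)) * x) C₂-middle ⟩
      g′ + g″ m + - (ι 3 * (1ℚ + ι 3 * π)) * (ι 2 * (1ℚ + ι 2 * π) * val W) ≈⟨ ≈-+ ((g′ + g″ m) ■) (≈-*ˡ (⊖ (⟦ 3 ⟧ ⊛ (⟦ 1 ⟧ ⊕ ⟦ 3 ⟧ ⊛ Π))) (≈-*ˡ (⟦ 2 ⟧ ⊛ (⟦ 1 ⟧ ⊕ ⟦ 2 ⟧ ⊛ Π)) W≈1)) ⟩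
      g′ + g″ m + - (ι 3 * (1ℚ + ι 3 * π)) * (ι 2 * (1ℚ + ι 2 * π) * 1ℚ) ≐⟨ cong (λ m → g′ + g″ m + - (ι 3 * (1ℚ + ι 3 * π)) * (ι 2 * (1ℚ + ι 2 * π) * 1ℚ)) m≡1+πq ⟩
      g′ + g″ (1ℚ + π * val q) + - (ι 3 * (1ℚ + ι 3 * π)) * (ι 2 * (1ℚ + ι 2 * π) * 1ℚ) ≈⟨ quot by lem₃ π (val q) ⟩
      (1ℚ + π * val q) * (1ℚ + π * val q) * ((1ℚ + π) * (1ℚ + π) * ((1ℚ + π) * (1ℚ + π))) * val T′ ≐⟨ cong (λ m → m * m * ((1ℚ + π) * (1ℚ + π) * ((1ℚ + π) * (1ℚ + π))) * val T′) m≡1+πq ⟨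
      val D * val T′ ■)
      where
      c = ι (suc (p ℕ.+ p) C p)
      g : ℚ → ℚ → ℚ → ℚ
      g a b r = ι 3 * (1ℚ + ι 2 * π) * (1ℚ + ι 3 * π) * (a * a) * (b * b) * ((1ℚ + π) * (1ℚ + π)) + ι 3 * (1ℚ + ι 3 * π) * (a * a) * (b * b) * (1ℚ + π) * r
        + ι 6 * (1ℚ + ι 2 * π) * (a * a) * b * ((1ℚ + π) * (1ℚ + π) * (1ℚ + π))
      g′ : ℚ
      g′ = ι 3 * (1ℚ + ι 2 * π) * (1ℚ + ι 3 * π) * ((1ℚ + π) * (1ℚ + π)) + ι 6 * (1ℚ + ι 2 * π) * ((1ℚ + π) * (1ℚ + π) * (1ℚ + π))
      G′ : ℤ₍ₚ₎
      G′ = ⟦ 3 ⟧ ⊛ (⟦ 1 ⟧ ⊕ ⟦ 3 ⟧ ⊛ Π) ⊛ (⟦ 1 ⟧ ⊕ Π)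
      g″ : ℚ → ℚ
      g″ m = ι 3 * (1ℚ + ι 3 * π) * ((1ℚ + π) * (ι 4 * (m * m) - 1ℚ - (1ℚ + π) * (1ℚ + ι 2 * π) + ι 3 * (π * π)))
      q² q³ q⁴ quot : ℤ₍ₚ₎
      q² = q ⊛ q
      q³ = q² ⊛ q
      q⁴ = q² ⊛ q²
      quot = ⟦ 42 ⟧ ⊕ ⊖ ⟦ 72 ⟧ ⊛ q ⊕ ⟦ 12 ⟧ ⊛ q³
        ⊕ Π ⊛ (⟦ 30 ⟧ ⊕ ⊖ ⟦ 96 ⟧ ⊛ q ⊕ ⊖ ⟦ 36 ⟧ ⊛ q² ⊕ ⟦ 48 ⟧ ⊛ q³ ⊕ ⟦ 9 ⟧ ⊛ q⁴
        ⊕ Π ⊛ (⊖ ⟦ 24 ⟧ ⊛ q ⊕ ⊖ ⟦ 48 ⟧ ⊛ q² ⊕ ⟦ 72 ⟧ ⊛ q³ ⊕ ⟦ 36 ⟧ ⊛ q⁴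
        ⊕ Π ⊛ (⊖ ⟦ 12 ⟧ ⊛ q² ⊕ ⟦ 48 ⟧ ⊛ q³ ⊕ ⟦ 54 ⟧ ⊛ q⁴
        ⊕ Π ⊛ (⟦ 12 ⟧ ⊛ q³ ⊕ ⟦ 36 ⟧ ⊛ q⁴
        ⊕ Π ⊛ (⟦ 9 ⟧ ⊛ q⁴)))))
      D-inverse : val D * val (μ² ⊛ (ε ⊛ ε ⊛ (ε ⊛ ε))) ≡ 1ℚ
      D-inverse = trans (lem₄ m (1ℚ + π) (val μ) (val ε)) (cong₂ (λ a b → a * a * (b * b * (b * b))) mμ ε-inverse)
        where
        lem₄ : ∀ m a u e → m * m * (a * a * (a * a)) * (u * u * (e * e * (e * e))) ≡ m * u * (m * u) * (a * e * (a * e) * (a * e * (a * e)))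
        lem₄ = solve-∀ ℚ-ring
      lem : ∀ π m u e r →
        m * m * ((1ℚ + π) * (1ℚ + π) * ((1ℚ + π) * (1ℚ + π))) * (ι 3 * ((1ℚ + ι 2 * π) * (1ℚ + ι 3 * π)) * (e * e) * (u * u) * (1ℚ + r) + ι 6 * (1ℚ + ι 2 * π) * e * (u * u))
        ≡ ι 3 * (1ℚ + ι 2 * π) * (1ℚ + ι 3 * π) * (m * u * (m * u)) * ((1ℚ + π) * e * ((1ℚ + π) * e)) * ((1ℚ + π) * (1ℚ + π))
          + ι 3 * (1ℚ + ι 3 * π) * (m * u * (m * u)) * ((1ℚ + π) * e * ((1ℚ + π) * e)) * (1ℚ + π) * ((1ℚ + π) * (1ℚ + ι 2 * π) * r)
          + ι 6 * (1ℚ + ι 2 * π) * (m * u * (m * u)) * ((1ℚ + π) * e) * ((1ℚ + π) * (1ℚ + π) * (1ℚ + π))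
      lem = solve-∀ ℚ-ring
      lem₁ : ∀ π r → ι 3 * (1ℚ + ι 2 * π) * (1ℚ + ι 3 * π) * (1ℚ * 1ℚ) * (1ℚ * 1ℚ) * ((1ℚ + π) * (1ℚ + π)) + ι 3 * (1ℚ + ι 3 * π) * (1ℚ * 1ℚ) * (1ℚ * 1ℚ) * (1ℚ + π) * r
        + ι 6 * (1ℚ + ι 2 * π) * (1ℚ * 1ℚ) * 1ℚ * ((1ℚ + π) * (1ℚ + π) * (1ℚ + π))
        ≡ ι 3 * (1ℚ + ι 2 * π) * (1ℚ + ι 3 * π) * ((1ℚ + π) * (1ℚ + π)) + ι 6 * (1ℚ + ι 2 * π) * ((1ℚ + π) * (1ℚ + π) * (1ℚ + π)) + ι 3 * (1ℚ + ι 3 * π) * (1ℚ + π) * r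
      lem₁ = solve-∀ ℚ-ring
      lem₂ : ∀ π m c → ι 3 * (1ℚ + ι 2 * π) * (1ℚ + ι 3 * π) * ((1ℚ + π) * (1ℚ + π)) + ι 6 * (1ℚ + ι 2 * π) * ((1ℚ + π) * (1ℚ + π) * (1ℚ + π))
        + ι 3 * (1ℚ + ι 3 * π) * (1ℚ + π) * (ι 4 * (m * m) - c - 1ℚ - (1ℚ + π) * (1ℚ + ι 2 * π) + ι 3 * (π * π))
        ≡ ι 3 * (1ℚ + ι 2 * π) * (1ℚ + ι 3 * π) * ((1ℚ + π) * (1ℚ + π)) + ι 6 * (1ℚ + ι 2 * π) * ((1ℚ + π) * (1ℚ + π) * (1ℚ + π))
        + (ι 3 * (1ℚ + ι 3 * π) * ((1ℚ + π) * (ι 4 * (m * m) - 1ℚ - (1ℚ + π) * (1ℚ + ι 2 * π) + ι 3 * (π * π)))) + - (ι 3 * (1ℚ + ι 3 * π)) * ((1ℚ + π) * c)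
      lem₂ = solve-∀ ℚ-ring
      lem₃ : ∀ π q → ι 3 * (1ℚ + ι 2 * π) * (1ℚ + ι 3 * π) * ((1ℚ + π) * (1ℚ + π)) + ι 6 * (1ℚ + ι 2 * π) * ((1ℚ + π) * (1ℚ + π) * (1ℚ + π))
        + ι 3 * (1ℚ + ι 3 * π) * ((1ℚ + π) * (ι 4 * ((1ℚ + π * q) * (1ℚ + π * q)) - 1ℚ - (1ℚ + π) * (1ℚ + ι 2 * π) + ι 3 * (π * π))) + - (ι 3 * (1ℚ + ι 3 * π)) * (ι 2 * (1ℚ + ι 2 * π) * 1ℚ)
        ≡ (1ℚ + π * q) * (1ℚ + π * q) * ((1ℚ + π) * (1ℚ + π) * ((1ℚ + π) * (1ℚ + π))) * (ι 9 + ι 6 * (π * q) + - (ι 9 * (π * q * (π * q))))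
        + π * (π * (π * 1ℚ)) * (ι 42 + - ι 72 * q + ι 12 * (q * q * q)
          + π * (ι 30 + - ι 96 * q + - ι 36 * (q * q) + ι 48 * (q * q * q) + ι 9 * (q * q * (q * q))
          + π * (- ι 24 * q + - ι 48 * (q * q) + ι 72 * (q * q * q) + ι 36 * (q * q * (q * q))
          + π * (- ι 12 * (q * q) + ι 48 * (q * q * q) + ι 54 * (q * q * (q * q))
          + π * (ι 12 * (q * q * q) + ι 36 * (q * q * (q * q))
          + π * (ι 9 * (q * q * (q * q))))))))
      lem₃ = solve-∀ ℚ-ring

    q≡ : fermatQuotient p 2 ≡ val q
    q≡ = begin
      fq ≡⟨ ℚ.*-identityʳ fq ⟨
      fq * 1ℚ ≡⟨ cong (fq *_) inverse-p ⟨
      fq * (π * recip 2P) ≡⟨ ℚ.*-assoc fq π (recip 2P) ⟨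
      fq * π * recip 2P ≡⟨ cong (_* recip 2P) (trans (/-*-cancel (ℤ.+ M ℤ.- ℤ.+ 1) p) (trans (/1-homo-+ (ℤ.+ M) (ℤ.- (ℤ.+ 1))) m-1≡πq)) ⟩
      π * val q * recip 2P ≡⟨ lem π (val q) (recip 2P) ⟩
      π * recip 2P * val q ≡⟨ trans (cong (_* val q) inverse-p) (ℚ.*-identityˡ (val q)) ⟩
      val q ∎
      where
      fq = fermatQuotient p 2
      inverse-p : π * recip 2P ≡ 1ℚ
      inverse-p = trans (cong (_* recip 2P) (ι-suc 2P)) (recip-inverse 2P)
      lem = solve 3 (λ a b c → a :* b :* c := a :* c :* b) refl

    main : (∑[ k ≤ P ] summand (toℕ k))
      ≅ fromℕ 9 * fromℕ p ^ 2 + fromℕ 6 * fromℕ p ^ 3 * fermatQuotient p 2 - fromℕ 9 * fromℕ p ^ 4 * fermatQuotient p 2 ^ 2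
      [mod p ℕ.^ 5 ]inℤ₍ p ₎
    main = go S′≈T′
      where
      lhsᶻ rhsᶻ : ℤ₍ₚ₎
      lhsᶻ = Π ⊛ (Π ⊛ S′)
      rhsᶻ = Π ⊛ (Π ⊛ T′)
      f : ℚ → ℚ
      f q = fromℕ 9 * (π * (π * 1ℚ)) + fromℕ 6 * (π * (π * (π * 1ℚ))) * q - fromℕ 9 * (π * (π * (π * (π * 1ℚ)))) * (q * (q * 1ℚ))
      lem = solve 2 (λ π q →
        π :* (π :* (con 9 :+ con 6 :* (π :* q) :+ :- (con 9 :* (π :* q :* (π :* q)))))
        := con 9 :* (π :* (π :* con 1)) :+ con 6 :* (π :* (π :* (π :* con 1))) :* q :- con 9 :* (π :* (π :* (π :* (π :* con 1)))) :* (q :* (q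
          :* con 1))) refl
      lem₁ = solve 3 (λ π t w →
        π :* (π :* (t :+ π :* (π :* (π :* con 1)) :* w)) :- π :* (π :* t)
        := π :* (π :* (π :* (π :* (π :* con 1)))) :* w) refl
      rhs≡ : val rhsᶻ ≡ f (fermatQuotient p 2)
      rhs≡ = trans (lem π (val q)) (cong f (sym q≡))
      ι-^ : ∀ n → ι (p ℕ.^ n) ≡ π ^ n
      ι-^ zero = refl
      ι-^ (suc n) = trans (ι-* p (p ℕ.^ n)) (cong (π *_) (ι-^ n))
      go : val S′ ≈[ 3 ] val T′ → (∑[ k ≤ P ] summand (toℕ k)) ≅ f (fermatQuotient p 2) [mod p ℕ.^ 5 ]inℤ₍ p ₎
      go (w by eq) = congruence
        (subst (Integral p) (sym sum≡π²S′) (isIntegral⇒Integral (integral lhsᶻ)))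
        (subst (Integral p) rhs≡ (isIntegral⇒Integral (integral rhsᶻ)))
        (val w)
        (isIntegral⇒Integral (integral w))
        (begin
          (∑[ k ≤ P ] summand (toℕ k)) - f (fermatQuotient p 2) ≡⟨ cong₂ _-_ (trans sum≡π²S′ (cong (λ x → π * (π * x)) eq)) (sym rhs≡) ⟩
          π * (π * (val T′ + π * (π * (π * 1ℚ)) * val w)) - π * (π * val T′) ≡⟨ lem₁ π (val T′) (val w) ⟩
          π * (π * (π * (π * (π * 1ℚ)))) * val w ≡⟨ cong (_* val w) (ι-^ 5) ⟨
          fromℕ (p ℕ.^ 5) * val w ∎)

odd-prime : ∀ {p} → Prime p → 2 < p → p ≡ suc ((p ∸ 1) ℕ./ 2 ℕ.+ (p ∸ 1) ℕ./ 2)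
odd-prime {suc n} p-prime 2<p with n ℕ.% 2 in eq | ℕ.m%n<n n 2
... | 0 | _ = cong suc (trans (ℕ.m≡m%n+[m/n]*n n 2) (trans (cong (ℕ._+ n ℕ./ 2 ℕ.* 2) eq) (lem (n ℕ./ 2))))
  where
  lem : ∀ x → x ℕ.* 2 ≡ x ℕ.+ x
  lem x = trans (ℕ.*-comm x 2) (cong (x ℕ.+_) (ℕ.+-identityʳ x))
... | 1 | _ with prime⇒irreducible p-prime (divides (suc (n ℕ./ 2)) (cong suc (trans (ℕ.m≡m%n+[m/n]*n n 2) (cong (ℕ._+ n ℕ./ 2 ℕ.* 2) eq))))
...   | inj₂ refl = contradiction 2<p (ℕ.<-irrefl refl)
odd-prime {suc n} _ _ | suc (suc _) | s≤s (s≤s ())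

theorem-odd : ∀ P (p-prime : Prime (suc (P ℕ.+ P))) → 0 < P → let p = suc (P ℕ.+ P); q = fermatQuotient p 2 {{prime⇒nonZero p-prime}} in
  (∑[ k ≤ P ] summand (toℕ k))
    ≅ fromℕ 9 * fromℕ p ^ 2 + fromℕ 6 * fromℕ p ^ 3 * q - fromℕ 9 * fromℕ p ^ 4 * q ^ 2
    [mod p ℕ.^ 5 ]inℤ₍ p ₎
-- Wolstenholme's theorem fails for p = 3, where both sides are evaluated instead.
theorem-odd 1 p-prime _ = congruence (λ (_ , d∣1) → ℕ.∣1⇒≡1 d∣1) (λ (_ , d∣1) → ℕ.∣1⇒≡1 d∣1) (fromℕ 2) (λ (_ , d∣1) → ℕ.∣1⇒≡1 d∣1) refl
theorem-odd (suc (suc n)) p-prime _ = OddPrime.Assembly.main (suc (suc n)) p-prime (s≤s (s≤s z≤n)) (suc n) refl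

theorem1p1 : (p : ℕ) (p-prime : Prime p) → 2 < p →
    let q = fermatQuotient p 2 {{prime⇒nonZero p-prime}} in
    (∑[ k ≤ (p ∸ 1) ℕ./ 2 ] summand (toℕ k))
    ≅ fromℕ 9 * fromℕ p ^ 2 + fromℕ 6 * fromℕ p ^ 3 * q - fromℕ 9 * fromℕ p ^ 4 * q ^ 2
    [mod p ℕ.^ 5 ]inℤ₍ p ₎
theorem1p1 p p-prime 2<p = go ((p ∸ 1) ℕ./ 2) (odd-prime p-prime 2<p) p-prime 2<p
  where
  go : ∀ P {p} → p ≡ suc (P ℕ.+ P) → (p-prime : Prime p) → 2 < p → let q = fermatQuotient p 2 {{prime⇒nonZero p-prime}} in
    (∑[ k ≤ P ] summand (toℕ k))
      ≅ fromℕ 9 * fromℕ p ^ 2 + fromℕ 6 * fromℕ p ^ 3 * q - fromℕ 9 * fromℕ p ^ 4 * q ^ 2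
      [mod p ℕ.^ 5 ]inℤ₍ p ₎
  go zero    refl p-prime (s≤s ())
  go (suc n) refl p-prime _ = theorem-odd (suc n) p-prime (s≤s z≤n)
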